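{- Let $G$ be a graph with maximum degree $\Delta\ge 3$. Then $$\pi_l(G) \le \left\lceil \Delta^2 + \frac{3}{2^{2/3}}\Delta^{5/3} + \frac{2^{2/3}\Delta^{5/3}}{\Delta^{1/3}-2^{1/3}}\right\rceil.$$
   Context: In a vertex-colored graph, a $2j$-repetition is a path $v_1v_2\dots v_{2j}$ on $2j$ vertices with $c(v_i)=c(v_{i+j})$ for all $1\le i\le j$. A vertex-coloring is non-repetitive if it contains no $2j$-repetition for any $j\ge1$. $\pi_l(G)$, the non-repetitive choice number, is the minimum $k$ such that for every assignment of lists of size at least $k$ to the vertices, $G$ has a non-repetitive coloring in which every vertex receives a color from its list. -}

module Defs where

module Colouring where

  open import Data.Fin as Fin using (Fin; zero; suc; toℕ; _↑ˡ_; _↑ʳ_)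
  import Data.Fin.Properties as Fin
  open import Data.List.Base using (List; _∷_; []; length; filter; allFin)
  import Data.List.Base as List
  open import Data.List.Extrema.Nat using (max)
  open import Data.List.Membership.Propositional using (_∈_; _∉_)
  import Data.List.Membership.DecPropositional as DecMembership
  open import Data.List.Membership.Propositional.Properties using (∈-lookup; ∈-tabulate⁻)
  open import Data.List.Properties using (length-tabulate)
  import Data.List.Relation.Unary.All as All
  import Data.List.Relation.Unary.All.Properties as All
  open import Data.List.Relation.Unary.AllPairs using () renaming (_∷_ to _∷ᵘ_)
  import Data.List.Relation.Unary.Any as Any
  open import Data.List.Relation.Unary.Any using (here; there)
  import Data.List.Relation.Unary.Any.Properties as Any
  open import Data.List.Relation.Unary.Unique.Propositional using (Unique)
  import Data.List.Relation.Unary.Unique.Propositional.Properties as Unique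
  open import Data.Nat as ℕ using (ℕ; zero; suc; _≤_; _<_; z≤n; s≤s)
  import Data.Nat.Properties as ℕ
  open import Data.Product using (Σ-syntax; ∃; ∃-syntax; _×_; _,_; proj₁; proj₂)
  open import Data.Vec as Vec using (Vec; []; _∷_; lookup)
  import Data.Vec.Properties as Vec
  open import Data.Vec.Relation.Unary.AllPairs as VecPairs using ()
  open import Data.Vec.Relation.Unary.Linked using (Linked; linked?)
  import Data.Vec.Relation.Unary.Unique.Propositional as Vec
  import Data.Vec.Relation.Unary.Unique.Propositional.Properties as VecUnique
  open import Function using (_∘_)
  open import Function.Definitions using (Injective)
  open import Relation.Binary using (Rel; Symmetric; Irreflexive; Decidable)
  open import Relation.Binary.PropositionalEquality
  open import Relation.Nullary using (Dec; yes; no; ¬_; ¬?; contradiction)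
  open import Relation.Nullary.Decidable
    using (map′; _×-dec_; _→-dec_; decidable-stable)
  open import Level using (0ℓ)

  record Graph : Set₁ where
    infix 4 _~_ _~?_
    field
      order    : ℕ
      _~_      : Rel (Fin order) 0ℓ
      ~-sym    : Symmetric _~_
      ~-irrefl : Irreflexive _≡_ _~_
      _~?_     : Decidable _~_

    Vertex : Set
    Vertex = Fin order

    degree : Vertex → ℕ
    degree v = length (filter (v ~?_) (allFin order))

    maxDegree : ℕ
    maxDegree = max 0 (List.map degree (allFin order))

  module _ (G : Graph) where
    open Graph G

    IsPath : ∀ {m} → Vec Vertex m → Set
    IsPath p = Linked _~_ p × Vec.Unique p

    -- The path v₁ … v₂ⱼ is p, with 0-based halves i ↑ˡ j (that is i) and j ↑ʳ i (that is j + i).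
    Repetition : (Vertex → ℕ) → ℕ → Set
    Repetition c j = Σ[ p ∈ Vec Vertex (j ℕ.+ j) ] IsPath p ×
      (∀ (i : Fin j) → c (lookup p (i ↑ˡ j)) ≡ c (lookup p (j ↑ʳ i)))

    NonRepetitive : (Vertex → ℕ) → Set
    NonRepetitive c = ∀ j → 1 ≤ j → ¬ Repetition c j

    -- Lists are duplicate-free, so that their length is the number of colours on offer.
    Choosable : ℕ → Set
    Choosable k = (L : Vertex → List ℕ) →
      (∀ v → Unique (L v)) → (∀ v → k ≤ length (L v)) →
      ∃[ c ] (∀ v → c v ∈ L v) × NonRepetitive c

  private
    Searchable : Set → Set₁
    Searchable A = {P : A → Set} → (∀ a → Dec (P a)) → Dec (∃ P)

    search-Vec : ∀ {A} → Searchable A → ∀ m → Searchable (Vec A m)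
    search-Vec s zero    P? = map′ ([] ,_) (λ { ([] , p) → p }) (P? [])
    search-Vec s (suc m) P? =
      map′ (λ { (x , xs , p) → x ∷ xs , p }) (λ { (x ∷ xs , p) → x , xs , p })
        (s λ x → search-Vec s m λ xs → P? (x ∷ xs))

    all-dec : ∀ {A} → Searchable A → {P : A → Set} → (∀ a → Dec (P a)) → Dec (∀ a → P a)
    all-dec s P? = map′
      (λ ¬∃ a → decidable-stable (P? a) λ ¬p → ¬∃ (a , ¬p))
      (λ { f (a , ¬p) → ¬p (f a) })
      (¬? (s λ a → ¬? (P? a)))

    least : ∀ {P : ℕ → Set} → (∀ k → Dec (P k)) → ∀ n → P n →
            ∃[ k ] P k × (∀ j → P j → k ≤ j)
    least P? zero    p = 0 , p , λ _ _ → z≤n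
    least P? (suc n) p with P? 0
    ... | yes p₀ = 0 , p₀ , λ _ _ → z≤n
    ... | no ¬p₀ with least (P? ∘ suc) n p
    ...   | k , pk , min = suc k , pk , λ where
      zero    p₀ → contradiction p₀ ¬p₀
      (suc j) pj → s≤s (min j pj)

    list-lookup-injective : ∀ {xs : List ℕ} → Unique xs → ∀ i j →
                            List.lookup xs i ≡ List.lookup xs j → i ≡ j
    list-lookup-injective (_ ∷ᵘ _)   zero    zero    _  = refl
    list-lookup-injective (px ∷ᵘ _)  zero    (suc j) eq =
      contradiction eq (All.lookup px (∈-lookup j))
    list-lookup-injective (px ∷ᵘ _)  (suc i) zero    eq =
      contradiction (sym eq) (All.lookup px (∈-lookup i))
    list-lookup-injective (_ ∷ᵘ pxs) (suc i) (suc j) eq =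
      cong suc (list-lookup-injective pxs i j eq)

    fresh : (xs ys : List ℕ) → Unique xs → length ys < length xs → ∃[ x ] x ∈ xs × x ∉ ys
    fresh xs ys uniq lt with Fin.any? (λ i → ¬? (List.lookup xs i ∈? ys))
      where open DecMembership ℕ._≟_ using (_∈?_)
    ... | yes (i , x∉ys) = List.lookup xs i , ∈-lookup i , x∉ys
    ... | no  none       = contradiction (Fin.injective⇒≤ index-injective) (ℕ.<⇒≱ lt)
      where
      open DecMembership ℕ._≟_ using (_∈?_)
      mem : ∀ i → List.lookup xs i ∈ ys
      mem i = decidable-stable (List.lookup xs i ∈? ys) (λ x∉ys → none (i , x∉ys))
      index-injective : Injective _≡_ _≡_ (Any.index ∘ mem)
      index-injective {i} {j} eq = list-lookup-injective uniq i j (begin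
        List.lookup xs i                     ≡⟨ Any.lookup-index (mem i) ⟩
        List.lookup ys (Any.index (mem i))   ≡⟨ cong (List.lookup ys) eq ⟩
        List.lookup ys (Any.index (mem j))   ≡⟨ Any.lookup-index (mem j) ⟨
        List.lookup xs j                     ∎)
        where open ≡-Reasoning

    distinctChoice : ∀ m (used : List ℕ) (L : Fin m → List ℕ) →
      (∀ v → Unique (L v)) → (∀ v → length used ℕ.+ m ≤ length (L v)) →
      ∃[ c ] (∀ v → c v ∈ L v) × (∀ v → c v ∉ used) × Injective _≡_ _≡_ c
    distinctChoice zero    used L uniq len = (λ ()) , (λ ()) , (λ ()) , λ { {()} }
    distinctChoice (suc m) used L uniq len
      with fresh (L zero) used (uniq zero)
             (ℕ.≤-trans (subst (suc (length used) ≤_) (sym (ℕ.+-suc _ m)) (s≤s (ℕ.m≤m+n _ m))) (len zero))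
    ... | x , x∈ , x∉
      with distinctChoice m (x ∷ used) (L ∘ suc) (uniq ∘ suc)
             (λ v → subst (_≤ length (L (suc v))) (ℕ.+-suc (length used) m) (len (suc v)))
    ...   | c , c∈ , c∉ , inj = c′ , c′∈ , c′∉ , c′-inj
      where
      c′ : Fin (suc m) → ℕ
      c′ zero    = x
      c′ (suc v) = c v
      c′∈ : ∀ v → c′ v ∈ L v
      c′∈ zero    = x∈
      c′∈ (suc v) = c∈ v
      c′∉ : ∀ v → c′ v ∉ used
      c′∉ zero    = x∉
      c′∉ (suc v) = c∉ v ∘ there
      c′-inj : Injective _≡_ _≡_ c′
      c′-inj {zero}  {zero}  _  = refl
      c′-inj {zero}  {suc w} eq = contradiction (here (sym eq)) (c∉ w)
      c′-inj {suc v} {zero}  eq = contradiction (here eq) (c∉ v)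
      c′-inj {suc v} {suc w} eq = cong suc (inj eq)

  module _ (G : Graph) where
    open Graph G

    private
      repetition? : ∀ c j → Dec (Repetition G c j)
      repetition? c j = search-Vec Fin.any? (j ℕ.+ j) λ p →
        (linked? _~?_ p ×-dec VecPairs.allPairs? (λ x y → ¬? (x Fin.≟ y)) p)
        ×-dec Fin.all? (λ i → c (lookup p (i ↑ˡ j)) ℕ.≟ c (lookup p (j ↑ʳ i)))

      repetition-bounded : ∀ c {j} → Repetition G c j → j ≤ order
      repetition-bounded c {j} (p , (_ , uniq) , _) =
        ℕ.≤-trans (ℕ.m≤m+n j j)
          (Fin.injective⇒≤ (λ {x} {y} → VecUnique.lookup-injective uniq x y))

      nonRepetitive? : ∀ c → Dec (NonRepetitive G c)
      nonRepetitive? c = map′ to from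
        (Fin.all? {n = suc order} λ j →
          (1 ℕ.≤? toℕ j) →-dec ¬? (repetition? c (toℕ j)))
        where
        from : NonRepetitive G c →
               ∀ (j : Fin (suc order)) → 1 ≤ toℕ j → ¬ Repetition G c (toℕ j)
        from h j = h (toℕ j)
        to : (∀ (j : Fin (suc order)) → 1 ≤ toℕ j → ¬ Repetition G c (toℕ j)) →
             NonRepetitive G c
        to h j 1≤j r = h (Fin.fromℕ< j<) (subst (1 ≤_) (sym eq) 1≤j)
                         (subst (Repetition G c) (sym eq) r)
          where
          j< : j < suc order
          j< = s≤s (repetition-bounded c r)
          eq : toℕ (Fin.fromℕ< j<) ≡ j
          eq = Fin.toℕ-fromℕ< j<

      injective⇒nonRepetitive : ∀ c → Injective _≡_ _≡_ c → NonRepetitive G c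
      injective⇒nonRepetitive c inj (suc j) _ (p , (_ , uniq) , same) =
        0≢ (VecUnique.lookup-injective uniq _ _ (inj (same zero)))
        where
        0≢ : zero {n = j ℕ.+ suc j} ≡ suc (j ↑ʳ zero) → _
        0≢ ()

      order-choosable : Choosable G order
      order-choosable L uniq len with distinctChoice order [] L uniq len
      ... | c , c∈ , _ , inj = c , c∈ , injective⇒nonRepetitive c inj

      module _ (k : ℕ) where
        palette : ℕ
        palette = suc (order ℕ.* k)

        Lists : Set
        Lists = Vec (Vec (Fin palette) k) order

        colour : Lists → Vec (Fin k) order → Vertex → ℕ
        colour M f v = toℕ (lookup (lookup M v) (lookup f v))

        -- Choosability restricted to lists of size exactly k over a finite palette.
        FiniteChoosable : Set
        FiniteChoosable = (M : Lists) →
          (∀ v i j → lookup (lookup M v) i ≡ lookup (lookup M v) j → i ≡ j) →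
          ∃[ f ] NonRepetitive G (colour M f)

        finiteChoosable? : Dec FiniteChoosable
        finiteChoosable? = all-dec (search-Vec (search-Vec Fin.any? k) order) λ M →
          Fin.all? (λ v → Fin.all? λ i → Fin.all? λ j →
            (lookup (lookup M v) i Fin.≟ lookup (lookup M v) j) →-dec (i Fin.≟ j))
          →-dec search-Vec Fin.any? order (λ f → nonRepetitive? (colour M f))

        nonRepetitive-resp : ∀ {c d : Vertex → ℕ} → (∀ v w → d v ≡ d w → c v ≡ c w) →
                             NonRepetitive G c → NonRepetitive G d
        nonRepetitive-resp h nr j 1≤j (p , path , same) =
          nr j 1≤j (p , path , λ i → h _ _ (same i))

        choosable⇒finite : Choosable G k → FiniteChoosable
        choosable⇒finite ch M inj
          with ch (λ v → List.tabulate (toℕ ∘ lookup (lookup M v)))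
                  (λ v → Unique.tabulate⁺ (λ eq → inj v _ _ (Fin.toℕ-injective eq)))
                  (λ v → ℕ.≤-reflexive (sym (length-tabulate _)))
        ... | c , c∈ , nr = Vec.tabulate f , nonRepetitive-resp reflects nr
          where
          f : Vertex → Fin k
          f v = proj₁ (∈-tabulate⁻ (c∈ v))
          c≡ : ∀ v → c v ≡ colour M (Vec.tabulate f) v
          c≡ v = trans (proj₂ (∈-tabulate⁻ (c∈ v)))
            (cong (toℕ ∘ lookup (lookup M v)) (sym (Vec.lookup∘tabulate f v)))
          reflects : ∀ v w → colour M (Vec.tabulate f) v ≡ colour M (Vec.tabulate f) w → c v ≡ c w
          reflects v w eq = trans (c≡ v) (trans eq (sym (c≡ w)))

        finite⇒choosable : FiniteChoosable → Choosable G k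
        finite⇒choosable fc L uniq len = c , c∈ , nr
          where
          row : Vertex → Fin k → ℕ
          row v i = List.lookup (L v) (Fin.inject≤ i (len v))

          row-injective : ∀ v i j → row v i ≡ row v j → i ≡ j
          row-injective v i j eq =
            Fin.inject≤-injective _ _ i j (list-lookup-injective (uniq v) _ _ eq)

          entry : Fin (order ℕ.* k) → ℕ
          entry x = row (proj₁ (Fin.remQuot {order} k x)) (proj₂ (Fin.remQuot {order} k x))

          entry-combine : ∀ v i → entry (Fin.combine v i) ≡ row v i
          entry-combine v i =
            cong (λ q → row (proj₁ q) (proj₂ q)) (Fin.remQuot-combine v i)

          rename : ℕ → Fin palette
          rename x with Fin.any? (λ i → entry i ℕ.≟ x)
          ... | yes (i , _) = suc i
          ... | no  _       = zero

          rename-injective : ∀ v i w j → rename (row v i) ≡ rename (row w j) → row v i ≡ row w j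
          rename-injective v i w j eq
            with Fin.any? (λ x → entry x ℕ.≟ row v i) | Fin.any? (λ x → entry x ℕ.≟ row w j)
          ... | no ¬p       | _           = contradiction (_ , entry-combine v i) ¬p
          ... | _           | no ¬p       = contradiction (_ , entry-combine w j) ¬p
          ... | yes (x , p) | yes (y , q) =
            trans (sym p) (trans (cong entry (Fin.suc-injective eq)) q)

          M : Lists
          M = Vec.tabulate λ v → Vec.tabulate λ i → rename (row v i)

          M≡ : ∀ v i → lookup (lookup M v) i ≡ rename (row v i)
          M≡ v i = trans (cong (λ r → lookup r i) (Vec.lookup∘tabulate _ v))
                         (Vec.lookup∘tabulate _ i)

          result : ∃[ f ] NonRepetitive G (colour M f)
          result = fc M λ v i j eq → row-injective v i j (rename-injective v i v j
            (trans (sym (M≡ v i)) (trans eq (M≡ v j))))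

          f : Vec (Fin k) order
          f = proj₁ result

          c : Vertex → ℕ
          c v = row v (lookup f v)

          c∈ : ∀ v → c v ∈ L v
          c∈ v = ∈-lookup (Fin.inject≤ (lookup f v) (len v))

          nr : NonRepetitive G c
          nr = nonRepetitive-resp {colour M f}
            (λ v w eq → cong toℕ (trans (M≡ v (lookup f v)) (trans (cong rename eq) (sym (M≡ w (lookup f w))))))
            (proj₂ result)

        choosable? : Dec (Choosable G k)
        choosable? = map′ finite⇒choosable choosable⇒finite finiteChoosable?

    abstract
      minimalChoosable : ∃[ k ] Choosable G k × (∀ j → Choosable G j → k ≤ j)
      minimalChoosable = least choosable? order order-choosable

    -- The non-repetitive choice number.
    πₗ : ℕ
    πₗ = proj₁ minimalChoosable

module Reals where

  open import Data.Empty using (⊥)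
  open import Data.Integer as ℤ using (ℤ)
  import Data.Integer.Properties as ℤ
  open import Data.Nat as ℕ using (ℕ; zero; suc; z≤n; s≤s)
  import Data.Nat.Properties as ℕ
  open import Data.Product using (Σ-syntax; ∃; ∃-syntax; ∃₂; _×_; _,_; proj₁; proj₂)
  open import Data.Rational as ℚ using (ℚ; mkℚ; 0ℚ; 1ℚ; ½; _+_; _*_; -_; _-_; _<_; _≤_; _⊔_; _⊓_; ∣_∣; _/_; toℚᵘ)
  import Data.Rational.Properties as ℚ
  open import Data.Rational.Solver using (module +-*-Solver)
  open import Data.Rational.Unnormalised as ℚᵘ using (mkℚᵘ)
  import Data.Rational.Unnormalised.Properties as ℚᵘ
  open import Data.Sum using (_⊎_; inj₁; inj₂)
  open import Function using (_∘_)
  open import Relation.Binary.PropositionalEquality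
  open import Relation.Nullary using (Dec; yes; no; ¬_; contradiction)
  open import Relation.Nullary.Decidable using (from-yes)

  -- Dedekind cuts of ℚ: Lower x p means p < x and Upper x q means x < q.
  record ℝ : Set₁ where
    field
      Lower Upper  : ℚ → Set
      lower-closed : ∀ {p q} → p < q → Lower q → Lower p
      lower-open   : ∀ {p} → Lower p → ∃[ q ] p < q × Lower q
      upper-closed : ∀ {p q} → p < q → Upper p → Upper q
      upper-open   : ∀ {q} → Upper q → ∃[ p ] p < q × Upper p
      lower<upper  : ∀ {p q} → Lower p → Upper q → p < q
      located      : ∀ ε → 0ℚ < ε → ∃₂ λ p q → Lower p × Upper q × q < p + ε

  open ℝ

  infix 4 _≤ᵣ_ 0<ᵣ_

  _≤ᵣ_ : ℝ → ℝ → Set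
  x ≤ᵣ y = ∀ p → Lower x p → Lower y p

  0<ᵣ_ : ℝ → Set
  0<ᵣ x = Lower x 0ℚ

  private
    recip : ∀ p → 0ℚ < p → ∃[ r ] 0ℚ < r × r * p ≡ 1ℚ
    recip p 0<p = (ℚ.1/ p) , ℚ.positive⁻¹ (ℚ.1/ p) ⦃ ℚ.1/pos⇒pos p ⦄ , ℚ.*-inverseˡ p
      where instance
        _ = ℚ.positive 0<p
        _ = ℚ.pos⇒nonZero p

    *-pos : ∀ {p q} → 0ℚ < p → 0ℚ < q → 0ℚ < p * q
    *-pos {p} {q} 0<p 0<q = ℚ.positive⁻¹ (p * q) ⦃ ℚ.pos*pos⇒pos p q ⦄
      where instance
        _ = ℚ.positive 0<p
        _ = ℚ.positive 0<q

    *-mono-≤ : ∀ {p q r s} → 0ℚ ≤ p → 0ℚ ≤ s → p ≤ q → r ≤ s → p * r ≤ q * s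
    *-mono-≤ {p} {q} {r} {s} 0≤p 0≤s p≤q r≤s = ℚ.≤-trans
      (ℚ.*-monoˡ-≤-nonNeg p ⦃ ℚ.nonNegative 0≤p ⦄ r≤s)
      (ℚ.*-monoʳ-≤-nonNeg s ⦃ ℚ.nonNegative 0≤s ⦄ p≤q)

    *-monoʳ-< : ∀ {p q r} → 0ℚ < r → p < q → p * r < q * r
    *-monoʳ-< {r = r} 0<r = ℚ.*-monoˡ-<-pos r ⦃ ℚ.positive 0<r ⦄

    *-cancelʳ-< : ∀ {p q} r → 0ℚ < r → p * r < q * r → p < q
    *-cancelʳ-< r 0<r = ℚ.*-cancelʳ-<-nonNeg r ⦃ ℚ.nonNegative (ℚ.<⇒≤ 0<r) ⦄

    ⅓ : ℚ
    ⅓ = ℤ.+ 1 / 3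

    0<⅓ : 0ℚ < ⅓
    0<⅓ = from-yes (0ℚ ℚ.<? ⅓)

    0<½ : 0ℚ < ½
    0<½ = from-yes (0ℚ ℚ.<? ½)

    0<1 : 0ℚ < 1ℚ
    0<1 = from-yes (0ℚ ℚ.<? 1ℚ)

    p<p+ε : ∀ {p ε} → 0ℚ < ε → p < p + ε
    p<p+ε {p} 0<ε = subst (_< p + _) (ℚ.+-identityʳ p) (ℚ.+-monoʳ-< p 0<ε)

    p-ε<p : ∀ {p ε} → 0ℚ < ε → p - ε < p
    p-ε<p {p} {ε} 0<ε = subst (p - ε <_) (ℚ.+-identityʳ p)
      (ℚ.+-monoʳ-< p (ℚ.neg-antimono-< 0<ε))

  -- The cut generated by a set A of rational lower bounds and a set B of rational
  -- upper bounds that come arbitrarily close to each other.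
  cut : (A B : ℚ → Set) → (∀ {p q} → A p → B q → p ≤ q) →
        (∀ ε → 0ℚ < ε → ∃₂ λ p q → A p × B q × q < p + ε) → ℝ
  cut A B A≤B close = record
    { Lower        = λ p → ∃[ r ] p < r × A r
    ; Upper        = λ q → ∃[ r ] r < q × B r
    ; lower-closed = λ { p<q (r , q<r , a) → r , ℚ.<-trans p<q q<r , a }
    ; lower-open   = λ { (r , p<r , a) → let (m , p<m , m<r) = ℚ.<-dense p<r in m , p<m , r , m<r , a }
    ; upper-closed = λ { p<q (r , r<p , b) → r , ℚ.<-trans r<p p<q , b }
    ; upper-open   = λ { (r , r<q , b) → let (m , r<m , m<q) = ℚ.<-dense r<q in m , m<q , r , r<m , b }
    ; lower<upper  = λ { (r , p<r , a) (s , s<q , b) → ℚ.<-≤-trans p<r (ℚ.≤-trans (A≤B a b) (ℚ.<⇒≤ s<q)) }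
    ; located      = loc
    }
    where
    loc : ∀ ε → 0ℚ < ε → ∃₂ λ p q → (∃[ r ] p < r × A r) × (∃[ r ] r < q × B r) × q < p + ε
    loc ε 0<ε with close (⅓ * ε) (*-pos 0<⅓ 0<ε)
    ... | p , q , a , b , q<p+δ =
      p - δ , q + δ , (p , p-ε<p 0<δ , a) , (q , p<p+ε 0<δ , b) ,
      subst (q + δ <_) eq (ℚ.+-monoˡ-< δ q<p+δ)
      where
      δ : ℚ
      δ = ⅓ * ε
      0<δ : 0ℚ < δ
      0<δ = *-pos 0<⅓ 0<ε
      eq : (p + δ) + δ ≡ (p - δ) + ε
      eq = begin
        (p + δ) + δ                  ≡⟨ solve 2 (λ p δ → (p :+ δ) :+ δ := (p :- δ) :+ (con (ℤ.+ 3 / 1) :* δ)) refl p δ ⟩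
        (p - δ) + (ℤ.+ 3 / 1) * δ      ≡⟨ cong ((p - δ) +_) (ℚ.*-assoc (ℤ.+ 3 / 1) ⅓ ε) ⟨
        (p - δ) + 1ℚ * ε             ≡⟨ cong ((p - δ) +_) (ℚ.*-identityˡ ε) ⟩
        (p - δ) + ε                  ∎
        where
        open ≡-Reasoning
        open +-*-Solver

  fromℚ : ℚ → ℝ
  fromℚ q = cut (_≤ q) (q ≤_) ℚ.≤-trans λ ε 0<ε → q , q , ℚ.≤-refl , ℚ.≤-refl , p<p+ε 0<ε

  fromℤ : ℤ → ℝ
  fromℤ m = fromℚ (m / 1)

  fromℕ : ℕ → ℝ
  fromℕ n = fromℤ (ℤ.+ n)

  infixl 6 _+ᵣ_ _-ᵣ_
  infixl 7 _*ᵣ_ _÷ᵣ_⟨_⟩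
  infix  8 -ᵣ_

  _+ᵣ_ : ℝ → ℝ → ℝ
  x +ᵣ y = cut
    (λ p → ∃₂ λ a c → Lower x a × Lower y c × p ≡ a + c)
    (λ q → ∃₂ λ b d → Upper x b × Upper y d × q ≡ b + d)
    (λ { (_ , _ , la , lc , refl) (_ , _ , ub , ud , refl) →
      ℚ.<⇒≤ (ℚ.+-mono-< (lower<upper x la ub) (lower<upper y lc ud)) })
    close
    where
    close : ∀ ε → 0ℚ < ε → _
    close ε 0<ε
      with located x (½ * ε) (*-pos 0<½ 0<ε)
         | located y (½ * ε) (*-pos 0<½ 0<ε)
    ... | a , b , la , ub , b<a+ | c , d , lc , ud , d<c+ =
      a + c , b + d , (a , c , la , lc , refl) , (b , d , ub , ud , refl) ,
      subst (b + d <_)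
        (solve 3 (λ a c ε → (a :+ con ½ :* ε) :+ (c :+ con ½ :* ε) := (a :+ c) :+ ε) refl a c ε)
        (ℚ.+-mono-< b<a+ d<c+)
      where open +-*-Solver

  private
    neg-neg : ∀ p → - (- p) ≡ p
    neg-neg = solve 1 (λ p → :- (:- p) := p) refl where open +-*-Solver

  private
    neg-gap : ∀ a b ε → b < a + ε → - a < - b + ε
    neg-gap a b ε h = subst₂ _<_ (l a b) (r a b ε) (ℚ.+-monoˡ-< (- a - b) h)
      where
      open +-*-Solver
      l : ∀ a b → b + (- a - b) ≡ - a
      l = solve 2 (λ a b → b :+ (:- a :- b) := :- a) refl
      r : ∀ a b ε → (a + ε) + (- a - b) ≡ - b + ε
      r = solve 3 (λ a b ε → (a :+ ε) :+ (:- a :- b) := :- b :+ ε) refl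

  -ᵣ_ : ℝ → ℝ
  -ᵣ x = cut (Upper x ∘ -_) (Lower x ∘ -_)
    (λ {p} {q} u l → ℚ.<⇒≤ (subst₂ _<_ (neg-neg p) (neg-neg q) (ℚ.neg-antimono-< (lower<upper x l u))))
    λ ε 0<ε → let (a , b , la , ub , b<a+ε) = located x ε 0<ε in
      - b , - a , subst (Upper x) (sym (neg-neg b)) ub , subst (Lower x) (sym (neg-neg a)) la ,
      neg-gap a b ε b<a+ε

  _-ᵣ_ : ℝ → ℝ → ℝ
  x -ᵣ y = x +ᵣ (-ᵣ y)

  private
    p≤∣p∣ : ∀ p → p ≤ ∣ p ∣
    p≤∣p∣ p with ℚ.≤-total 0ℚ p
    ... | inj₁ 0≤p = ℚ.≤-reflexive (sym (ℚ.0≤p⇒∣p∣≡p 0≤p))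
    ... | inj₂ p≤0 = ℚ.≤-trans p≤0 (ℚ.0≤∣p∣ p)

    ∣∣-bound : ∀ {a s b} → a ≤ s → s ≤ b → ∣ s ∣ ≤ ∣ a ∣ + ∣ b ∣
    ∣∣-bound {a} {s} {b} a≤s s≤b with ℚ.∣p∣≡p∨∣p∣≡-p s
    ... | inj₁ eq = begin
      ∣ s ∣         ≡⟨ eq ⟩
      s             ≤⟨ s≤b ⟩
      b             ≤⟨ p≤∣p∣ b ⟩
      ∣ b ∣         ≡⟨ ℚ.+-identityˡ ∣ b ∣ ⟨
      0ℚ + ∣ b ∣    ≤⟨ ℚ.+-monoˡ-≤ ∣ b ∣ (ℚ.0≤∣p∣ a) ⟩
      ∣ a ∣ + ∣ b ∣ ∎
      where open ℚ.≤-Reasoning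
    ... | inj₂ eq = begin
      ∣ s ∣         ≡⟨ eq ⟩
      - s           ≤⟨ ℚ.neg-antimono-≤ a≤s ⟩
      - a           ≤⟨ p≤∣p∣ (- a) ⟩
      ∣ - a ∣       ≡⟨ ℚ.∣-p∣≡∣p∣ a ⟩
      ∣ a ∣         ≡⟨ ℚ.+-identityʳ ∣ a ∣ ⟨
      ∣ a ∣ + 0ℚ    ≤⟨ ℚ.+-monoʳ-≤ ∣ a ∣ (ℚ.0≤∣p∣ b) ⟩
      ∣ a ∣ + ∣ b ∣ ∎
      where open ℚ.≤-Reasoning

    ∣∣≤⇒ : ∀ p e → ∣ p ∣ ≤ e → - e ≤ p × p ≤ e
    ∣∣≤⇒ p e h with ℚ.≤-total 0ℚ p
    ... | inj₁ 0≤p = ℚ.≤-trans (ℚ.neg-antimono-≤ (ℚ.≤-trans (ℚ.0≤∣p∣ p) h)) 0≤p ,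
                     subst (_≤ e) (ℚ.0≤p⇒∣p∣≡p 0≤p) h
    ... | inj₂ p≤0 = subst (- e ≤_) (neg-neg p) (ℚ.neg-antimono-≤
                       (subst (_≤ e) (trans (sym (ℚ.∣-p∣≡∣p∣ p)) (ℚ.0≤p⇒∣p∣≡p (ℚ.neg-antimono-≤ p≤0))) h)) ,
                     ℚ.≤-trans p≤0 (ℚ.≤-trans (ℚ.0≤∣p∣ p) h)

    small : ∀ K ε → 0ℚ < K → 0ℚ < ε →
            ∃[ δ ] 0ℚ < δ × δ ≤ 1ℚ × K * δ + K * δ < ε
    small K ε 0<K 0<ε with recip K 0<K
    ... | r , 0<r , rK≡1 = δ , 0<δ , ℚ.p⊓q≤p 1ℚ η , (begin-strict
        K * δ + K * δ         ≤⟨ ℚ.+-mono-≤ Kδ≤ Kδ≤ ⟩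
        ⅓ * ε + ⅓ * ε         ≡⟨ ℚ.+-identityʳ _ ⟨
        ⅓ * ε + ⅓ * ε + 0ℚ    <⟨ ℚ.+-monoʳ-< (⅓ * ε + ⅓ * ε) 0<⅓ε ⟩
        ⅓ * ε + ⅓ * ε + ⅓ * ε ≡⟨ solve 1 (λ ε → con ⅓ :* ε :+ con ⅓ :* ε :+ con ⅓ :* ε := ε) refl ε ⟩
        ε                     ∎)
      where
      open +-*-Solver
      open ℚ.≤-Reasoning
      0<⅓ε : 0ℚ < ⅓ * ε
      0<⅓ε = *-pos 0<⅓ 0<ε
      η δ : ℚ
      η = ⅓ * ε * r
      δ = 1ℚ ⊓ η
      0<δ : 0ℚ < δ
      0<δ with ℚ.⊓-sel 1ℚ η
      ... | inj₁ eq = subst (0ℚ <_) (sym eq) 0<1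
      ... | inj₂ eq = subst (0ℚ <_) (sym eq) (*-pos 0<⅓ε 0<r)
      Kδ≤ : K * δ ≤ ⅓ * ε
      Kδ≤ = begin
        K * δ             ≤⟨ ℚ.*-monoˡ-≤-nonNeg K ⦃ ℚ.nonNegative (ℚ.<⇒≤ 0<K) ⦄ (ℚ.p⊓q≤q 1ℚ η) ⟩
        K * (⅓ * ε * r)   ≡⟨ solve 3 (λ K e r → K :* (e :* r) := e :* (r :* K)) refl K (⅓ * ε) r ⟩
        ⅓ * ε * (r * K)   ≡⟨ cong (⅓ * ε *_) rK≡1 ⟩
        ⅓ * ε * 1ℚ        ≡⟨ ℚ.*-identityʳ (⅓ * ε) ⟩
        ⅓ * ε             ∎

    within : ∀ p q e → ∣ p - q ∣ ≤ e → q - e ≤ p × p ≤ q + e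
    within p q e h =
      subst (q - e ≤_) (eq p q) (ℚ.+-monoʳ-≤ q (proj₁ (∣∣≤⇒ (p - q) e h))) ,
      subst (_≤ q + e) (eq p q) (ℚ.+-monoʳ-≤ q (proj₂ (∣∣≤⇒ (p - q) e h)))
      where
      eq : ∀ p q → q + (p - q) ≡ p
      eq = solve 2 (λ p q → q :+ (p :- q) := p) refl where open +-*-Solver

    gap : ∀ p e ε → e + e < ε → p + e < (p - e) + ε
    gap p e ε h = subst (_< (p - e) + ε) (eq p e) (ℚ.+-monoʳ-< (p - e) h)
      where
      eq : ∀ p e → (p - e) + (e + e) ≡ p + e
      eq = solve 2 (λ p e → (p :- e) :+ (e :+ e) := p :+ e) refl where open +-*-Solver

    ∣∣-near : ∀ u v δ → u ≤ v → v ≤ u + δ → ∣ v - u ∣ ≤ δ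
    ∣∣-near u v δ u≤v v≤ = subst (_≤ δ) (sym (ℚ.0≤p⇒∣p∣≡p 0≤))
      (subst (v - u ≤_) (cancel u δ) (ℚ.+-monoˡ-≤ (- u) v≤))
      where
      0≤ : 0ℚ ≤ v - u
      0≤ = subst (_≤ v - u) (ℚ.+-inverseʳ u) (ℚ.+-monoˡ-≤ (- u) u≤v)
      cancel : ∀ u δ → (u + δ) - u ≡ δ
      cancel = solve 2 (λ u δ → (u :+ δ) :- u := δ) refl where open +-*-Solver

    -- Products over a small rectangle with lower left corner (a , c) stay near a * c.
    product-near : ∀ a b c d s t X Y δ →
      ∣ s ∣ ≤ X → ∣ c ∣ ≤ Y → 0ℚ ≤ δ → b ≤ a + δ → d ≤ c + δ →
      a ≤ s → s ≤ b → c ≤ t → t ≤ d → ∣ s * t - a * c ∣ ≤ (X + Y) * δ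
    product-near a b c d s t X Y δ s≤X c≤Y 0≤δ b≤ d≤ a≤s s≤b c≤t t≤d =
      subst₂ (λ p q → ∣ p ∣ ≤ q) (sym (split s t a c)) (sym (ℚ.*-distribʳ-+ δ X Y))
        (ℚ.≤-trans (ℚ.∣p+q∣≤∣p∣+∣q∣ (s * (t - c)) (c * (s - a)))
          (ℚ.+-mono-≤ (term s (t - c) X s≤X t-c≤δ) (term c (s - a) Y c≤Y s-a≤δ)))
      where
      split : ∀ s t a c → s * t - a * c ≡ s * (t - c) + c * (s - a)
      split = solve 4 (λ s t a c → s :* t :- a :* c := s :* (t :- c) :+ c :* (s :- a)) refl
        where open +-*-Solver
      t-c≤δ : ∣ t - c ∣ ≤ δ
      t-c≤δ = ∣∣-near c t δ c≤t (ℚ.≤-trans t≤d d≤)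
      s-a≤δ : ∣ s - a ∣ ≤ δ
      s-a≤δ = ∣∣-near a s δ a≤s (ℚ.≤-trans s≤b b≤)
      term : ∀ p q Z → ∣ p ∣ ≤ Z → ∣ q ∣ ≤ δ → ∣ p * q ∣ ≤ Z * δ
      term p q Z p≤Z q≤δ = subst (_≤ Z * δ) (sym (ℚ.∣p*q∣≡∣p∣*∣q∣ p q))
        (*-mono-≤ (ℚ.0≤∣p∣ p) 0≤δ p≤Z q≤δ)

    0<p+q+1 : ∀ p q → 0ℚ ≤ p → 0ℚ ≤ q → 0ℚ < p + q + 1ℚ
    0<p+q+1 p q 0≤p 0≤q = ℚ.+-mono-≤-< (ℚ.+-mono-≤ 0≤p 0≤q) 0<1

    widen : ∀ p q δ → 0ℚ ≤ δ → (p + q) * δ ≤ (p + q + 1ℚ) * δ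
    widen p q δ 0≤δ = ℚ.*-monoʳ-≤-nonNeg δ ⦃ ℚ.nonNegative 0≤δ ⦄ (ℚ.<⇒≤ (p<p+ε {p + q} 0<1))

    bounded : ∀ z → ∃[ Z ] 0ℚ ≤ Z × (∀ a b δ s → Lower z a → Upper z b →
              δ ≤ 1ℚ → b < a + δ → a ≤ s → s ≤ b → ∣ s ∣ ≤ Z)
    bounded z with located z 1ℚ 0<1
    ... | a₀ , b₀ , la₀ , ub₀ , _ =
      ∣ a₀ - 1ℚ ∣ + ∣ b₀ + 1ℚ ∣ ,
      ℚ.+-mono-≤ (ℚ.0≤∣p∣ (a₀ - 1ℚ)) (ℚ.0≤∣p∣ (b₀ + 1ℚ)) ,
      confined
      where
      cancel : ∀ a → (a + 1ℚ) - 1ℚ ≡ a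
      cancel = solve 1 (λ a → (a :+ con 1ℚ) :- con 1ℚ := a) refl where open +-*-Solver

      confined : ∀ a b δ s → Lower z a → Upper z b →
                 δ ≤ 1ℚ → b < a + δ → a ≤ s → s ≤ b → ∣ s ∣ ≤ ∣ a₀ - 1ℚ ∣ + ∣ b₀ + 1ℚ ∣
      confined a b δ s la ub δ≤1 b<a+δ a≤s s≤b =
        ∣∣-bound (ℚ.≤-trans (ℚ.<⇒≤ a₀-1<a) a≤s) (ℚ.≤-trans s≤b (ℚ.<⇒≤ b<b₀+1))
        where
        b<a+1 : b < a + 1ℚ
        b<a+1 = ℚ.<-≤-trans b<a+δ (ℚ.+-monoʳ-≤ a δ≤1)
        b<b₀+1 : b < b₀ + 1ℚ
        b<b₀+1 = ℚ.<-trans b<a+1 (ℚ.+-monoˡ-< 1ℚ (lower<upper z la ub₀))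
        a₀-1<a : a₀ - 1ℚ < a
        a₀-1<a = subst (a₀ - 1ℚ <_) (cancel a)
          (ℚ.+-monoˡ-< (- 1ℚ) (ℚ.<-trans (lower<upper z la₀ ub) b<a+1))

  -- Lower and upper bounds of x * y are bounds of the set of products s * t over some
  -- rational rectangle [a , b] × [c , d] containing the point (x , y).
  record Rectangle (x y : ℝ) : Set where
    field
      a b c d : ℚ
      a<x     : Lower x a
      x<b     : Upper x b
      c<y     : Lower y c
      y<d     : Upper y d

    Contains : ℚ → ℚ → Set
    Contains s t = (a ≤ s × s ≤ b) × (c ≤ t × t ≤ d)

  _*ᵣ_ : ℝ → ℝ → ℝ
  x *ᵣ y = cut A B (λ { (R , p≤) (S , ≤q) → bounds R p≤ S ≤q }) close
    where
    A B : ℚ → Set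
    A p = Σ[ R ∈ Rectangle x y ] (∀ s t → Rectangle.Contains R s t → p ≤ s * t)
    B q = Σ[ R ∈ Rectangle x y ] (∀ s t → Rectangle.Contains R s t → s * t ≤ q)

    common : ∀ z {a b a′ b′} → Lower z a → Upper z b → Lower z a′ → Upper z b′ →
             (a ≤ a ⊔ a′ × a ⊔ a′ ≤ b) × (a′ ≤ a ⊔ a′ × a ⊔ a′ ≤ b′)
    common z {a} {b} {a′} {b′} la ub la′ ub′ =
      (ℚ.p≤p⊔q a a′ , ℚ.⊔-lub (ℚ.<⇒≤ (lower<upper z la ub)) (ℚ.<⇒≤ (lower<upper z la′ ub))) ,
      (ℚ.p≤q⊔p a a′ , ℚ.⊔-lub (ℚ.<⇒≤ (lower<upper z la ub′)) (ℚ.<⇒≤ (lower<upper z la′ ub′)))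

    bounds : ∀ {p q} (R : Rectangle x y) → (∀ s t → Rectangle.Contains R s t → p ≤ s * t) →
             (S : Rectangle x y) → (∀ s t → Rectangle.Contains S s t → s * t ≤ q) → p ≤ q
    bounds R p≤ S ≤q =
      let (r₁ , s₁) = common x R₁.a<x R₁.x<b S₁.a<x S₁.x<b
          (r₂ , s₂) = common y R₁.c<y R₁.y<d S₁.c<y S₁.y<d
      in ℚ.≤-trans (p≤ (R₁.a ⊔ S₁.a) (R₁.c ⊔ S₁.c) (r₁ , r₂)) (≤q (R₁.a ⊔ S₁.a) (R₁.c ⊔ S₁.c) (s₁ , s₂))
      where
      module R₁ = Rectangle R
      module S₁ = Rectangle S

    near : ∀ a b c d X Y δ →
      Lower x a → Upper x b → Lower y c → Upper y d →
      (∀ s → a ≤ s → s ≤ b → ∣ s ∣ ≤ X) → ∣ c ∣ ≤ Y →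
      0ℚ ≤ δ → b < a + δ → d < c + δ →
      ∀ s t → (a ≤ s × s ≤ b) × (c ≤ t × t ≤ d) →
      a * c - (X + Y + 1ℚ) * δ ≤ s * t × s * t ≤ a * c + (X + Y + 1ℚ) * δ
    near a b c d X Y δ la ub lc ud x-bound c≤Y 0≤δ b< d< s t ((a≤s , s≤b) , (c≤t , t≤d)) =
      within (s * t) (a * c) ((X + Y + 1ℚ) * δ) (ℚ.≤-trans
        (product-near a b c d s t X Y δ (x-bound s a≤s s≤b) c≤Y 0≤δ
          (ℚ.<⇒≤ b<) (ℚ.<⇒≤ d<) a≤s s≤b c≤t t≤d)
        (widen X Y δ 0≤δ))

    close : ∀ ε → 0ℚ < ε → ∃₂ λ p q → A p × B q × q < p + ε
    close ε 0<ε =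
      let (X , 0≤X , x-bound) = bounded x
          (Y , 0≤Y , y-bound) = bounded y
          (δ , 0<δ , δ≤1 , 2Kδ<ε) = small (X + Y + 1ℚ) ε (0<p+q+1 X Y 0≤X 0≤Y) 0<ε
          (a , b , la , ub , b<) = located x δ 0<δ
          (c , d , lc , ud , d<) = located y δ 0<δ
          R = record { a = a ; b = b ; c = c ; d = d ; a<x = la ; x<b = ub ; c<y = lc ; y<d = ud }
          h = near a b c d X Y δ la ub lc ud
                (λ s → x-bound a b δ s la ub δ≤1 b<)
                (y-bound c d δ c lc ud δ≤1 d< ℚ.≤-refl (ℚ.<⇒≤ (lower<upper y lc ud)))
                (ℚ.<⇒≤ 0<δ) b< d<
      in a * c - (X + Y + 1ℚ) * δ , a * c + (X + Y + 1ℚ) * δ ,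
         (R , λ s t st → proj₁ (h s t st)) , (R , λ s t st → proj₂ (h s t st)) ,
         gap (a * c) ((X + Y + 1ℚ) * δ) ε 2Kδ<ε

  inverse : (x : ℝ) → 0<ᵣ x → ℝ
  inverse x 0<x = cut
    (λ p → ∃[ u ] Upper x u × p * u ≤ 1ℚ)
    (λ q → ∃[ l ] 0ℚ < l × Lower x l × 1ℚ ≤ q * l)
    (λ { (u , uu , pu≤1) (l , 0<l , ll , 1≤ql) → bounds uu pu≤1 0<l ll 1≤ql })
    close
    where
    bounds : ∀ {p q u l} → Upper x u → p * u ≤ 1ℚ → 0ℚ < l → Lower x l → 1ℚ ≤ q * l → p ≤ q
    bounds {p} {q} {u} {l} uu pu≤1 0<l ll 1≤ql = ℚ.≮⇒≥ λ q<p → ℚ.<-irrefl refl (begin-strict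
      1ℚ    ≤⟨ 1≤ql ⟩
      q * l <⟨ *-monoʳ-< 0<l q<p ⟩
      p * l <⟨ ℚ.*-monoʳ-<-pos p ⦃ ℚ.positive (ℚ.<-trans 0<q q<p) ⦄ (lower<upper x ll uu) ⟩
      p * u ≤⟨ pu≤1 ⟩
      1ℚ    ∎)
      where
      open ℚ.≤-Reasoning
      0<q : 0ℚ < q
      0<q = *-cancelʳ-< l 0<l (ℚ.<-≤-trans
        (subst (_< 1ℚ) (sym (ℚ.*-zeroˡ l)) 0<1) 1≤ql)

    close : ∀ ε → 0ℚ < ε → _
    close ε 0<ε with lower-open x 0<x
    ... | l₀ , 0<l₀ , ll₀
      with located x (ε * (l₀ * l₀)) (*-pos 0<ε (*-pos 0<l₀ 0<l₀))
    ... | l₁ , u , ll₁ , uu , u<l₁+δ = result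
      where
      open +-*-Solver
      open ℚ.≤-Reasoning
      l : ℚ
      l = l₀ ⊔ l₁
      ll : Lower x l
      ll with ℚ.⊔-sel l₀ l₁
      ... | inj₁ eq = subst (Lower x) (sym eq) ll₀
      ... | inj₂ eq = subst (Lower x) (sym eq) ll₁
      l₀≤l : l₀ ≤ l
      l₀≤l = ℚ.p≤p⊔q l₀ l₁
      0<l : 0ℚ < l
      0<l = ℚ.<-≤-trans 0<l₀ l₀≤l
      l<u : l < u
      l<u = lower<upper x ll uu
      0<u : 0ℚ < u
      0<u = ℚ.<-trans 0<l l<u
      result : _
      result with recip l 0<l | recip u 0<u
      ... | r , _ , rl≡1 | w , _ , wu≡1 =
        w , r , (u , uu , ℚ.≤-reflexive wu≡1) , (l , 0<l , ll , ℚ.≤-reflexive (sym rl≡1)) ,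
        *-cancelʳ-< (u * l) (*-pos 0<u 0<l) (begin-strict
          r * (u * l)                 ≡⟨ solve 3 (λ r u l → r :* (u :* l) := u :* (r :* l)) refl r u l ⟩
          u * (r * l)                 ≡⟨ trans (cong (u *_) rl≡1) (ℚ.*-identityʳ u) ⟩
          u                           <⟨ u<l₁+δ ⟩
          l₁ + ε * (l₀ * l₀)          ≤⟨ ℚ.+-mono-≤ (ℚ.p≤q⊔p l₀ l₁)
                                           (ℚ.*-monoˡ-≤-nonNeg ε ⦃ ℚ.nonNegative (ℚ.<⇒≤ 0<ε) ⦄
                                             (*-mono-≤ (ℚ.<⇒≤ 0<l₀) (ℚ.<⇒≤ 0<l)
                                               (ℚ.≤-trans l₀≤l (ℚ.<⇒≤ l<u)) l₀≤l)) ⟩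
          l + ε * (u * l)             ≡⟨ cong (_+ ε * (u * l)) (trans (cong (l *_) wu≡1) (ℚ.*-identityʳ l)) ⟨
          l * (w * u) + ε * (u * l)   ≡⟨ solve 4 (λ l w u ε → l :* (w :* u) :+ ε :* (u :* l) := (w :+ ε) :* (u :* l)) refl l w u ε ⟩
          (w + ε) * (u * l)           ∎)

  _÷ᵣ_⟨_⟩ : ℝ → (y : ℝ) → 0<ᵣ y → ℝ
  x ÷ᵣ y ⟨ 0<y ⟩ = x *ᵣ inverse y 0<y

  private
    ι : ℕ → ℚ
    ι n = ℤ.+ n / 1

    toℚᵘ-ι : ∀ n → toℚᵘ (ι n) ℚᵘ.≃ mkℚᵘ (ℤ.+ n) 0
    toℚᵘ-ι n = ℚ.toℚᵘ-fromℚᵘ (mkℚᵘ (ℤ.+ n) 0)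

    ι-suc : ∀ n → ι (suc n) ≡ ι n + 1ℚ
    ι-suc n = ℚ.toℚᵘ-injective (begin
      toℚᵘ (ι (suc n))              ≈⟨ toℚᵘ-ι (suc n) ⟩
      mkℚᵘ (ℤ.+ suc n) 0            ≈⟨ ℚᵘ.*≡* (cong (ℤ._* ℤ.+ 1) (eq n)) ⟩
      mkℚᵘ (ℤ.+ n) 0 ℚᵘ.+ ℚᵘ.1ℚᵘ    ≈⟨ ℚᵘ.+-congˡ ℚᵘ.1ℚᵘ (toℚᵘ-ι n) ⟨
      toℚᵘ (ι n) ℚᵘ.+ ℚᵘ.1ℚᵘ        ≈⟨ ℚ.toℚᵘ-homo-+ (ι n) 1ℚ ⟨
      toℚᵘ (ι n + 1ℚ)               ∎)
      where
      open ℚᵘ.≃-Reasoning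
      eq : ∀ n → ℤ.+ suc n ≡ ℤ.+ n ℤ.* ℤ.+ 1 ℤ.+ ℤ.+ 1
      eq n = trans (cong ℤ.+_ (ℕ.+-comm 1 n)) (cong (ℤ._+ ℤ.+ 1) (sym (ℤ.*-identityʳ (ℤ.+ n))))

    0≤1 : 0ℚ ≤ 1ℚ
    0≤1 = ℚ.<⇒≤ 0<1

    0≤ι : ∀ n → 0ℚ ≤ ι n
    0≤ι zero    = ℚ.≤-refl
    0≤ι (suc n) = subst (0ℚ ≤_) (sym (ι-suc n)) (ℚ.+-mono-≤ (0≤ι n) 0≤1)

    ι-mono : ∀ {m n} → m ℕ.≤ n → ι m ≤ ι n
    ι-mono {n = n} z≤n = 0≤ι n
    ι-mono {suc m} {suc n} (s≤s m≤n) =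
      subst₂ _≤_ (sym (ι-suc m)) (sym (ι-suc n)) (ℚ.+-monoˡ-≤ 1ℚ (ι-mono m≤n))

    archimedean : ∀ n h → 0ℚ < h → ∃[ k ] ι n ≤ ι k * h
    archimedean n h@(mkℚ (ℤ.+ zero) _ _) 0<h = contradiction (ℚ.positive 0<h) λ ()
    archimedean n h@(mkℚ ℤ.-[1+ _ ] _ _) 0<h = contradiction (ℚ.positive 0<h) λ ()
    archimedean n h@(mkℚ (ℤ.+ suc a) d _) 0<h = n ℕ.* suc d , ℚ.toℚᵘ-cancel-≤
      (ℚᵘ.≤-respˡ-≃ (ℚᵘ.≃-sym (toℚᵘ-ι n)) (ℚᵘ.≤-respʳ-≃ (ℚᵘ.≃-sym step) core))
      where
      step : toℚᵘ (ι (n ℕ.* suc d) * h) ℚᵘ.≃ mkℚᵘ (ℤ.+ (n ℕ.* suc d)) 0 ℚᵘ.* mkℚᵘ (ℤ.+ suc a) d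
      step = ℚᵘ.≃-trans (ℚ.toℚᵘ-homo-* (ι (n ℕ.* suc d)) h)
        (ℚᵘ.*-congʳ {mkℚᵘ (ℤ.+ suc a) d} (toℚᵘ-ι (n ℕ.* suc d)))
      core : mkℚᵘ (ℤ.+ n) 0 ℚᵘ.≤ mkℚᵘ (ℤ.+ (n ℕ.* suc d)) 0 ℚᵘ.* mkℚᵘ (ℤ.+ suc a) d
      core = ℚᵘ.*≤* (subst₂ ℤ._≤_ l r (ℤ.+≤+ ineq))
        where
        ineq : n ℕ.* suc (d ℕ.+ 0) ℕ.≤ n ℕ.* suc d ℕ.* suc a ℕ.* 1
        ineq = subst₂ ℕ._≤_ (cong (λ e → n ℕ.* suc e) (sym (ℕ.+-identityʳ d))) (sym (ℕ.*-identityʳ _))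
          (ℕ.m≤m*n (n ℕ.* suc d) (suc a))
        l : ℤ.+ (n ℕ.* suc (d ℕ.+ 0)) ≡ ℤ.+ n ℤ.* ℤ.+ suc (d ℕ.+ 0)
        l = ℤ.pos-* n _
        r : ℤ.+ (n ℕ.* suc d ℕ.* suc a ℕ.* 1) ≡ ℤ.+ (n ℕ.* suc d) ℤ.* ℤ.+ suc a ℤ.* ℤ.+ 1
        r = trans (ℤ.pos-* (n ℕ.* suc d ℕ.* suc a) 1) (cong (ℤ._* ℤ.+ 1) (ℤ.pos-* (n ℕ.* suc d) (suc a)))

    firstTrue : {P : ℕ → Set} → (∀ k → Dec (P k)) → ∀ n → P n → P 0 ⊎ ∃[ k ] ¬ P k × P (suc k)
    firstTrue P? zero    p = inj₁ p
    firstTrue P? (suc n) p with P? n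
    ... | yes pn = firstTrue P? n pn
    ... | no ¬pn = inj₂ (n , ¬pn , p)

    cube : ℚ → ℚ
    cube q = q * q * q

    cube-mono-≤ : ∀ {p q} → 0ℚ ≤ p → p ≤ q → cube p ≤ cube q
    cube-mono-≤ {p} {q} 0≤p p≤q = *-mono-≤ 0≤p² 0≤q (*-mono-≤ 0≤p 0≤q p≤q p≤q) p≤q
      where
      0≤q : 0ℚ ≤ q
      0≤q = ℚ.≤-trans 0≤p p≤q
      0≤p² : 0ℚ ≤ p * p
      0≤p² = subst (_≤ p * p) (ℚ.*-zeroˡ 0ℚ) (*-mono-≤ ℚ.≤-refl 0≤p 0≤p 0≤p)

    cube-mono-< : ∀ {p q} → 0ℚ ≤ p → p < q → cube p < cube q
    cube-mono-< {p} {q} 0≤p p<q = ℚ.≤-<-trans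
      (ℚ.*-monoˡ-≤-nonNeg (p * p) ⦃ ℚ.nonNegative 0≤p² ⦄ (ℚ.<⇒≤ p<q))
      (*-monoʳ-< 0<q (ℚ.≤-<-trans
        (ℚ.*-monoˡ-≤-nonNeg p ⦃ ℚ.nonNegative 0≤p ⦄ (ℚ.<⇒≤ p<q)) (*-monoʳ-< 0<q p<q)))
      where
      0<q : 0ℚ < q
      0<q = ℚ.≤-<-trans 0≤p p<q
      0≤p² : 0ℚ ≤ p * p
      0≤p² = subst (_≤ p * p) (ℚ.*-zeroˡ 0ℚ) (*-mono-≤ ℚ.≤-refl 0≤p 0≤p 0≤p)

    cube-neg : ∀ {p} → p < 0ℚ → cube p < 0ℚ
    cube-neg {p} p<0 = ℚ.negative⁻¹ (cube p) ⦃ ℚ.pos*neg⇒neg (p * p) ⦃ ℚ.neg*neg⇒pos p p ⦄ p ⦄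
      where instance _ = ℚ.negative p<0

    cube-bounds : ∀ {p q n} → 0ℚ ≤ n → cube p ≤ n → n ≤ cube q → p ≤ q
    cube-bounds {p} {q} 0≤n p³≤n n≤q³ = ℚ.≮⇒≥ λ q<p → lemma q<p (0ℚ ℚ.≤? q)
      where
      lemma : q < p → Dec (0ℚ ≤ q) → ⊥
      lemma q<p (yes 0≤q) = ℚ.<-irrefl refl (ℚ.<-≤-trans (cube-mono-< 0≤q q<p) (ℚ.≤-trans p³≤n n≤q³))
      lemma q<p (no 0≰q)  = ℚ.<-irrefl refl (ℚ.<-≤-trans (cube-neg (ℚ.≰⇒> 0≰q)) (ℚ.≤-trans 0≤n n≤q³))

    cube-large : ∀ n q → ι (suc n) ≤ q → ι n ≤ cube q
    cube-large n q n+1≤q = begin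
      ι n          ≤⟨ ι-mono (ℕ.n≤1+n n) ⟩
      ι (suc n)    ≤⟨ n+1≤q ⟩
      q            ≡⟨ trans (ℚ.*-identityˡ (1ℚ * q)) (ℚ.*-identityˡ q) ⟨
      1ℚ * (1ℚ * q) ≡⟨ ℚ.*-assoc 1ℚ 1ℚ q ⟨
      1ℚ * 1ℚ * q  ≤⟨ *-mono-≤ 0≤1 0≤q (*-mono-≤ 0≤1 0≤q 1≤q 1≤q) ℚ.≤-refl ⟩
      q * q * q    ∎
      where
      open ℚ.≤-Reasoning
      1≤q : 1ℚ ≤ q
      1≤q = ℚ.≤-trans (ι-mono {1} {suc n} (s≤s z≤n)) n+1≤q
      0≤q : 0ℚ ≤ q
      0≤q = ℚ.≤-trans 0≤1 1≤q

    module _ (n : ℕ) (h : ℚ) where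
      step : ∀ k → ι (suc k) * h ≡ ι k * h + h
      step k = trans (cong (_* h) (ι-suc k))
        (trans (ℚ.*-distribʳ-+ h (ι k) 1ℚ) (cong (ι k * h +_) (ℚ.*-identityˡ h)))

      Bracket : Set
      Bracket = ∃₂ λ p q → cube p ≤ ι n × ι n ≤ cube q × q ≤ p + h

      bracket : 0ℚ < h → Bracket
      bracket 0<h =
        let (k , large) = archimedean (suc n) h 0<h
        in found (firstTrue (λ k → ι n ℚ.≤? cube (ι k * h)) k (cube-large n (ι k * h) large))
        where
        found : ι n ≤ cube (ι 0 * h) ⊎ (∃[ k ] ¬ (ι n ≤ cube (ι k * h)) × ι n ≤ cube (ι (suc k) * h)) →
                Bracket
        found (inj₁ n≤0) =
          0ℚ , 0ℚ , 0≤ι n , subst (λ q → ι n ≤ cube q) (ℚ.*-zeroˡ h) n≤0 , ℚ.<⇒≤ (p<p+ε {0ℚ} 0<h)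
        found (inj₂ (k , n≰ , n≤)) =
          ι k * h , ι (suc k) * h , ℚ.<⇒≤ (ℚ.≰⇒> n≰) , n≤ , ℚ.≤-reflexive (step k)

    ½*ε<ε : ∀ ε → 0ℚ < ε → ½ * ε < ε
    ½*ε<ε ε 0<ε = subst (½ * ε <_) (halves ε) (p<p+ε {½ * ε} (*-pos 0<½ 0<ε))
      where
      halves : ∀ ε → ½ * ε + ½ * ε ≡ ε
      halves = solve 1 (λ ε → con ½ :* ε :+ con ½ :* ε := ε) refl where open +-*-Solver

  -- The real cube root, so that n ^ (k / 3) is ∛ (n ^ k).
  ∛ : ℕ → ℝ
  ∛ n = cut (λ p → p * p * p ≤ ℤ.+ n / 1) (λ q → ℤ.+ n / 1 ≤ q * q * q)
    (λ {p} {q} → cube-bounds {p} {q} (0≤ι n))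
    λ ε 0<ε → let (p , q , p³≤n , n≤q³ , q≤p+h) = bracket n (½ * ε) (*-pos 0<½ 0<ε)
              in p , q , p³≤n , n≤q³ , ℚ.≤-<-trans q≤p+h (ℚ.+-monoʳ-< p (½*ε<ε ε 0<ε))

  ∛-positive : ∀ n → 1 ℕ.≤ n → 0<ᵣ (∛ n)
  ∛-positive n 1≤n = 1ℚ , 0<1 , ι-mono 1≤n

  ∛2<∛ : ∀ n → 3 ℕ.≤ n → 0<ᵣ (∛ n -ᵣ ∛ 2)
  ∛2<∛ n 3≤n = ℤ.+ 1 / 10 , from-yes (0ℚ ℚ.<? ℤ.+ 1 / 10) ,
    ℤ.+ 7 / 5 , ℚ.- (ℤ.+ 13 / 10) ,
    (ℤ.+ 71 / 50 , from-yes (ℤ.+ 7 / 5 ℚ.<? ℤ.+ 71 / 50) ,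
      ℚ.≤-trans (from-yes (cube (ℤ.+ 71 / 50) ℚ.≤? ι 3)) (ι-mono 3≤n)) ,
    (ℚ.- (ℤ.+ 129 / 100) , from-yes (ℚ.- (ℤ.+ 13 / 10) ℚ.<? ℚ.- (ℤ.+ 129 / 100)) ,
      (ℤ.+ 127 / 100 , from-yes (ℤ.+ 127 / 100 ℚ.<? ℤ.+ 129 / 100) ,
        from-yes (ι 2 ℚ.≤? cube (ℤ.+ 127 / 100)))) ,
    refl

  -- Δ² + (3 / 2^⅔) Δ^(5/3) + 2^⅔ Δ^(5/3) / (Δ^⅓ - 2^⅓)
  bound : (Δ : ℕ) → 3 ℕ.≤ Δ → ℝ
  bound Δ 3≤Δ =
    fromℕ (Δ ℕ.^ 2)
    +ᵣ (fromℕ 3 ÷ᵣ ∛ (2 ℕ.^ 2) ⟨ ∛-positive (2 ℕ.^ 2) (s≤s z≤n) ⟩) *ᵣ ∛ (Δ ℕ.^ 5)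
    +ᵣ (∛ (2 ℕ.^ 2) *ᵣ ∛ (Δ ℕ.^ 5)) ÷ᵣ (∛ Δ -ᵣ ∛ 2) ⟨ ∛2<∛ Δ 3≤Δ ⟩

  IsCeiling : ℝ → ℤ → Set
  IsCeiling x k = (x ≤ᵣ fromℤ k) × (∀ m → x ≤ᵣ fromℤ m → k ℤ.≤ m)

open Colouring public
open Reals public

module Submission where

open import Defs

-- Let N(S) be the number of list colourings of all vertices, with k colours per list, that are
-- non-repetitive on the vertex set S. Adding v to S destroys only colourings with a repetition
-- through v. Such a repetition on 2 j vertices lives on one of at most j Δ^(2j-1) paths, and it
-- determines the j colours of the half containing v from the other half, so nothing is lost by
-- deleting that half from S. If adding a vertex multiplies N by at least β / k, then at most
-- (1 / k) Σ_j j Δ^(2j-1) β^(1-j) N(S) colourings are destroyed. With β = Δ² / (1 - e) the series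
-- sums to Δ / e², so the induction closes, and N stays positive, when Δ² / (1 - e) + Δ / e² ≤ k.
-- The bound of the theorem is this sum at e = (2 / Δ)^⅓. That is not its minimum, which leaves room
-- for a rational e: take e = u - u² / 2 with u a rational approximation of (2 / Δ)^⅓ from below.

-- The powers in the loss have separate origins. A path can be read in both directions, so v may be
-- placed in the first half: this leaves j positions, and the other 2j - 1 vertices cost a factor Δ
-- each. Matching the first half to the second gains k^j, but v is not in S, so only j - 1 deletions
-- are charged. Writing β as Δ² / (1 - e) turns Δ² / β into 1 - e, the ratio of an
-- arithmetic-geometric series. All counting takes place in ℕ, with e = E / (X + E) and denominators
-- cleared.
--
-- On the analytic side a cube root is a cut, known only through rational approximations, and these
-- spoil the relation Δ u³ = 2 on which the value at e = u rests. That value leaves no slack to pay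
-- for rounding. The minimum lies where e³ = (2 / Δ) (1 - e)², about u - 2u² / 3 for small u. The
-- choice u - u² / 2 moves in this direction and keeps the algebra small: with x = 1 - u it is (1 -
-- x²) / 2, and its complement is (1 + x²) / 2. The slack gained is of order u² and u ≥ 1 / Δ, so a
-- tolerance of order 1 / Δ² is enough.

module Combinatorics where

  open import Data.Fin as Fin using (Fin; zero; suc)
  import Data.Fin.Properties as Fin
  open import Data.List.Base using (List; []; _∷_; _++_; _ʳ++_; reverse; map; length; allFin; filter; take; drop; upTo; downFrom; cartesianProductWith; concatMap)
  import Data.List.Base as List
  import Data.List.Properties as List
  import Data.List.Extrema.Nat as Extrema
  open import Data.List.Membership.Propositional using (_∈_; _∉_)
  open import Data.List.Membership.Propositional.Properties
  import Data.List.Membership.DecPropositional as DecMembership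
  open import Data.List.Relation.Binary.Permutation.Propositional using (↭-sym; ↭⇒↭ₛ)
  import Data.List.Relation.Binary.Permutation.Propositional.Properties as Perm
  import Data.List.Relation.Binary.Permutation.Setoid.Properties as PermS
  open import Data.List.Relation.Unary.All as All using (All; []; _∷_)
  import Data.List.Relation.Unary.All.Properties as All
  open import Data.List.Relation.Unary.Any using (here; there)
  import Data.List.Relation.Unary.Any as Any
  import Data.List.Relation.Unary.Any.Properties as Any
  open import Data.List.Relation.Unary.AllPairs as AllPairs using ([]; _∷_)
  open import Data.List.Relation.Unary.Linked as Linked using (Linked; []; [-]; _∷_)
  open import Data.List.Relation.Unary.Unique.Propositional using (Unique)
  import Data.List.Relation.Unary.Unique.Propositional.Properties as Unique
  open import Data.Nat as ℕ using (ℕ; zero; suc; _+_; _*_; _^_; _∸_; _≤_; _<_; z≤n; s≤s)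
  import Data.Nat.Properties as ℕ
  open import Data.Nat.ListAction using (sum)
  open import Data.Nat.Solver using (module +-*-Solver)
  open +-*-Solver using (solve; _:=_; _:+_; _:*_; con)
  open import Data.Product using (∃-syntax; _×_; _,_; proj₁; proj₂)
  open import Data.Sum using (inj₁; inj₂)
  open import Data.Vec as Vec using (Vec; []; _∷_; lookup; _[_]≔_)
  import Data.Vec.Properties as Vec
  import Data.Vec.Relation.Unary.All as VecAll
  import Data.Vec.Relation.Unary.AllPairs as VecAllPairs
  import Data.Vec.Relation.Unary.Linked as VecLinked
  import Data.Vec.Relation.Unary.Unique.Propositional as VecUnique
  open import Function using (_∘_)
  open import Function.Definitions using (Injective)
  open import Relation.Binary using (Rel; Symmetric)
  open import Relation.Binary.PropositionalEquality
  open import Relation.Nullary using (Dec; yes; no; ¬?; contradiction)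
  open import Relation.Nullary.Decidable using (map′; _×-dec_; _→-dec_)
  open import Level using (0ℓ)

  -- Finite sums and indicators of decidable propositions.

  module Sums where

    ∑ : {A : Set} → List A → (A → ℕ) → ℕ
    ∑ xs f = sum (map f xs)

    ∑-mono : {A : Set} (xs : List A) {f g : A → ℕ} →
             (∀ {x} → x ∈ xs → f x ≤ g x) → ∑ xs f ≤ ∑ xs g
    ∑-mono []       h = z≤n
    ∑-mono (x ∷ xs) h = ℕ.+-mono-≤ (h (here refl)) (∑-mono xs (h ∘ there))

    ∑-cong : {A : Set} (xs : List A) {f g : A → ℕ} → (∀ x → f x ≡ g x) → ∑ xs f ≡ ∑ xs g
    ∑-cong xs h = cong sum (List.map-cong h xs)

    ∑-++ : {A : Set} (xs ys : List A) (f : A → ℕ) → ∑ (xs ++ ys) f ≡ ∑ xs f + ∑ ys f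
    ∑-++ []       ys f = refl
    ∑-++ (x ∷ xs) ys f = trans (cong (f x +_) (∑-++ xs ys f)) (sym (ℕ.+-assoc (f x) _ _))

    ∑-+ : {A : Set} (xs : List A) (f g : A → ℕ) → ∑ xs (λ x → f x + g x) ≡ ∑ xs f + ∑ xs g
    ∑-+ []       f g = refl
    ∑-+ (x ∷ xs) f g = trans (cong (f x + g x +_) (∑-+ xs f g))
      (solve 4 (λ a b c d → a :+ b :+ (c :+ d) := a :+ c :+ (b :+ d)) refl (f x) (g x) _ _)

    ∑-* : {A : Set} (xs : List A) (k : ℕ) (f : A → ℕ) → ∑ xs (λ x → k * f x) ≡ k * ∑ xs f
    ∑-* []       k f = sym (ℕ.*-zeroʳ k)
    ∑-* (x ∷ xs) k f = trans (cong (k * f x +_) (∑-* xs k f)) (sym (ℕ.*-distribˡ-+ k (f x) _))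

    ∑-const : {A : Set} (xs : List A) (k : ℕ) → ∑ xs (λ _ → k) ≡ length xs * k
    ∑-const []       k = refl
    ∑-const (x ∷ xs) k = cong (k +_) (∑-const xs k)

    ∑-swap : {A B : Set} (xs : List A) (ys : List B) (f : A → B → ℕ) →
             ∑ xs (λ x → ∑ ys (f x)) ≡ ∑ ys (λ y → ∑ xs (λ x → f x y))
    ∑-swap []       ys f = sym (trans (∑-const ys 0) (ℕ.*-zeroʳ (length ys)))
    ∑-swap (x ∷ xs) ys f = trans (cong (∑ ys (f x) +_) (∑-swap xs ys f)) (sym (∑-+ ys (f x) _))

    ∑-map : {A B : Set} (g : A → B) (xs : List A) (f : B → ℕ) → ∑ (map g xs) f ≡ ∑ xs (f ∘ g)
    ∑-map g xs f = cong sum (sym (List.map-∘ xs))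

    ∑-cartesianProductWith : {A B C : Set} (g : A → B → C) (xs : List A) (ys : List B) (f : C → ℕ) →
      ∑ (cartesianProductWith g xs ys) f ≡ ∑ xs (λ x → ∑ ys (λ y → f (g x y)))
    ∑-cartesianProductWith g []       ys f = refl
    ∑-cartesianProductWith g (x ∷ xs) ys f = trans (∑-++ (map (g x) ys) _ f)
      (cong₂ _+_ (∑-map (g x) ys f) (∑-cartesianProductWith g xs ys f))

    length-concatMap : {A B : Set} (g : A → List B) (xs : List A) →
                       length (concatMap g xs) ≡ ∑ xs (length ∘ g)
    length-concatMap g []       = refl
    length-concatMap g (x ∷ xs) =
      trans (List.length-++ (g x)) (cong (length (g x) +_) (length-concatMap g xs))

    ∑-term : {A : Set} {xs : List A} {x : A} (f : A → ℕ) → x ∈ xs → f x ≤ ∑ xs f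
    ∑-term f (here refl) = ℕ.m≤m+n _ _
    ∑-term f (there x∈)  = ℕ.≤-trans (∑-term f x∈) (ℕ.m≤n+m _ _)

    ∑-positive : {A : Set} (xs : List A) {f : A → ℕ} → 0 < ∑ xs f → ∃[ x ] 0 < f x
    ∑-positive (x ∷ xs) {f} 0<∑ with f x in eq
    ... | zero  = ∑-positive xs 0<∑
    ... | suc _ = x , subst (0 <_) (sym eq) (s≤s z≤n)

    ⟦_⟧ : {P : Set} → Dec P → ℕ
    ⟦ yes _ ⟧ = 1
    ⟦ no _ ⟧  = 0

    ⟦⟧≤1 : {P : Set} (P? : Dec P) → ⟦ P? ⟧ ≤ 1
    ⟦⟧≤1 (yes _) = s≤s z≤n
    ⟦⟧≤1 (no _)  = z≤n

    ⟦⟧-mono : {P Q : Set} (P? : Dec P) (Q? : Dec Q) → (P → Q) → ⟦ P? ⟧ ≤ ⟦ Q? ⟧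
    ⟦⟧-mono (no _)  _       f = z≤n
    ⟦⟧-mono (yes p) (yes q) f = s≤s z≤n
    ⟦⟧-mono (yes p) (no ¬q) f = contradiction (f p) ¬q

    ⟦⟧-cong : {P Q : Set} (P? : Dec P) (Q? : Dec Q) → (P → Q) → (Q → P) → ⟦ P? ⟧ ≡ ⟦ Q? ⟧
    ⟦⟧-cong P? Q? f g = ℕ.≤-antisym (⟦⟧-mono P? Q? f) (⟦⟧-mono Q? P? g)

    ⟦⟧-× : {P Q R : Set} (P? : Dec P) (Q? : Dec Q) (R? : Dec R) → (P → Q × R) → ⟦ P? ⟧ ≤ ⟦ Q? ⟧ * ⟦ R? ⟧
    ⟦⟧-× (no _)  _       _       f = z≤n
    ⟦⟧-× (yes p) (yes _) (yes _) f = s≤s z≤n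
    ⟦⟧-× (yes p) (no ¬q) _       f = contradiction (proj₁ (f p)) ¬q
    ⟦⟧-× (yes p) _       (no ¬r) f = contradiction (proj₂ (f p)) ¬r

    ⟦⟧-positive : {P : Set} (P? : Dec P) → 0 < ⟦ P? ⟧ → P
    ⟦⟧-positive (yes p) _ = p

    ∑-injective : {A : Set} {xs : List A} → Unique xs → {g : A → ℕ} → Injective _≡_ _≡_ g →
                  ∀ y → ∑ xs (λ x → ⟦ g x ℕ.≟ y ⟧) ≤ 1
    ∑-injective []          inj y = z≤n
    ∑-injective {A} {x ∷ xs} (x∉xs ∷ uniq) {g} inj y with g x ℕ.≟ y
    ... | no _     = ∑-injective uniq inj y
    ... | yes refl = s≤s (begin
      ∑ xs (λ z → ⟦ g z ℕ.≟ g x ⟧) ≤⟨ ∑-mono xs zero-term ⟩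
      ∑ xs (λ _ → 0)               ≡⟨ trans (∑-const xs 0) (ℕ.*-zeroʳ (length xs)) ⟩
      0                            ∎)
      where
      open ℕ.≤-Reasoning
      zero-term : ∀ {z} → z ∈ xs → ⟦ g z ℕ.≟ g x ⟧ ≤ 0
      zero-term {z} z∈ with g z ℕ.≟ g x
      ... | no _   = z≤n
      ... | yes eq = contradiction (sym (inj eq)) (All.lookup x∉xs z∈)

  open Sums

  -- Counting colourings by resampling the colours of single vertices.

  module Resampling (k : ℕ) where

    colourings : ∀ n → List (Vec (Fin k) n)
    colourings zero    = [] ∷ []
    colourings (suc n) = cartesianProductWith _∷_ (allFin k) (colourings n)

    length-colourings : ∀ n → length (colourings n) ≡ k ^ n
    length-colourings zero    = refl
    length-colourings (suc n) = begin
      length (colourings (suc n))                            ≡⟨ trans (∑-const (colourings (suc n)) 1) (ℕ.*-identityʳ _) ⟨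
      ∑ (colourings (suc n)) (λ _ → 1)                       ≡⟨ ∑-cartesianProductWith _∷_ (allFin k) (colourings n) _ ⟩
      ∑ (allFin k) (λ _ → ∑ (colourings n) (λ _ → 1))        ≡⟨ ∑-const (allFin k) _ ⟩
      length (allFin k) * ∑ (colourings n) (λ _ → 1)         ≡⟨ cong₂ _*_ (List.length-tabulate {n = k} _) (trans (∑-const (colourings n) 1) (ℕ.*-identityʳ _)) ⟩
      k * length (colourings n)                              ≡⟨ cong (k *_) (length-colourings n) ⟩
      k * k ^ n                                              ∎
      where open ≡-Reasoning

    -- Overwriting position `h` is k-to-one: each colouring arises from exactly the `k` colourings
    -- that differ from it at most at `h`.
    ∑-resample : ∀ {n} (h : Fin n) (f : Vec (Fin k) n → ℕ) →
      k * ∑ (colourings n) f ≡ ∑ (colourings n) (λ c → ∑ (allFin k) (λ x → f (c [ h ]≔ x)))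
    ∑-resample {suc n} zero f = begin
      k * ∑ (colourings (suc n)) f
        ≡⟨ cong₂ _*_ (sym (List.length-tabulate {n = k} _)) (∑-cartesianProductWith _∷_ (allFin k) (colourings n) f) ⟩
      length (allFin k) * ∑ (allFin k) (λ x → ∑ (colourings n) (λ c → f (x ∷ c)))
        ≡⟨ cong (length (allFin k) *_) (∑-swap (allFin k) (colourings n) _) ⟩
      length (allFin k) * ∑ (colourings n) (λ c → ∑ (allFin k) (λ x → f (x ∷ c)))
        ≡⟨ ∑-const (allFin k) _ ⟨
      ∑ (allFin k) (λ _ → ∑ (colourings n) (λ c → ∑ (allFin k) (λ x → f (x ∷ c))))
        ≡⟨ ∑-cartesianProductWith _∷_ (allFin k) (colourings n) _ ⟨
      ∑ (colourings (suc n)) (λ c → ∑ (allFin k) (λ x → f (c [ zero ]≔ x))) ∎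
      where open ≡-Reasoning
    ∑-resample {suc n} (suc h) f = begin
      k * ∑ (colourings (suc n)) f
        ≡⟨ cong (k *_) (∑-cartesianProductWith _∷_ (allFin k) (colourings n) f) ⟩
      k * ∑ (allFin k) (λ y → ∑ (colourings n) (λ c → f (y ∷ c)))
        ≡⟨ ∑-* (allFin k) k _ ⟨
      ∑ (allFin k) (λ y → k * ∑ (colourings n) (λ c → f (y ∷ c)))
        ≡⟨ ∑-cong (allFin k) (λ y → ∑-resample h (λ c → f (y ∷ c))) ⟩
      ∑ (allFin k) (λ y → ∑ (colourings n) (λ c → ∑ (allFin k) (λ x → f (y ∷ c [ h ]≔ x))))
        ≡⟨ ∑-cartesianProductWith _∷_ (allFin k) (colourings n) _ ⟨
      ∑ (colourings (suc n)) (λ c → ∑ (allFin k) (λ x → f (c [ suc h ]≔ x))) ∎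
      where open ≡-Reasoning

    module _ {n : ℕ} (row : Fin n → Fin k → ℕ) where

      colour : Vec (Fin k) n → Fin n → ℕ
      colour c v = row v (lookup c v)

      colour-≔ : ∀ c {h v} x → v ≢ h → colour (c [ h ]≔ x) v ≡ colour c v
      colour-≔ c {h} {v} x v≢h = cong (row v) (Vec.lookup∘update′ v≢h c x)

      Ignores : (Vec (Fin k) n → ℕ) → Fin n → Set
      Ignores f h = ∀ c x → f (c [ h ]≔ x) ≡ f c

      agree? : ∀ c (xs ys : List (Fin n)) → Dec (map (colour c) xs ≡ map (colour c) ys)
      agree? c xs ys = List.≡-dec ℕ._≟_ (map (colour c) xs) (map (colour c) ys)

      module _ (row-injective : ∀ v → Injective _≡_ _≡_ (row v)) where

        -- Once `h` is resampled, the weight and the colour of `h′` stay fixed, and by injectivity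
        -- of `row h` at most one of the `k` choices hits that colour.
        single-agreement : ∀ f {h h′} → h ≢ h′ → Ignores f h →
          k * ∑ (colourings n) (λ c → f c * ⟦ colour c h ℕ.≟ colour c h′ ⟧) ≤ ∑ (colourings n) f
        single-agreement f {h} {h′} h≢h′ ign = begin
          k * ∑ (colourings n) (λ c → f c * ⟦ colour c h ℕ.≟ colour c h′ ⟧)
            ≡⟨ ∑-resample h _ ⟩
          ∑ (colourings n) (λ c → ∑ (allFin k) (λ x →
            f (c [ h ]≔ x) * ⟦ colour (c [ h ]≔ x) h ℕ.≟ colour (c [ h ]≔ x) h′ ⟧))
            ≡⟨ ∑-cong (colourings n) (λ c → trans (∑-cong (allFin k) (λ x →
                 cong₂ _*_ (ign c x) (cong₂ (λ a b → ⟦ a ℕ.≟ b ⟧)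
                   (cong (row h) (Vec.lookup∘update h c x)) (colour-≔ c x (≢-sym h≢h′)))))
                 (∑-* (allFin k) (f c) _)) ⟩
          ∑ (colourings n) (λ c → f c * ∑ (allFin k) (λ x → ⟦ row h x ℕ.≟ colour c h′ ⟧))
            ≤⟨ ∑-mono (colourings n) (λ {c} _ → ℕ.*-monoʳ-≤ (f c)
                 (∑-injective (Unique.allFin⁺ k) (row-injective h) (colour c h′))) ⟩
          ∑ (colourings n) (λ c → f c * 1)
            ≡⟨ ∑-cong (colourings n) (λ c → ℕ.*-identityʳ (f c)) ⟩
          ∑ (colourings n) f ∎
          where open ℕ.≤-Reasoning

        -- The positions of `xs` are resampled one by one. The agreements still to be treated
        -- involve neither the head of `xs` nor its colour, so they can be absorbed into the weight,
        -- which then still ignores the head.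
        agreement : ∀ f xs ys → length xs ≡ length ys → Unique xs →
          (∀ {h} → h ∈ xs → h ∉ ys) → (∀ {h} → h ∈ xs → Ignores f h) →
          k ^ length xs * ∑ (colourings n) (λ c → f c * ⟦ agree? c xs ys ⟧) ≤ ∑ (colourings n) f
        agreement f [] ys _ _ _ _ = begin
          1 * ∑ (colourings n) (λ c → f c * ⟦ agree? c [] ys ⟧) ≡⟨ ℕ.*-identityˡ _ ⟩
          ∑ (colourings n) (λ c → f c * ⟦ agree? c [] ys ⟧)     ≤⟨ ∑-mono (colourings n) (λ {c} _ → ℕ.≤-trans
                                                                     (ℕ.*-monoʳ-≤ (f c) (⟦⟧≤1 (agree? c [] ys)))
                                                                     (ℕ.≤-reflexive (ℕ.*-identityʳ (f c)))) ⟩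
          ∑ (colourings n) f ∎
          where open ℕ.≤-Reasoning
        agreement f (x ∷ xs) (y ∷ ys) eq (x∉xs ∷ uniq) disj ign = begin
          k * k ^ length xs * ∑ (colourings n) (λ c → f c * ⟦ agree? c (x ∷ xs) (y ∷ ys) ⟧)
            ≤⟨ ℕ.*-monoʳ-≤ (k * k ^ length xs) (∑-mono (colourings n) (λ {c} _ → split c)) ⟩
          k * k ^ length xs * ∑ (colourings n) (λ c → g c * ⟦ colour c x ℕ.≟ colour c y ⟧)
            ≡⟨ trans (cong (_* s) (ℕ.*-comm k (k ^ length xs))) (ℕ.*-assoc (k ^ length xs) k s) ⟩
          k ^ length xs * (k * ∑ (colourings n) (λ c → g c * ⟦ colour c x ℕ.≟ colour c y ⟧))
            ≤⟨ ℕ.*-monoʳ-≤ (k ^ length xs) (single-agreement g (λ { refl → disj (here refl) (here refl) }) g-ign) ⟩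
          k ^ length xs * ∑ (colourings n) g
            ≤⟨ agreement f xs ys (ℕ.suc-injective eq) uniq (λ h∈ → disj (there h∈) ∘ there) (ign ∘ there) ⟩
          ∑ (colourings n) f ∎
          where
          open ℕ.≤-Reasoning
          g : Vec (Fin k) n → ℕ
          g c = f c * ⟦ agree? c xs ys ⟧
          s = ∑ (colourings n) (λ c → g c * ⟦ colour c x ℕ.≟ colour c y ⟧)
          unchanged : ∀ c z ws → x ∉ ws → map (colour (c [ x ]≔ z)) ws ≡ map (colour c) ws
          unchanged c z []       _  = refl
          unchanged c z (w ∷ ws) x∉ = cong₂ _∷_ (colour-≔ c z (λ { refl → x∉ (here refl) }))
            (unchanged c z ws (x∉ ∘ there))
          g-ign : Ignores g x
          g-ign c z = cong₂ _*_ (ign (here refl) c z) (cong₂ (λ as bs → ⟦ List.≡-dec ℕ._≟_ as bs ⟧)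
            (unchanged c z xs (λ x∈ → All.lookup x∉xs x∈ refl))
            (unchanged c z ys (disj (here refl) ∘ there)))
          split : ∀ c → f c * ⟦ agree? c (x ∷ xs) (y ∷ ys) ⟧ ≤ g c * ⟦ colour c x ℕ.≟ colour c y ⟧
          split c = subst (f c * ⟦ agree? c (x ∷ xs) (y ∷ ys) ⟧ ≤_) (sym (ℕ.*-assoc (f c) _ _))
            (ℕ.*-monoʳ-≤ (f c) (⟦⟧-× (agree? c (x ∷ xs) (y ∷ ys)) (agree? c xs ys) (colour c x ℕ.≟ colour c y)
              λ p → List.∷-injectiveʳ p , List.∷-injectiveˡ p))

  -- Duplicate-free and linked lists.

  unique-lookup-injective : {A : Set} {xs : List A} → Unique xs → Injective _≡_ _≡_ (List.lookup xs)
  unique-lookup-injective (_ ∷ _)      {zero}  {zero}  _  = refl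
  unique-lookup-injective (x∉ ∷ _)     {zero}  {suc j} eq = contradiction eq (All.lookup x∉ (∈-lookup j))
  unique-lookup-injective (x∉ ∷ _)     {suc i} {zero}  eq = contradiction (sym eq) (All.lookup x∉ (∈-lookup i))
  unique-lookup-injective (_ ∷ unique) {suc i} {suc j} eq = cong suc (unique-lookup-injective unique eq)

  unique-++ : {A : Set} (xs : List A) {ys : List A} → Unique (xs ++ ys) →
              Unique xs × (∀ {x} → x ∈ xs → x ∉ ys)
  unique-++ []       _ = [] , λ ()
  unique-++ (x ∷ xs) (x∉ ∷ unique) with unique-++ xs unique
  ... | unique-xs , disjoint = All.++⁻ˡ xs x∉ ∷ unique-xs , λ where
    (here refl) → λ x∈ → All.lookup (All.++⁻ʳ xs x∉) x∈ refl
    (there y∈)  → disjoint y∈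

  module _ {A : Set} {R : Rel A 0ℓ} where

    linked-++ʳ : ∀ xs {ys} → Linked R (xs ++ ys) → Linked R ys
    linked-++ʳ []       l = l
    linked-++ʳ (x ∷ xs) l = linked-++ʳ xs (Linked.tail l)

    linked-ʳ++ : Symmetric R → ∀ x xs ys → Linked R (x ∷ xs) → Linked R (x ∷ ys) → Linked R (xs ʳ++ (x ∷ ys))
    linked-ʳ++ R-sym x []       ys _         acc = acc
    linked-ʳ++ R-sym x (z ∷ xs) ys (xRz ∷ l) acc = linked-ʳ++ R-sym z xs (x ∷ ys) l (R-sym xRz ∷ acc)

    linked-reverse : Symmetric R → ∀ xs → Linked R xs → Linked R (reverse xs)
    linked-reverse R-sym []       _ = []
    linked-reverse R-sym (x ∷ xs) l = linked-ʳ++ R-sym x xs [] l [-]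

    linked-toList : ∀ {n} {xs : Vec A n} → VecLinked.Linked R xs → Linked R (Vec.toList xs)
    linked-toList VecLinked.[]       = []
    linked-toList VecLinked.[-]      = [-]
    linked-toList {xs = _ ∷ _ ∷ _} (r VecLinked.∷ rs) = r ∷ linked-toList rs

  unique-toList : {A : Set} {n : ℕ} {xs : Vec A n} → VecUnique.Unique xs → Unique (Vec.toList xs)
  unique-toList VecAllPairs.[]       = []
  unique-toList (r VecAllPairs.∷ rs) = all r ∷ unique-toList rs
    where
    all : ∀ {A : Set} {P : A → Set} {n} {xs : Vec A n} → VecAll.All P xs → All P (Vec.toList xs)
    all VecAll.[]       = []
    all (p VecAll.∷ ps) = p ∷ all ps

  allOfLength? : ∀ {n} m {P : List (Fin n) → Set} → (∀ xs → Dec (P xs)) → Dec (∀ xs → length xs ≡ m → P xs)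
  allOfLength? zero    P? = map′ (λ { p [] _ → p }) (λ f → f [] refl) (P? [])
  allOfLength? (suc m) P? = map′
    (λ { f (x ∷ xs) eq → f x xs (ℕ.suc-injective eq) })
    (λ f x xs eq → f (x ∷ xs) (cong suc eq))
    (Fin.all? λ x → allOfLength? m (λ xs → P? (x ∷ xs)))

  take-++-length : {A : Set} (xs ys : List A) → take (length xs) (xs ++ ys) ≡ xs
  take-++-length []       ys = refl
  take-++-length (x ∷ xs) ys = cong (x ∷_) (take-++-length xs ys)

  drop-++-length : {A : Set} (xs ys : List A) → drop (length xs) (xs ++ ys) ≡ ys
  drop-++-length []       ys = refl
  drop-++-length (x ∷ xs) ys = drop-++-length xs ys

  -- Enumerating the paths through a vertex.

  module Walks (G : Graph) (Δ : ℕ) (degree≤Δ : ∀ v → Graph.degree G v ≤ Δ) where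

    open Graph G

    -- The start `v` is left out of each list, so that two walks from `v` can be glued along it.
    walks : Vertex → ℕ → List (List Vertex)
    walks v zero    = [] ∷ []
    walks v (suc m) = concatMap (λ w → map (w ∷_) (walks w m)) (filter (v ~?_) (allFin order))

    length-walks : ∀ v m → length (walks v m) ≤ Δ ^ m
    length-walks v zero    = ℕ.≤-refl
    length-walks v (suc m) = begin
      length (walks v (suc m))                                  ≡⟨ length-concatMap _ nbrs ⟩
      ∑ nbrs (λ w → length (map (w ∷_) (walks w m)))            ≤⟨ ∑-mono nbrs (λ {w} _ → ℕ.≤-trans
                                                                     (ℕ.≤-reflexive (List.length-map _ (walks w m))) (length-walks w m)) ⟩
      ∑ nbrs (λ _ → Δ ^ m)                                      ≡⟨ ∑-const nbrs (Δ ^ m) ⟩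
      degree v * Δ ^ m                                          ≤⟨ ℕ.*-monoˡ-≤ (Δ ^ m) (degree≤Δ v) ⟩
      Δ * Δ ^ m                                                 ∎
      where
      open ℕ.≤-Reasoning
      nbrs = filter (v ~?_) (allFin order)

    ∈-walks : ∀ v xs → Linked _~_ (v ∷ xs) → xs ∈ walks v (length xs)
    ∈-walks v []       _         = here refl
    ∈-walks v (w ∷ xs) (v~w ∷ l) = ∈-concatMap⁺ _
      (Any.map (λ { refl → ∈-map⁺ _ (∈-walks w xs l) }) (∈-filter⁺ (v ~?_) (∈-allFin w) v~w))

    -- Two halves of i + 1 vertices each, with v at position a of the first one.
    joined : ℕ → Vertex → List Vertex → List Vertex → List Vertex × List Vertex
    joined i v l r = take (suc i) (reverse l ++ v ∷ r) , drop (suc i) (reverse l ++ v ∷ r)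

    -- Of the 2i + 2 vertices, `a` precede `v`; they form a walk leading away from `v`, which
    -- `joined` reverses. The rest form a walk of 2i + 1 - a steps.
    halvesAt : Vertex → ℕ → ℕ → List (List Vertex × List Vertex)
    halvesAt v i a = cartesianProductWith (joined i v) (walks v a) (walks v (suc (i + i) ∸ a))

    halves : Vertex → ℕ → List (List Vertex × List Vertex)
    halves v i = concatMap (halvesAt v i) (upTo (suc i))

    -- The two walk lengths add up to 2i + 1 whatever the position `a`, so all i + 1 positions
    -- contribute the same power of Δ.
    length-halves : ∀ v i → length (halves v i) ≤ suc i * Δ ^ suc (i + i)
    length-halves v i = begin
      length (halves v i)                         ≡⟨ length-concatMap (halvesAt v i) (upTo (suc i)) ⟩
      ∑ (upTo (suc i)) (length ∘ halvesAt v i)                          ≤⟨ ∑-mono (upTo (suc i)) (λ {a} → term {a}) ⟩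
      ∑ (upTo (suc i)) (λ _ → Δ ^ suc (i + i))    ≡⟨ ∑-const (upTo (suc i)) _ ⟩
      length (upTo (suc i)) * Δ ^ suc (i + i)     ≡⟨ cong (_* Δ ^ suc (i + i)) (List.length-upTo (suc i)) ⟩
      suc i * Δ ^ suc (i + i)                     ∎
      where
      open ℕ.≤-Reasoning
      length-product : ∀ {A B C : Set} (g : A → B → C) xs ys → length (cartesianProductWith g xs ys) ≡ length xs * length ys
      length-product g []       ys = refl
      length-product g (x ∷ xs) ys = trans (List.length-++ (map (g x) ys))
        (cong₂ _+_ (List.length-map (g x) ys) (length-product g xs ys))
      term : ∀ {a} → a ∈ upTo (suc i) → length (halvesAt v i a) ≤ Δ ^ suc (i + i)
      term {a} a∈ = begin
        length (halvesAt v i a)                                           ≡⟨ length-product _ (walks v a) _ ⟩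
        length (walks v a) * length (walks v b)                           ≤⟨ ℕ.*-mono-≤ (length-walks v a) (length-walks v b) ⟩
        Δ ^ a * Δ ^ b                                                     ≡⟨ ℕ.^-distribˡ-+-* Δ a b ⟨
        Δ ^ (a + b)                                                       ≡⟨ cong (Δ ^_) (ℕ.m+[n∸m]≡n a≤) ⟩
        Δ ^ suc (i + i)                                                   ∎
        where
        b = suc (i + i) ∸ a
        a≤ : a ≤ suc (i + i)
        a≤ = ℕ.≤-trans (ℕ.<⇒≤ (∈-upTo⁻ a∈)) (s≤s (ℕ.m≤m+n i i))

    -- The path is cut at an occurrence of `v` in `xs`; by symmetry of adjacency the piece before
    -- it, read backwards, is a walk from `v`.
    ∈-halves : ∀ v i xs ys → Linked _~_ (xs ++ ys) → length xs ≡ suc i → length ys ≡ suc i → v ∈ xs →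
               (xs , ys) ∈ halves v i
    ∈-halves v i xs ys linked ∣xs∣ ∣ys∣ v∈xs with ∈-∃++ v∈xs
    ... | as , bs , refl = ∈-concatMap⁺ (halvesAt v i) (Any.map (λ { refl → here-a }) (∈-upTo⁺ a<))
      where
      a = length as
      len : a + suc (length bs) ≡ suc i
      len = trans (sym (List.length-++ as)) ∣xs∣
      a< : a < suc i
      a< = subst (a <_) len (ℕ.m<m+n a (s≤s z≤n))
      assoc : (as ++ v ∷ bs) ++ ys ≡ as ++ v ∷ (bs ++ ys)
      assoc = List.++-assoc as (v ∷ bs) ys
      right : Linked _~_ (v ∷ (bs ++ ys))
      right = linked-++ʳ as (subst (Linked _~_) assoc linked)
      left : Linked _~_ (v ∷ reverse as)
      left = linked-++ʳ (reverse (bs ++ ys)) (subst (Linked _~_) eq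
        (linked-reverse ~-sym _ (subst (Linked _~_) assoc linked)))
        where
        eq : reverse (as ++ v ∷ (bs ++ ys)) ≡ reverse (bs ++ ys) ++ v ∷ reverse as
        eq = begin
          reverse (as ++ v ∷ (bs ++ ys))                   ≡⟨ List.reverse-++ as _ ⟩
          reverse (v ∷ (bs ++ ys)) ++ reverse as           ≡⟨ cong (_++ reverse as) (List.unfold-reverse v (bs ++ ys)) ⟩
          (reverse (bs ++ ys) List.∷ʳ v) ++ reverse as     ≡⟨ List.++-assoc (reverse (bs ++ ys)) _ _ ⟩
          reverse (bs ++ ys) ++ v ∷ reverse as             ∎
          where open ≡-Reasoning
      length-right : length (bs ++ ys) ≡ suc (i + i) ∸ a
      length-right = begin
        length (bs ++ ys)                  ≡⟨ trans (List.length-++ bs) (cong (length bs +_) ∣ys∣) ⟩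
        length bs + suc i                  ≡⟨ ℕ.+-suc (length bs) i ⟩
        suc (length bs) + i                ≡⟨ ℕ.m+n∸m≡n a (suc (length bs) + i) ⟨
        a + (suc (length bs) + i) ∸ a      ≡⟨ cong (_∸ a) (ℕ.+-assoc a (suc (length bs)) i) ⟨
        a + suc (length bs) + i ∸ a        ≡⟨ cong (λ m → m + i ∸ a) len ⟩
        suc (i + i) ∸ a                    ∎
        where open ≡-Reasoning
      whole : reverse (reverse as) ++ v ∷ (bs ++ ys) ≡ (as ++ v ∷ bs) ++ ys
      whole = trans (cong (_++ v ∷ (bs ++ ys)) (List.reverse-involutive as)) (sym assoc)
      joined≡ : (as ++ v ∷ bs , ys) ≡ joined i v (reverse as) (bs ++ ys)
      joined≡ = cong₂ _,_
        (trans (sym (take-++-length (as ++ v ∷ bs) ys)) (cong₂ take ∣xs∣ (sym whole)))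
        (trans (sym (drop-++-length (as ++ v ∷ bs) ys)) (cong₂ drop ∣xs∣ (sym whole)))
      here-a : (as ++ v ∷ bs , ys) ∈ halvesAt v i a
      here-a = subst (_∈ halvesAt v i a) (sym joined≡) (∈-cartesianProductWith⁺ (joined i v)
        (subst (λ m → reverse as ∈ walks v m) (List.length-reverse as) (∈-walks v (reverse as) left))
        (subst (λ m → bs ++ ys ∈ walks v m) length-right (∈-walks v (bs ++ ys) right)))

  ^-distribʳ-* : ∀ n a b → (a * b) ^ n ≡ a ^ n * b ^ n
  ^-distribʳ-* zero    a b = refl
  ^-distribʳ-* (suc n) a b = trans (cong (a * b *_) (^-distribʳ-* n a b))
    (solve 4 (λ a b p q → a :* b :* (p :* q) := a :* p :* (b :* q)) refl a b (a ^ n) (b ^ n))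

  -- The arithmetic-geometric series with ratio X / (X + E).

  module ArithmeticGeometric (X E : ℕ) where

    D : ℕ
    D = X + E

    -- The sum of (i + 1) X^i D^(m - 1 - i) over i < m, that is, a partial sum of the series in X /
    -- D with denominators cleared.
    S : ℕ → ℕ
    S zero    = 0
    S (suc m) = D * S m + suc m * X ^ m

    -- The series of (i + 1) q^i sums to 1 / (1 - q)² at q = X / D, where 1 - q = E / D. The second
    -- summand on the left is the tail, kept so that the induction is an exact identity.
    S-closed : ∀ m → E * E * S m + X ^ m * (D + m * E) ≡ D * D ^ m
    S-closed zero    = solve 2 (λ e d → e :* e :* con 0 :+ con 1 :* (d :+ con 0) := d :* con 1) refl E D
    S-closed (suc m) = begin
      E * E * (D * S m + suc m * X ^ m) + X * X ^ m * (D + suc m * E)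
        ≡⟨ solve 5 (λ x e s p m → e :* e :* ((x :+ e) :* s :+ (con 1 :+ m) :* p) :+ x :* p :* (x :+ e :+ (con 1 :+ m) :* e)
                                 := (x :+ e) :* (e :* e :* s :+ p :* (x :+ e :+ m :* e))) refl X E (S m) (X ^ m) m ⟩
      D * (E * E * S m + X ^ m * (D + m * E))
        ≡⟨ cong (D *_) (S-closed m) ⟩
      D * (D * D ^ m) ∎
      where
      open ≡-Reasoning

    module _ (k B : ℕ) (w : ℕ → ℕ) (w-bound : ∀ i → k * D ^ i * w i ≤ suc i * B * X ^ i) where

      ∑-bound : ∀ m → k * D ^ m * ∑ (downFrom m) w ≤ D * B * S m
      ∑-bound zero    = ℕ.≤-trans (ℕ.≤-reflexive (ℕ.*-zeroʳ (k * 1))) z≤n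
      ∑-bound (suc m) = begin
        k * (D * D ^ m) * (w m + ∑ (downFrom m) w)
          ≡⟨ solve 5 (λ k d p w t → k :* (d :* p) :* (w :+ t) := d :* (k :* p :* t) :+ d :* (k :* p :* w)) refl k D (D ^ m) (w m) _ ⟩
        D * (k * D ^ m * ∑ (downFrom m) w) + D * (k * D ^ m * w m)
          ≤⟨ ℕ.+-mono-≤ (ℕ.*-monoʳ-≤ D (∑-bound m)) (ℕ.*-monoʳ-≤ D (w-bound m)) ⟩
        D * (D * B * S m) + D * (suc m * B * X ^ m)
          ≡⟨ solve 5 (λ d b s m p → d :* (d :* b :* s) :+ d :* (m :* b :* p) := d :* b :* (d :* s :+ m :* p)) refl D B (S m) (suc m) (X ^ m) ⟩
        D * B * S (suc m) ∎
        where
        open ℕ.≤-Reasoning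

      weighted-∑-bound : 0 < D → ∀ m → E * E * (k * ∑ (downFrom m) w) ≤ B * (D * D)
      weighted-∑-bound 0<D m = ℕ.*-cancelˡ-≤ (D ^ m) ⦃ ℕ.m^n≢0 D m ⦃ ℕ.>-nonZero 0<D ⦄ ⦄ (begin
        D ^ m * (E * E * (k * ∑ (downFrom m) w)) ≡⟨ solve 4 (λ p e k t → p :* (e :* e :* (k :* t)) := e :* e :* (k :* p :* t)) refl (D ^ m) E k _ ⟩
        E * E * (k * D ^ m * ∑ (downFrom m) w)   ≤⟨ ℕ.*-monoʳ-≤ (E * E) (∑-bound m) ⟩
        E * E * (D * B * S m)                    ≡⟨ solve 4 (λ e d b s → e :* e :* (d :* b :* s) := d :* b :* (e :* e :* s)) refl E D B (S m) ⟩
        D * B * (E * E * S m)                    ≤⟨ ℕ.*-monoʳ-≤ (D * B) (ℕ.≤-trans (ℕ.m≤m+n _ _) (ℕ.≤-reflexive (S-closed m))) ⟩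
        D * B * (D * D ^ m)                      ≡⟨ solve 3 (λ d b p → d :* b :* (d :* p) := p :* (b :* (d :* d))) refl D B (D ^ m) ⟩
        D ^ m * (B * (D * D))                    ∎)
        where
        open ℕ.≤-Reasoning

  -- Stated over variables because the ring solver would evaluate the counts they are applied to.
  module Identities where

    x∙yz≡y∙xz : ∀ x y z → x * (y * z) ≡ y * (x * z)
    x∙yz≡y∙xz = solve 3 (λ x y z → x :* (y :* z) := y :* (x :* z)) refl

    xy∙z≡y∙xz : ∀ x y z → x * y * z ≡ y * (x * z)
    xy∙z≡y∙xz = solve 3 (λ x y z → x :* y :* z := y :* (x :* z)) refl

    x∙[yz∙w]≡z∙[yx∙w] : ∀ x y z w → x * (y * z * w) ≡ z * (y * x * w)
    x∙[yz∙w]≡z∙[yx∙w] = solve 4 (λ x y z w → x :* (y :* z :* w) := z :* (y :* x :* w)) refl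

    x∙[yz∙w]≡y[xz]∙w : ∀ x y z w → x * (y * z * w) ≡ y * (x * z) * w
    x∙[yz∙w]≡y[xz]∙w = solve 4 (λ x y z w → x :* (y :* z :* w) := y :* (x :* z) :* w) refl

    count-identity : ∀ s δ p x n → s * (δ * p) * (x * n) ≡ p * (s * (δ * n) * x)
    count-identity = solve 5 (λ s δ p x n → s :* (δ :* p) :* (x :* n) := p :* (s :* (δ :* n) :* x)) refl

    -- In fractions: `loss` bounds `t` by (δ d / (e k)) n, so n′ ≥ (1 - δ d / (e k)) n, and `enough`
    -- says that this factor is at least a / (x k). Adding the loss term to both sides avoids
    -- subtraction in ℕ.
    growth-inequality : ∀ a x e k δ d {n n′ t} → 0 < e → a * e + δ * d * x ≤ x * e * k →
                        n ≤ n′ + t → e * (k * t) ≤ δ * n * d → a * n ≤ x * k * n′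
    growth-inequality a x e k δ d {n} {n′} {t} 0<e enough split loss =
      ℕ.*-cancelʳ-≤ _ _ e ⦃ ℕ.>-nonZero 0<e ⦄ (ℕ.+-cancelʳ-≤ (δ * n * d * x) (a * n * e) (x * k * n′ * e) (begin
        a * n * e + δ * n * d * x
          ≡⟨ solve 6 (λ a n e δ d x → a :* n :* e :+ δ :* n :* d :* x := (a :* e :+ δ :* d :* x) :* n) refl a n e δ d x ⟩
        (a * e + δ * d * x) * n
          ≤⟨ ℕ.*-monoˡ-≤ n enough ⟩
        x * e * k * n
          ≤⟨ ℕ.*-monoʳ-≤ (x * e * k) split ⟩
        x * e * k * (n′ + t)
          ≡⟨ solve 5 (λ x e k n t → x :* e :* k :* (n :+ t) := x :* k :* n :* e :+ e :* (k :* t) :* x) refl x e k n′ t ⟩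
        x * k * n′ * e + e * (k * t) * x
          ≤⟨ ℕ.+-monoʳ-≤ (x * k * n′ * e) (ℕ.*-monoˡ-≤ x loss) ⟩
        x * k * n′ * e + δ * n * d * x ∎))
      where open ℕ.≤-Reasoning

  open Identities

  -- Colourings without repetitions inside a set of vertices.

  module Counting (G : Graph) (k : ℕ) (row : Graph.Vertex G → Fin k → ℕ)
                  (row-injective : ∀ v → Injective _≡_ _≡_ (row v)) where

    open Graph G
    open Resampling k
    open DecMembership (Fin._≟_ {order}) using (_∈?_)

    Colouring : Set
    Colouring = Vec (Fin k) order

    col : Colouring → Vertex → ℕ
    col = colour row

    same? : (xs ys : List Vertex) (c : Colouring) → Dec (map (col c) xs ≡ map (col c) ys)
    same? xs ys c = agree? row c xs ys

    Legal : List Vertex → List Vertex → List Vertex → Set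
    Legal S xs ys = Linked _~_ (xs ++ ys) × Unique (xs ++ ys) × All (_∈ S) (xs ++ ys)

    legal? : ∀ S xs ys → Dec (Legal S xs ys)
    legal? S xs ys = Linked.linked? _~?_ (xs ++ ys) ×-dec
      AllPairs.allPairs? (λ x y → ¬? (x Fin.≟ y)) (xs ++ ys) ×-dec All.all? (_∈? S) (xs ++ ys)

    -- Half length `suc i` builds in j ≥ 1. Lists replace vectors so that a path can be cut at any
    -- vertex and reversed.
    Good : List Vertex → Colouring → Set
    Good S c = ∀ i xs → length xs ≡ suc i → ∀ ys → length ys ≡ suc i →
               Legal S xs ys → map (col c) xs ≢ map (col c) ys

    -- A half has distinct vertices. This makes `Good` a finite search and the sum over half lengths
    -- finite.
    half-bounded : ∀ {i S xs ys} → length xs ≡ suc i → Legal S xs ys → i < order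
    half-bounded {xs = xs} ∣xs∣ (_ , unique , _) =
      subst (_≤ order) ∣xs∣ (Fin.injective⇒≤ (unique-lookup-injective (proj₁ (unique-++ xs unique))))

    good? : ∀ S c → Dec (Good S c)
    good? S c = map′
      (λ f i xs ∣xs∣ ys ∣ys∣ legal → All.lookup f (∈-downFrom⁺ (half-bounded {ys = ys} ∣xs∣ legal)) xs ∣xs∣ ys ∣ys∣ legal)
      (λ f → All.universal f (downFrom order))
      (All.all? (λ i → allOfLength? (suc i) λ xs → allOfLength? (suc i) λ ys →
        legal? S xs ys →-dec ¬? (same? xs ys c)) (downFrom order))

    good-antitone : ∀ {S T c} → (∀ {w} → w ∈ S → w ∈ T) → Good T c → Good S c
    good-antitone S⊆T good i xs ∣xs∣ ys ∣ys∣ (linked , unique , ⊆S) =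
      good i xs ∣xs∣ ys ∣ys∣ (linked , unique , All.map S⊆T ⊆S)

    good-local : ∀ {S c d} → (∀ {w} → w ∈ S → col d w ≡ col c w) → Good S c → Good S d
    good-local {S} {c} {d} d≈c good i xs ∣xs∣ ys ∣ys∣ legal@(_ , _ , ⊆S) same =
      good i xs ∣xs∣ ys ∣ys∣ legal (trans (sym (agree xs (All.++⁻ˡ xs ⊆S))) (trans same (agree ys (All.++⁻ʳ xs ⊆S))))
      where
      agree : ∀ ws → All (_∈ S) ws → map (col d) ws ≡ map (col c) ws
      agree []       []         = refl
      agree (w ∷ ws) (w∈ ∷ ws⊆) = cong₂ _∷_ (d≈c w∈) (agree ws ws⊆)

    -- Vertices outside `S` remain freely coloured, so different sets are compared within one family
    -- of colourings and deleted vertices can be resampled.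
    N : List Vertex → ℕ
    N S = ∑ (colourings order) (λ c → ⟦ good? S c ⟧)

    N-antitone : ∀ {S T} → (∀ {w} → w ∈ S → w ∈ T) → N T ≤ N S
    N-antitone {S} {T} S⊆T = ∑-mono (colourings order) λ {c} _ →
      ⟦⟧-mono (good? T c) (good? S c) (good-antitone {c = c} S⊆T)

    N-[] : N [] ≡ k ^ order
    N-[] = begin
      -- The decision `0 ℕ.≟ 0` stands for a true proposition: its indicator computes to 1.
      N []                                ≡⟨ ∑-cong (colourings order) (λ c → ⟦⟧-cong (good? [] c) (0 ℕ.≟ 0) (λ _ → refl) (λ _ → empty c)) ⟩
      ∑ (colourings order) (λ _ → 1)      ≡⟨ trans (∑-const (colourings order) 1) (ℕ.*-identityʳ _) ⟩
      length (colourings order)           ≡⟨ length-colourings order ⟩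
      k ^ order                           ∎
      where
      open ≡-Reasoning
      empty : ∀ c → Good [] c
      empty c i (x ∷ xs) _ ys _ (_ , _ , () ∷ _)

    infixl 5 _-_ _∖_

    _-_ : List Vertex → Vertex → List Vertex
    S - h = filter (λ w → ¬? (w Fin.≟ h)) S

    _∖_ : List Vertex → List Vertex → List Vertex
    S ∖ []       = S
    S ∖ (h ∷ hs) = (S - h) ∖ hs

    ∖-⊆ : ∀ {S} hs {w} → w ∈ S ∖ hs → w ∈ S
    ∖-⊆ []       w∈ = w∈
    ∖-⊆ (h ∷ hs) w∈ = proj₁ (∈-filter⁻ _ (∖-⊆ hs w∈))

    ∖-∉ : ∀ {S} hs {h} → h ∈ hs → h ∉ S ∖ hs
    ∖-∉ {S} (h ∷ hs) (here refl) h∈S = proj₂ (∈-filter⁻ (λ w → ¬? (w Fin.≟ h)) {xs = S} (∖-⊆ hs h∈S)) refl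
    ∖-∉ (h ∷ hs) (there g∈)  g∈S = ∖-∉ hs g∈ g∈S

    length-remove : ∀ {S h} → h ∈ S → length (S - h) < length S
    length-remove {S} {h} h∈ = List.filter-notAll (λ w → ¬? (w Fin.≟ h)) S
      (Any.map (λ { refl ¬≡ → ¬≡ refl }) h∈)

    ∈-remove : ∀ {S h w} → w ∈ S → w ≢ h → w ∈ S - h
    ∈-remove {h = h} = ∈-filter⁺ (λ w → ¬? (w Fin.≟ h))

    ⊆-remove-insert : ∀ {S} h {w} → w ∈ S → w ∈ h ∷ (S - h)
    ⊆-remove-insert h {w} w∈ with w Fin.≟ h
    ... | yes refl = here refl
    ... | no w≢h   = there (∈-remove w∈ w≢h)

    good-ignores : ∀ {S h} → h ∉ S → Ignores row (λ c → ⟦ good? S c ⟧) h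
    good-ignores {S} {h} h∉S c x = ⟦⟧-cong (good? S (c [ h ]≔ x)) (good? S c)
      (good-local {c = c [ h ]≔ x} {d = c} λ w∈ → sym (eq w∈)) (good-local {c = c} {d = c [ h ]≔ x} eq)
      where
      eq : ∀ {w} → w ∈ S → col (c [ h ]≔ x) w ≡ col c w
      eq w∈ = colour-≔ row c x (λ { refl → h∉S w∈ })

    -- Reversal exchanges the halves. It reduces repetitions with the new vertex in the second half
    -- to those with it in the first.
    good-reverse : ∀ {S xs ys} → Legal S xs ys → Legal S (reverse ys) (reverse xs)
    good-reverse {S} {xs} {ys} (linked , unique , ⊆S) =
      subst (Linked _~_) eq (linked-reverse ~-sym _ linked) ,
      subst Unique eq (PermS.AllPairs-resp-↭ (setoid Vertex) ≢-sym ((λ { refl p → p }) , λ { refl p → p })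
        (↭⇒↭ₛ (↭-sym (Perm.↭-reverse (xs ++ ys)))) unique) ,
      subst (All (_∈ S)) eq (Perm.All-resp-↭ (↭-sym (Perm.↭-reverse (xs ++ ys))) ⊆S)
      where
      eq : reverse (xs ++ ys) ≡ reverse ys ++ reverse xs
      eq = List.reverse-++ xs ys

    clashes : List Vertex → List Vertex × List Vertex → ℕ
    clashes S (xs , ys) = ∑ (colourings order) (λ c → ⟦ good? S c ⟧ * ⟦ same? xs ys c ⟧)

    -- The growth induction.

    module Growth (Δ : ℕ) (degree≤Δ : ∀ v → degree v ≤ Δ) (0<Δ : 0 < Δ) (X E : ℕ) (0<X : 0 < X) (0<E : 0 < E)
      (enough : Δ * Δ * (X + E) * (E * E) + Δ * ((X + E) * (X + E)) * X ≤ X * (E * E) * k) where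

      open Walks G Δ degree≤Δ
      open ArithmeticGeometric X E using (D; weighted-∑-bound)

      -- a / b is β / k for the growth factor β = Δ² D / X.
      a b : ℕ
      a = Δ * Δ * D
      b = X * k

      0<EE : 0 < E * E
      0<EE = ℕ.*-mono-< 0<E 0<E

      0<D : 0 < D
      0<D = ℕ.≤-trans 0<X (ℕ.m≤m+n X E)

      0<a : 0 < a
      0<a = ℕ.*-mono-< (ℕ.*-mono-< 0<Δ 0<Δ) 0<D

      -- This is β ≤ k, by dropping the term Δ / e² from the hypothesis. It covers every step in
      -- which adding or deleting a vertex leaves the set unchanged.
      a≤b : a ≤ b
      a≤b = ℕ.*-cancelʳ-≤ a b (E * E) ⦃ ℕ.>-nonZero 0<EE ⦄ (begin
        a * (E * E)                                ≤⟨ ℕ.m≤m+n _ _ ⟩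
        a * (E * E) + Δ * (D * D) * X              ≤⟨ enough ⟩
        X * (E * E) * k                            ≡⟨ solve 3 (λ x e k → x :* e :* k := x :* k :* e) refl X (E * E) k ⟩
        b * (E * E)                                ∎)
        where
        open ℕ.≤-Reasoning

      0<k : 0 < k
      0<k = ℕ.n≢0⇒n>0 λ { refl → ℕ.<⇒≱ 0<a (ℕ.≤-trans a≤b (ℕ.≤-reflexive (ℕ.*-zeroʳ X))) }

      Growing : ℕ → Set
      Growing m = ∀ S v → length S < m → a * N S ≤ b * N (v ∷ S)

      -- Each deletion uses growth backwards: for `h` in `S`, adding `h` to the strictly shorter
      -- `S - h` restores `S`. For `h` outside `S` nothing is lost, and `a≤b` supplies the factor.
      N-∖ : ∀ {m} → Growing m → ∀ hs S → length S ≤ m → a ^ length hs * N (S ∖ hs) ≤ b ^ length hs * N S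
      N-∖ growing []       S ∣S∣≤ = ℕ.≤-refl
      N-∖ growing (h ∷ hs) S ∣S∣≤ = begin
        a * p * N ((S - h) ∖ hs)             ≡⟨ ℕ.*-assoc a p _ ⟩
        a * (p * N ((S - h) ∖ hs))           ≤⟨ ℕ.*-monoʳ-≤ a (N-∖ growing hs (S - h) (ℕ.≤-trans (List.length-filter _ S) ∣S∣≤)) ⟩
        a * (q * N (S - h))                  ≡⟨ x∙yz≡y∙xz a q _ ⟩
        q * (a * N (S - h))                  ≤⟨ ℕ.*-monoʳ-≤ q (remove (h ∈? S)) ⟩
        q * (b * N S)                        ≡⟨ xy∙z≡y∙xz b q _ ⟨
        b * q * N S                          ∎
        where
        open ℕ.≤-Reasoning
        p = a ^ length hs
        q = b ^ length hs
        remove : Dec (h ∈ S) → a * N (S - h) ≤ b * N S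
        remove (yes h∈S) = ℕ.≤-trans (growing (S - h) h (ℕ.<-≤-trans (length-remove h∈S) ∣S∣≤))
                          (ℕ.*-monoʳ-≤ b (N-antitone {S} {h ∷ (S - h)} (⊆-remove-insert h)))
        remove (no h∉S)  = ℕ.*-mono-≤ {a} {b} {N (S - h)} {N S} a≤b (N-antitone {S} {S - h} λ w∈ → ∈-remove w∈ λ { refl → h∉S w∈ })

      module Step {m : ℕ} (growing : Growing m) (S : List Vertex) (v : Vertex) (v∉S : v ∉ S) (∣S∣≤m : length S ≤ m) where

        Valid : ℕ → List Vertex × List Vertex → Set
        Valid i (xs , ys) = length xs ≡ suc i × length ys ≡ suc i × Legal (v ∷ S) xs ys × v ∈ xs

        valid? : ∀ i e → Dec (Valid i e)
        valid? i (xs , ys) = length xs ℕ.≟ suc i ×-dec length ys ℕ.≟ suc i ×-dec legal? (v ∷ S) xs ys ×-dec v ∈? xs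

        -- Good colourings with this clash are determined by their restriction to S without the
        -- half xs, and at most i elements of S lie in that half.
        clashes-bound-++ : ∀ {i} as bs ys → Valid i (as ++ v ∷ bs , ys) →
                           k * a ^ i * clashes S (as ++ v ∷ bs , ys) ≤ X ^ i * N S
        clashes-bound-++ {i} as bs ys (∣xs∣ , ∣ys∣ , (_ , unique , _) , _) = ℕ.*-cancelˡ-≤ (k ^ i) ⦃ ℕ.m^n≢0 k i ⦃ ℕ.>-nonZero 0<k ⦄ ⦄ (begin
          k ^ i * (k * a ^ i * clashes S (xs , ys))
            ≡⟨ x∙[yz∙w]≡z∙[yx∙w] (k ^ i) k (a ^ i) _ ⟩
          a ^ i * (k ^ suc i * clashes S (xs , ys))
            ≤⟨ ℕ.*-monoʳ-≤ (a ^ i) (ℕ.*-monoʳ-≤ (k ^ suc i) (∑-mono (colourings order) λ {c} _ →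
                 ℕ.*-monoˡ-≤ ⟦ same? xs ys c ⟧ (⟦⟧-mono (good? S c) (good? S′ c) (good-antitone {c = c} (∖-⊆ hs))))) ⟩
          a ^ i * (k ^ suc i * clashes S′ (xs , ys))
            ≡⟨ cong (λ n → a ^ i * (k ^ n * clashes S′ (xs , ys))) ∣xs∣ ⟨
          a ^ i * (k ^ length xs * clashes S′ (xs , ys))
            ≤⟨ ℕ.*-monoʳ-≤ (a ^ i) (agreement row row-injective _ xs ys (trans ∣xs∣ (sym ∣ys∣))
                 (proj₁ (unique-++ xs unique)) (proj₂ (unique-++ xs unique)) (λ h∈ → good-ignores (∉S′ h∈))) ⟩
          a ^ i * N S′
            ≡⟨ cong (λ n → a ^ n * N S′) ∣hs∣ ⟨
          a ^ length hs * N S′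
            ≤⟨ N-∖ growing hs S ∣S∣≤m ⟩
          b ^ length hs * N S
            ≡⟨ cong (λ n → b ^ n * N S) ∣hs∣ ⟩
          b ^ i * N S
            ≡⟨ cong (_* N S) (^-distribʳ-* i X k) ⟩
          X ^ i * k ^ i * N S
            ≡⟨ xy∙z≡y∙xz (X ^ i) (k ^ i) (N S) ⟩
          k ^ i * (X ^ i * N S) ∎)
          where
          open ℕ.≤-Reasoning
          xs = as ++ v ∷ bs
          -- One deletion fewer than there are forced colours: the surplus factor `k` is the one
          -- left in the claim after `k ^ i` is cancelled.
          hs = as ++ bs
          S′ = S ∖ hs
          ∣hs∣ : length hs ≡ i
          ∣hs∣ = ℕ.suc-injective (trans (sym (List.length-++-sucʳ as v bs)) ∣xs∣)
          ∉S′ : ∀ {h} → h ∈ as ++ v ∷ bs → h ∉ S′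
          ∉S′ h∈ with ∈-++⁻ as h∈
          ... | inj₁ h∈as          = ∖-∉ hs (∈-++⁺ˡ h∈as)
          ... | inj₂ (here refl)   = v∉S ∘ ∖-⊆ hs
          ... | inj₂ (there h∈bs)  = ∖-∉ hs (∈-++⁺ʳ as h∈bs)

        clashes-bound : ∀ {i} e → Valid i e → k * a ^ i * clashes S e ≤ X ^ i * N S
        clashes-bound {i} (xs , ys) valid@(_ , _ , _ , v∈xs) =
          let (as , bs , eq) = ∈-∃++ v∈xs
          in subst (λ ws → k * a ^ i * clashes S (ws , ys) ≤ X ^ i * N S) (sym eq)
               (clashes-bound-++ as bs ys (subst (λ ws → Valid i (ws , ys)) eq valid))

        candidates : ℕ → List (List Vertex × List Vertex)
        candidates i = filter (valid? i) (halves v i)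

        W : ℕ → ℕ
        W i = ∑ (candidates i) (clashes S)

        -- Of the Δ^(2i + 1) from the path count, Δ^(2i) cancels against the same power in `a ^ i`.
        -- What remains is a term of the series with ratio X / D.
        W-bound : ∀ i → k * D ^ i * W i ≤ suc i * (Δ * N S) * X ^ i
        W-bound i = ℕ.*-cancelˡ-≤ ΔΔ^i ⦃ ℕ.m^n≢0 (Δ * Δ) i ⦃ ℕ.>-nonZero (ℕ.*-mono-< 0<Δ 0<Δ) ⦄ ⦄ (begin
          ΔΔ^i * (k * D ^ i * W i)                          ≡⟨ x∙[yz∙w]≡y[xz]∙w ΔΔ^i k (D ^ i) (W i) ⟩
          k * (ΔΔ^i * D ^ i) * W i                          ≡⟨ cong (λ n → k * n * W i) (^-distribʳ-* i (Δ * Δ) D) ⟨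
          k * a ^ i * W i                                   ≡⟨ ∑-* (candidates i) (k * a ^ i) (clashes S) ⟨
          ∑ (candidates i) (λ e → k * a ^ i * clashes S e)  ≤⟨ ∑-mono (candidates i) (λ {e} e∈ →
                                                                 clashes-bound e (proj₂ (∈-filter⁻ (valid? i) {xs = halves v i} e∈))) ⟩
          ∑ (candidates i) (λ _ → X ^ i * N S)              ≡⟨ ∑-const (candidates i) _ ⟩
          length (candidates i) * (X ^ i * N S)             ≤⟨ ℕ.*-monoˡ-≤ (X ^ i * N S)
                                                                 (ℕ.≤-trans (List.length-filter (valid? i) (halves v i)) (length-halves v i)) ⟩
          suc i * (Δ * Δ ^ (i + i)) * (X ^ i * N S)         ≡⟨ cong (λ p → suc i * (Δ * p) * (X ^ i * N S))
                                                                 (trans (ℕ.^-distribˡ-+-* Δ i i) (sym (^-distribʳ-* i Δ Δ))) ⟩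
          suc i * (Δ * ΔΔ^i) * (X ^ i * N S)                ≡⟨ count-identity (suc i) Δ ΔΔ^i (X ^ i) (N S) ⟩
          ΔΔ^i * (suc i * (Δ * N S) * X ^ i)                ∎)
          where
          open ℕ.≤-Reasoning
          ΔΔ^i = (Δ * Δ) ^ i

        loss : Colouring → ℕ
        loss c = ∑ (downFrom order) λ i → ∑ (candidates i) λ e → ⟦ good? S c ⟧ * ⟦ same? (proj₁ e) (proj₂ e) c ⟧

        -- No repetition is extracted from the failure of goodness. The split is on whether `loss c`
        -- vanishes: if so, no repetition through `v` exists and goodness extends from `S` to
        -- `v ∷ S`; otherwise the loss is at least 1.
        good-or-clash : ∀ c → ⟦ good? S c ⟧ ≤ ⟦ good? (v ∷ S) c ⟧ + loss c
        good-or-clash c = compare (good? (v ∷ S) c)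
          where
          no-clash : Good S c → loss c ≡ 0 → ∀ {i xs ys} → Valid i (xs , ys) → map (col c) xs ≢ map (col c) ys
          no-clash good loss≡0 {i} {xs} {ys} valid@(∣xs∣ , ∣ys∣ , legal , v∈xs) same = ℕ.<⇒≱ positive (ℕ.≤-reflexive loss≡0)
            where
            positive : 0 < loss c
            positive = begin
              -- Again `0 ℕ.≟ 0` serves as a true proposition, whose indicator is the 1 on the left.
              1                                               ≤⟨ ⟦⟧-× (0 ℕ.≟ 0) (good? S c) (same? xs ys c) (λ (_ : 0 ≡ 0) → good , same) ⟩
              ⟦ good? S c ⟧ * ⟦ same? xs ys c ⟧               ≤⟨ ∑-term _ (∈-filter⁺ (valid? i)
                                                                   (∈-halves v i xs ys (proj₁ legal) ∣xs∣ ∣ys∣ v∈xs) valid) ⟩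
              ∑ (candidates i) _                              ≤⟨ ∑-term _ (∈-downFrom⁺ (half-bounded {ys = ys} ∣xs∣ legal)) ⟩
              loss c                                          ∎
              where open ℕ.≤-Reasoning
          extend : Good S c → loss c ≡ 0 → Good (v ∷ S) c
          extend good loss≡0 i xs ∣xs∣ ys ∣ys∣ legal@(linked , unique , ⊆vS) same with v ∈? (xs ++ ys)
          ... | no v∉ = good i xs ∣xs∣ ys ∣ys∣ (linked , unique , All.tabulate ⊆S) same
            where
            ⊆S : ∀ {w} → w ∈ xs ++ ys → w ∈ S
            ⊆S w∈ with All.lookup ⊆vS w∈
            ... | here refl = contradiction w∈ v∉
            ... | there w∈S = w∈S
          ... | yes v∈ with ∈-++⁻ xs v∈
          ...   | inj₁ v∈xs = no-clash good loss≡0 (∣xs∣ , ∣ys∣ , legal , v∈xs) same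
          ...   | inj₂ v∈ys = no-clash good loss≡0
            (trans (List.length-reverse ys) ∣ys∣ , trans (List.length-reverse xs) ∣xs∣ ,
             good-reverse {xs = xs} legal , Any.reverse⁺ v∈ys)
            (trans (List.reverse-map (col c) ys) (trans (cong reverse (sym same)) (sym (List.reverse-map (col c) xs))))
          compare : (d : Dec (Good (v ∷ S) c)) → ⟦ good? S c ⟧ ≤ ⟦ d ⟧ + loss c
          compare (yes _) = ℕ.≤-trans (⟦⟧≤1 (good? S c)) (s≤s z≤n)
          compare (no ¬good) = some-loss (loss c ℕ.≟ 0)
            where
            some-loss : Dec (loss c ≡ 0) → ⟦ good? S c ⟧ ≤ loss c
            some-loss (no ≢0)  = ℕ.≤-trans (⟦⟧≤1 (good? S c)) (ℕ.n≢0⇒n>0 ≢0)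
            some-loss (yes ≡0) = ℕ.≤-trans (⟦⟧-mono (good? S c) (no ¬good) λ good → extend good ≡0) z≤n

        ∑-loss : ∑ (colourings order) loss ≡ ∑ (downFrom order) W
        ∑-loss = trans (∑-swap (colourings order) (downFrom order) _)
          (∑-cong (downFrom order) λ i → ∑-swap (colourings order) (candidates i) _)

        N-split : N S ≤ N (v ∷ S) + ∑ (downFrom order) W
        N-split = begin
          N S                                                                     ≤⟨ ∑-mono (colourings order) (λ {c} _ → good-or-clash c) ⟩
          ∑ (colourings order) (λ c → ⟦ good? (v ∷ S) c ⟧ + loss c)               ≡⟨ ∑-+ (colourings order) _ _ ⟩
          N (v ∷ S) + ∑ (colourings order) loss                                   ≡⟨ cong (N (v ∷ S) +_) ∑-loss ⟩
          N (v ∷ S) + ∑ (downFrom order) W                                        ∎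
          where open ℕ.≤-Reasoning

        grow : a * N S ≤ b * N (v ∷ S)
        grow = growth-inequality a X (E * E) k Δ (D * D) 0<EE enough N-split
          (weighted-∑-bound k (Δ * N S) W W-bound 0<D order)

      growing : ∀ m → Growing m
      growing (suc m) S v (s≤s ∣S∣≤m) = cases (v ∈? S)
        where
        cases : Dec (v ∈ S) → a * N S ≤ b * N (v ∷ S)
        cases (yes v∈S) = ℕ.*-mono-≤ {a} {b} {N S} {N (v ∷ S)} a≤b (N-antitone {v ∷ S} {S} λ { (here refl) → v∈S ; (there w∈) → w∈ })
        cases (no v∉S)  = Step.grow (growing m) S v v∉S ∣S∣≤m

      N-positive : ∀ S → 0 < N S
      N-positive []      = subst (0 <_) (sym N-[]) (ℕ.m^n>0 k ⦃ ℕ.>-nonZero 0<k ⦄ order)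
      N-positive (v ∷ S) = ℕ.n≢0⇒n>0 λ N≡0 → ℕ.<⇒≱ (ℕ.*-mono-< 0<a (N-positive S))
        (ℕ.≤-trans (growing _ S v ℕ.≤-refl) (ℕ.≤-reflexive (trans (cong (b *_) N≡0) (ℕ.*-zeroʳ b))))

      good-colouring : ∃[ c ] Good (allFin order) c
      good-colouring = let (c , 0<) = ∑-positive (colourings order) (N-positive (allFin order))
                       in c , ⟦⟧-positive (good? (allFin order) c) 0<

  -- From good colourings to the choice number.

  map-toList-cong : {A B : Set} (f : A → B) {n : ℕ} (xs ys : Vec A n) →
                    (∀ i → f (lookup xs i) ≡ f (lookup ys i)) → map f (Vec.toList xs) ≡ map f (Vec.toList ys)
  map-toList-cong f []       []       eq = refl
  map-toList-cong f (x ∷ xs) (y ∷ ys) eq = cong₂ _∷_ (eq zero) (map-toList-cong f xs ys (eq ∘ suc))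

  degree≤maxDegree : ∀ G v → Graph.degree G v ≤ Graph.maxDegree G
  degree≤maxDegree G v = All.lookup (Extrema.xs≤max 0 _) (∈-map⁺ (Graph.degree G) (∈-allFin v))

  sufficient⇒choosable : ∀ G → let Δ = Graph.maxDegree G in 0 < Δ → ∀ X E → 0 < X → 0 < E → ∀ k →
    Δ * Δ * (X + E) * (E * E) + Δ * ((X + E) * (X + E)) * X ≤ X * (E * E) * k → Choosable G k
  sufficient⇒choosable G 0<Δ X E 0<X 0<E k enough L unique len =
    col c , (λ v → ∈-lookup (Fin.inject≤ (lookup c v) (len v))) , nonRepetitive
    where
    open Graph G
    -- Lists may be longer than `k`; only their first `k` colours are used.
    row : Vertex → Fin k → ℕ
    row v i = List.lookup (L v) (Fin.inject≤ i (len v))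
    row-injective : ∀ v → Injective _≡_ _≡_ (row v)
    row-injective v {i} {j} eq = Fin.inject≤-injective _ _ i j (unique-lookup-injective (unique v) eq)
    open Counting G k row row-injective
    open Growth maxDegree (degree≤maxDegree G) 0<Δ X E 0<X 0<E enough
    c = proj₁ good-colouring
    nonRepetitive : NonRepetitive G (col c)
    nonRepetitive (suc i) _ (p , (linked , unique-p) , same) with Vec.splitAt (suc i) p
    ... | xs , ys , refl = proj₂ good-colouring i
      (Vec.toList xs) (Vec.length-toList xs) (Vec.toList ys) (Vec.length-toList ys)
      (subst (Linked _~_) (Vec.toList-++ xs ys) (linked-toList linked) ,
       subst Unique (Vec.toList-++ xs ys) (unique-toList unique-p) ,
       All.universal ∈-allFin _)
      (map-toList-cong (col c) xs ys λ h → subst₂ (λ x y → col c x ≡ col c y)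
        (Vec.lookup-++ˡ xs ys h) (Vec.lookup-++ʳ xs ys h) (same h))

  sufficient⇒πₗ≤ : ∀ G → let Δ = Graph.maxDegree G in 0 < Δ → ∀ X E → 0 < X → 0 < E → ∀ k →
    Δ * Δ * (X + E) * (E * E) + Δ * ((X + E) * (X + E)) * X ≤ X * (E * E) * k → πₗ G ≤ k
  sufficient⇒πₗ≤ G 0<Δ X E 0<X 0<E k enough =
    proj₂ (proj₂ (minimalChoosable G)) k (sufficient⇒choosable G 0<Δ X E 0<X 0<E k enough)

module Analysis where

  open import Data.Integer as ℤ using (ℤ; +_; -[1+_])
  import Data.Integer.Properties as ℤ
  open import Data.Nat as ℕ using (ℕ; zero; suc; z≤n; s≤s)
  import Data.Nat.Properties as ℕ
  open import Data.Product using (∃-syntax; ∃₂; _×_; _,_; proj₁; proj₂)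
  open import Data.Rational as ℚ using (ℚ; mkℚ; 0ℚ; 1ℚ; ½; _+_; _*_; -_; _-_; _<_; _≤_; _⊔_; _/_; toℚᵘ)
  import Data.Rational.Properties as ℚ
  open import Data.Rational.Solver using (module +-*-Solver)
  open import Data.Rational.Unnormalised as ℚᵘ using (mkℚᵘ)
  import Data.Rational.Unnormalised.Properties as ℚᵘ
  open import Data.Sum using (inj₁; inj₂)
  open import Relation.Binary.PropositionalEquality
  open import Relation.Nullary using (¬_; contradiction)
  open import Relation.Nullary.Decidable using (from-yes)
  open +-*-Solver using (solve; _:=_; _:+_; _:*_; _:-_; :-_; con)

  -- Ordered arithmetic of rationals.

  module Rationals where

    *-pos : ∀ {p q} → 0ℚ < p → 0ℚ < q → 0ℚ < p * q
    *-pos {p} {q} 0<p 0<q = ℚ.positive⁻¹ (p * q) ⦃ ℚ.pos*pos⇒pos p ⦃ ℚ.positive 0<p ⦄ q ⦃ ℚ.positive 0<q ⦄ ⦄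

    *-nonNeg : ∀ {p q} → 0ℚ ≤ p → 0ℚ ≤ q → 0ℚ ≤ p * q
    *-nonNeg {p} {q} 0≤p 0≤q = subst (_≤ p * q) (ℚ.*-zeroʳ p) (ℚ.*-monoˡ-≤-nonNeg p ⦃ ℚ.nonNegative 0≤p ⦄ 0≤q)

    +-nonNeg : ∀ {p q} → 0ℚ ≤ p → 0ℚ ≤ q → 0ℚ ≤ p + q
    +-nonNeg = ℚ.+-mono-≤

    *-monoˡ : ∀ {p q} r → 0ℚ ≤ r → p ≤ q → r * p ≤ r * q
    *-monoˡ r 0≤r = ℚ.*-monoˡ-≤-nonNeg r ⦃ ℚ.nonNegative 0≤r ⦄

    *-monoʳ : ∀ {p q} r → 0ℚ ≤ r → p ≤ q → p * r ≤ q * r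
    *-monoʳ r 0≤r = ℚ.*-monoʳ-≤-nonNeg r ⦃ ℚ.nonNegative 0≤r ⦄

    *-mono : ∀ {p q r s} → 0ℚ ≤ p → 0ℚ ≤ s → p ≤ q → r ≤ s → p * r ≤ q * s
    *-mono {p} {s = s} 0≤p 0≤s p≤q r≤s = ℚ.≤-trans (*-monoˡ p 0≤p r≤s) (*-monoʳ s 0≤s p≤q)

    *-mono-<ʳ : ∀ {p q} r → 0ℚ < r → p < q → p * r < q * r
    *-mono-<ʳ r 0<r = ℚ.*-monoˡ-<-pos r ⦃ ℚ.positive 0<r ⦄

    *-cancel-≤ʳ : ∀ {p q} r → 0ℚ < r → p * r ≤ q * r → p ≤ q
    *-cancel-≤ʳ r 0<r = ℚ.*-cancelʳ-≤-pos r ⦃ ℚ.positive 0<r ⦄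

    *-cancel-<ˡ : ∀ {p q} r → 0ℚ ≤ r → r * p < r * q → p < q
    *-cancel-<ˡ r 0≤r = ℚ.*-cancelˡ-<-nonNeg r ⦃ ℚ.nonNegative 0≤r ⦄

    cube-mono : ∀ {p q} → 0ℚ ≤ p → p ≤ q → p * p * p ≤ q * q * q
    cube-mono 0≤p p≤q = *-mono (*-nonNeg 0≤p 0≤p) 0≤q (*-mono 0≤p 0≤q p≤q p≤q) p≤q
      where 0≤q = ℚ.≤-trans 0≤p p≤q

    reciprocal : ∀ p → 0ℚ < p → ∃[ r ] 0ℚ < r × r * p ≡ 1ℚ
    reciprocal p 0<p = (ℚ.1/ p) , ℚ.positive⁻¹ (ℚ.1/ p) ⦃ ℚ.1/pos⇒pos p ⦄ , ℚ.*-inverseˡ p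
      where instance
        _ = ℚ.positive 0<p
        _ = ℚ.pos⇒nonZero p

    0≤q-p : ∀ {p q} → p ≤ q → 0ℚ ≤ q - p
    0≤q-p {p} {q} p≤q = subst (_≤ q - p) (ℚ.+-inverseʳ p) (ℚ.+-monoˡ-≤ (- p) p≤q)

    0<q-p : ∀ {p q} → p < q → 0ℚ < q - p
    0<q-p {p} {q} p<q = subst (_< q - p) (ℚ.+-inverseʳ p) (ℚ.+-monoˡ-< (- p) p<q)

    p≤p+q : ∀ {p q} → 0ℚ ≤ q → p ≤ p + q
    p≤p+q {p} {q} 0≤q = subst (_≤ p + q) (ℚ.+-identityʳ p) (ℚ.+-monoʳ-≤ p 0≤q)

    p-q<r⇒p<r+q : ∀ {p q r} → p - q < r → p < r + q
    p-q<r⇒p<r+q {p} {q} {r} h = subst (_< r + q) (solve 2 (λ p q → p :- q :+ q := p) refl p q) (ℚ.+-monoˡ-< q h)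

    p<r+q⇒p-q<r : ∀ {p q r} → p < r + q → p - q < r
    p<r+q⇒p-q<r {p} {q} {r} h = subst (p - q <_) (solve 2 (λ q r → r :+ q :- q := r) refl q r) (ℚ.+-monoˡ-< (- q) h)

    0<1 : 0ℚ < 1ℚ
    0<1 = from-yes (0ℚ ℚ.<? 1ℚ)

    0≤1 : 0ℚ ≤ 1ℚ
    0≤1 = ℚ.<⇒≤ 0<1

    ⊔-lub-< : ∀ {p q r} → p < r → q < r → p ⊔ q < r
    ⊔-lub-< {p} {q} p<r q<r with ℚ.⊔-sel p q
    ... | inj₁ eq = subst (_< _) (sym eq) p<r
    ... | inj₂ eq = subst (_< _) (sym eq) q<r

    2ℚ 3ℚ 4ℚ 8ℚ 16ℚ 18ℚ 72ℚ 144ℚ : ℚ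
    2ℚ   = + 2 / 1
    3ℚ   = + 3 / 1
    4ℚ   = + 4 / 1
    8ℚ   = + 8 / 1
    16ℚ  = + 16 / 1
    18ℚ  = + 18 / 1
    72ℚ  = + 72 / 1
    144ℚ = + 144 / 1

  open Rationals

  module Embedding where

    ι : ℕ → ℚ
    ι n = + n / 1

    toℚᵘ-/1 : ∀ m → toℚᵘ (m / 1) ℚᵘ.≃ mkℚᵘ m 0
    toℚᵘ-/1 m = ℚ.toℚᵘ-fromℚᵘ (mkℚᵘ m 0)

    ι-+ : ∀ m n → ι (m ℕ.+ n) ≡ ι m + ι n
    ι-+ m n = ℚ.toℚᵘ-injective (begin
      toℚᵘ (ι (m ℕ.+ n))                 ≈⟨ toℚᵘ-/1 (+ (m ℕ.+ n)) ⟩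
      mkℚᵘ (+ (m ℕ.+ n)) 0               ≈⟨ ℚᵘ.*≡* (cong (ℤ._* + 1) (cong₂ ℤ._+_ (sym (ℤ.*-identityʳ (+ m))) (sym (ℤ.*-identityʳ (+ n))))) ⟩
      mkℚᵘ (+ m) 0 ℚᵘ.+ mkℚᵘ (+ n) 0     ≈⟨ ℚᵘ.+-cong (toℚᵘ-/1 (+ m)) (toℚᵘ-/1 (+ n)) ⟨
      toℚᵘ (ι m) ℚᵘ.+ toℚᵘ (ι n)         ≈⟨ ℚ.toℚᵘ-homo-+ (ι m) (ι n) ⟨
      toℚᵘ (ι m + ι n)                   ∎)
      where open ℚᵘ.≃-Reasoning

    ι-* : ∀ m n → ι (m ℕ.* n) ≡ ι m * ι n
    ι-* m n = ℚ.toℚᵘ-injective (begin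
      toℚᵘ (ι (m ℕ.* n))                 ≈⟨ toℚᵘ-/1 (+ (m ℕ.* n)) ⟩
      mkℚᵘ (+ (m ℕ.* n)) 0               ≈⟨ ℚᵘ.*≡* (cong (ℤ._* + 1) (ℤ.pos-* m n)) ⟩
      mkℚᵘ (+ m) 0 ℚᵘ.* mkℚᵘ (+ n) 0     ≈⟨ ℚᵘ.*-cong (toℚᵘ-/1 (+ m)) (toℚᵘ-/1 (+ n)) ⟨
      toℚᵘ (ι m) ℚᵘ.* toℚᵘ (ι n)         ≈⟨ ℚ.toℚᵘ-homo-* (ι m) (ι n) ⟨
      toℚᵘ (ι m * ι n)                   ∎)
      where open ℚᵘ.≃-Reasoning

    /1-cancel-≤ : ∀ {m n} → m / 1 ≤ n / 1 → m ℤ.≤ n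
    /1-cancel-≤ {m} {n} h with ℚᵘ.≤-respˡ-≃ (toℚᵘ-/1 m) (ℚᵘ.≤-respʳ-≃ (toℚᵘ-/1 n) (ℚ.toℚᵘ-mono-≤ h))
    ... | ℚᵘ.*≤* le = subst₂ ℤ._≤_ (ℤ.*-identityʳ m) (ℤ.*-identityʳ n) le

    ι-cancel-≤ : ∀ {m n} → ι m ≤ ι n → m ℕ.≤ n
    ι-cancel-≤ h = ℤ.drop‿+≤+ (/1-cancel-≤ h)

    ι-mono-≤ : ∀ {m n} → m ℕ.≤ n → ι m ≤ ι n
    ι-mono-≤ {m} {n} m≤n = ℚ.toℚᵘ-cancel-≤ (ℚᵘ.≤-respˡ-≃ (ℚᵘ.≃-sym (toℚᵘ-/1 (+ m)))
      (ℚᵘ.≤-respʳ-≃ (ℚᵘ.≃-sym (toℚᵘ-/1 (+ n)))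
        (ℚᵘ.*≤* (subst₂ ℤ._≤_ (sym (ℤ.*-identityʳ (+ m))) (sym (ℤ.*-identityʳ (+ n))) (ℤ.+≤+ m≤n)))))

    fraction : ∀ e → 0ℚ < e → ∃₂ λ E D → 0 ℕ.< D × e * ι D ≡ ι E
    fraction (mkℚ -[1+ _ ] _ _)    0<e = contradiction (ℚ.positive 0<e) λ ()
    fraction e@(mkℚ (+ m) d _) 0<e = m , suc d , s≤s z≤n , ℚ.toℚᵘ-injective (begin
      toℚᵘ (e * ι (suc d))                       ≈⟨ ℚ.toℚᵘ-homo-* e (ι (suc d)) ⟩
      mkℚᵘ (+ m) d ℚᵘ.* toℚᵘ (ι (suc d))         ≈⟨ ℚᵘ.*-congˡ {mkℚᵘ (+ m) d} (toℚᵘ-/1 (+ suc d)) ⟩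
      mkℚᵘ (+ m) d ℚᵘ.* mkℚᵘ (+ suc d) 0         ≈⟨ ℚᵘ.*≡* (trans (ℤ.*-identityʳ (+ m ℤ.* + suc d))
                                                     (cong (+ m ℤ.*_) (cong +_ (sym (ℕ.*-identityʳ (suc d)))))) ⟩
      mkℚᵘ (+ m) 0                               ≈⟨ toℚᵘ-/1 (+ m) ⟨
      toℚᵘ (ι m)                                 ∎)
      where open ℚᵘ.≃-Reasoning

  open Embedding

  -- Rational bounds for real expressions.

  module Cuts where

    open ℝ

    -- Membership in a cut is strict, while these express q ≤ x and x ≤ q. They are preserved by the
    -- arithmetic operations without any loss in the rational value.
    LowerBound UpperBound : ℝ → ℚ → Set
    LowerBound x q = ∀ p → p < q → Lower x p
    UpperBound x q = ∀ p → q < p → Upper x p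

    lower-fromℕ : ∀ n → LowerBound (fromℕ n) (ι n)
    lower-fromℕ n p p< = ι n , p< , ℚ.≤-refl

    lower-∛ : ∀ n {q} → q * q * q ≤ ι n → LowerBound (∛ n) q
    lower-∛ n {q} q³≤n p p<q = q , p<q , q³≤n

    upper-∛ : ∀ n {q} → ι n ≤ q * q * q → UpperBound (∛ n) q
    upper-∛ n {q} n≤q³ p q<p = q , q<p , n≤q³

    lower-+ : ∀ x y {a c} → LowerBound x a → LowerBound y c → LowerBound (x +ᵣ y) (a + c)
    lower-+ x y {a} {c} la lc p p<a+c =
      let (a′ , p-c<a′ , a′<a) = ℚ.<-dense (p<r+q⇒p-q<r p<a+c)
          (c′ , p-a′<c′ , c′<c) = ℚ.<-dense (p<r+q⇒p-q<r (subst (p <_) (ℚ.+-comm a′ c) (p-q<r⇒p<r+q p-c<a′)))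
      in a′ + c′ , subst (p <_) (ℚ.+-comm c′ a′) (p-q<r⇒p<r+q p-a′<c′) , a′ , c′ , la a′ a′<a , lc c′ c′<c , refl

    upper-+ : ∀ x y {b d} → UpperBound x b → UpperBound y d → UpperBound (x +ᵣ y) (b + d)
    upper-+ x y {b} {d} ub ud q b+d<q =
      let (b′ , b<b′ , b′<q-d) = ℚ.<-dense (b<q-d b+d<q)
          (d′ , d<d′ , d′<q-b′) = ℚ.<-dense (b<q-d (subst (_< q) (ℚ.+-comm b′ d) (p<q-d⇒p+d<q b′<q-d)))
      in b′ + d′ , subst (_< q) (ℚ.+-comm d′ b′) (p<q-d⇒p+d<q d′<q-b′) , b′ , d′ , ub b′ b<b′ , ud d′ d<d′ , refl
      where
      b<q-d : ∀ {b d q} → b + d < q → b < q - d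
      b<q-d {b} {d} h = subst (_< _) (solve 2 (λ b d → b :+ d :- d := b) refl b d) (ℚ.+-monoˡ-< (- d) h)
      p<q-d⇒p+d<q : ∀ {p d q} → p < q - d → p + d < q
      p<q-d⇒p+d<q {p} {d} {q} h = subst (p + d <_) (solve 2 (λ q d → q :- d :+ d := q) refl q d) (ℚ.+-monoˡ-< d h)

    upper-neg : ∀ x {a} → LowerBound x a → UpperBound (-ᵣ x) (- a)
    upper-neg x {a} la q -a<q =
      let (r , -a<r , r<q) = ℚ.<-dense -a<q
      in r , r<q , la (- r) (subst (- r <_) (solve 1 (λ a → :- (:- a) := a) refl a) (ℚ.neg-antimono-< -a<r))

    -- With `p₀` the positive part of `p`, the factors are lowered in turn: p₀ / c < a′ < a, then p₀
    -- / a′ < c′ < c. On a rectangle with positive lower left corner the least product is at that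
    -- corner.
    lower-* : ∀ x y {a c} → 0ℚ < a → 0ℚ < c → LowerBound x a → LowerBound y c → LowerBound (x *ᵣ y) (a * c)
    lower-* x y {a} {c} 0<a 0<c la lc p p<ac =
      let (rc , 0<rc , rc*c≡1) = reciprocal c 0<c
          (a′ , p₀rc<a′ , a′<a) = ℚ.<-dense (p₀rc<a rc 0<rc rc*c≡1)
          0<a′ = ℚ.≤-<-trans (*-nonNeg 0≤p₀ (ℚ.<⇒≤ 0<rc)) p₀rc<a′
          (ra , 0<ra , ra*a′≡1) = reciprocal a′ 0<a′
          p₀<a′c = subst (_< a′ * c) (trans (ℚ.*-assoc p₀ rc c) (trans (cong (p₀ *_) rc*c≡1) (ℚ.*-identityʳ p₀)))
                     (*-mono-<ʳ c 0<c p₀rc<a′)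
          (c′ , p₀ra<c′ , c′<c) = ℚ.<-dense (subst (p₀ * ra <_) (cancel a′ c ra ra*a′≡1) (*-mono-<ʳ ra 0<ra p₀<a′c))
          0<c′ = ℚ.≤-<-trans (*-nonNeg 0≤p₀ (ℚ.<⇒≤ 0<ra)) p₀ra<c′
          p₀<a′c′ = subst₂ _<_ (trans (ℚ.*-assoc p₀ ra a′) (trans (cong (p₀ *_) ra*a′≡1) (ℚ.*-identityʳ p₀))) (ℚ.*-comm c′ a′)
                      (*-mono-<ʳ a′ 0<a′ p₀ra<c′)
          -- The upper sides of the rectangle only have to exist, so any precision will do.
          (_ , b , _ , x<b , _) = located x 1ℚ 0<1
          (_ , d , _ , y<d , _) = located y 1ℚ 0<1
      in a′ * c′ , ℚ.≤-<-trans (ℚ.p≤p⊔q p 0ℚ) p₀<a′c′ ,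
         record { a = a′ ; b = b ; c = c′ ; d = d ; a<x = la a′ a′<a ; x<b = x<b ; c<y = lc c′ c′<c ; y<d = y<d } ,
         λ { s t ((a′≤s , _) , (c′≤t , _)) → *-mono (ℚ.<⇒≤ 0<a′) (ℚ.≤-trans (ℚ.<⇒≤ 0<c′) c′≤t) a′≤s c′≤t }
      where
      p₀ : ℚ
      p₀ = p ⊔ 0ℚ
      0≤p₀ : 0ℚ ≤ p₀
      0≤p₀ = ℚ.p≤q⊔p p 0ℚ
      cancel : ∀ a c r → r * a ≡ 1ℚ → a * c * r ≡ c
      cancel a c r ra≡1 = trans (solve 3 (λ a c r → a :* c :* r := r :* a :* c) refl a c r)
        (trans (cong (_* c) ra≡1) (ℚ.*-identityˡ c))
      p₀rc<a : ∀ rc → 0ℚ < rc → rc * c ≡ 1ℚ → p₀ * rc < a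
      p₀rc<a rc 0<rc rc*c≡1 = subst (p₀ * rc <_) (trans (cong (_* rc) (ℚ.*-comm a c)) (cancel c a rc rc*c≡1))
        (*-mono-<ʳ rc 0<rc (⊔-lub-< p<ac (*-pos 0<a 0<c)))

    -- Lowering `r` to `r′` makes 1 / r′ strictly exceed `u`, as membership in the upper cut
    -- demands.
    lower-inverse : ∀ x 0<x {r u} → 0ℚ < r → r * u ≡ 1ℚ → UpperBound x u → LowerBound (inverse x 0<x) r
    lower-inverse x 0<x {r} {u} 0<r ru≡1 uu p p<r =
      let (r′ , p₀<r′ , r′<r) = ℚ.<-dense (⊔-lub-< p<r 0<r)
          0<r′ = ℚ.≤-<-trans (ℚ.p≤q⊔p p 0ℚ) p₀<r′
          (u′ , 0<u′ , u′r′≡1) = reciprocal r′ 0<r′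
          r′u′≡1 = trans (ℚ.*-comm r′ u′) u′r′≡1
      in r′ , ℚ.≤-<-trans (ℚ.p≤p⊔q p 0ℚ) p₀<r′ , u′ ,
         uu u′ (*-cancel-<ˡ r′ (ℚ.<⇒≤ 0<r′) (subst (r′ * u <_) (trans ru≡1 (sym r′u′≡1)) (*-mono-<ʳ u 0<u r′<r))) ,
         ℚ.≤-reflexive r′u′≡1
      where
      0<u : 0ℚ < u
      0<u = *-cancel-<ˡ r (ℚ.<⇒≤ 0<r) (subst₂ _<_ (sym (ℚ.*-zeroʳ r)) (sym ru≡1) 0<1)

    lower-÷ : ∀ x y 0<y {a r u} → 0ℚ < a → 0ℚ < r → r * u ≡ 1ℚ → LowerBound x a → UpperBound y u →
              LowerBound (x ÷ᵣ y ⟨ 0<y ⟩) (a * r)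
    lower-÷ x y 0<y 0<a 0<r ru≡1 la uu = lower-* x (inverse y 0<y) 0<a 0<r la (lower-inverse y 0<y 0<r ru≡1 uu)

    upper-- : ∀ x y {b c} → UpperBound x b → LowerBound y c → UpperBound (x -ᵣ y) (b - c)
    upper-- x y ub lc = upper-+ x (-ᵣ y) ub (upper-neg y lc)

    -- The shape of the bound, over arbitrary reals: checking it for concrete cube roots makes Agda
    -- unfold the cuts.
    lower-expression : ∀ x₀ x₁ x₂ x₃ x₄ x₅ 0<x₂ 0<x₄₅ {a₀ a₁ a₂ a₃ u₂ r₂ u₄ a₅ r₄₅} →
      0ℚ < a₁ → 0ℚ < a₂ → 0ℚ < a₃ → 0ℚ < r₂ → 0ℚ < r₄₅ → r₂ * u₂ ≡ 1ℚ → r₄₅ * (u₄ - a₅) ≡ 1ℚ →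
      LowerBound x₀ a₀ → LowerBound x₁ a₁ → LowerBound x₂ a₂ → UpperBound x₂ u₂ → LowerBound x₃ a₃ →
      UpperBound x₄ u₄ → LowerBound x₅ a₅ →
      LowerBound (x₀ +ᵣ (x₁ ÷ᵣ x₂ ⟨ 0<x₂ ⟩) *ᵣ x₃ +ᵣ (x₂ *ᵣ x₃) ÷ᵣ (x₄ -ᵣ x₅) ⟨ 0<x₄₅ ⟩)
                 (a₀ + (a₁ * r₂) * a₃ + (a₂ * a₃) * r₄₅)
    lower-expression x₀ x₁ x₂ x₃ x₄ x₅ 0<x₂ 0<x₄₅ 0<a₁ 0<a₂ 0<a₃ 0<r₂ 0<r₄₅ inv₂ inv₄₅ l₀ l₁ l₂ u₂ l₃ u₄ l₅ =
      lower-+ (x₀ +ᵣ (x₁ ÷ᵣ x₂ ⟨ 0<x₂ ⟩) *ᵣ x₃) ((x₂ *ᵣ x₃) ÷ᵣ (x₄ -ᵣ x₅) ⟨ 0<x₄₅ ⟩)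
        (lower-+ x₀ ((x₁ ÷ᵣ x₂ ⟨ 0<x₂ ⟩) *ᵣ x₃) l₀
          (lower-* (x₁ ÷ᵣ x₂ ⟨ 0<x₂ ⟩) x₃ (*-pos 0<a₁ 0<r₂) 0<a₃ (lower-÷ x₁ x₂ 0<x₂ 0<a₁ 0<r₂ inv₂ l₁ u₂) l₃))
        (lower-÷ (x₂ *ᵣ x₃) (x₄ -ᵣ x₅) 0<x₄₅ (*-pos 0<a₂ 0<a₃) 0<r₄₅ inv₄₅
          (lower-* x₂ x₃ 0<a₂ 0<a₃ l₂ l₃) (upper-- x₄ x₅ u₄ l₅))

    lower≤ᵣ : ∀ x {q} m → LowerBound x q → x ≤ᵣ fromℤ m → q ≤ m / 1
    lower≤ᵣ x {q} m lq x≤m = ℚ.≮⇒≥ above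
      where
      above : ¬ m / 1 < q
      above m<q with x≤m (m / 1) (lq (m / 1) m<q)
      ... | r , m<r , r≤m = ℚ.<-irrefl refl (ℚ.<-≤-trans m<r r≤m)

    1≤cube⇒1≤ : ∀ {r} → 1ℚ ≤ r * r * r → 1ℚ ≤ r
    1≤cube⇒1≤ {r} 1≤r³ = ℚ.≮⇒≥ λ r<1 → ℚ.<-irrefl refl (ℚ.≤-<-trans 1≤r³ (cube<1 r<1 (ℚ.≤-total 0ℚ r)))
      where
      cube<1 : r < 1ℚ → _ → r * r * r < 1ℚ
      cube<1 r<1 (inj₁ 0≤r) = ℚ.≤-<-trans (subst (r * r * r ≤_) (ℚ.*-identityˡ r)
        (*-monoʳ r 0≤r (ℚ.≤-trans (subst (r * r ≤_) (ℚ.*-identityʳ r) (*-monoˡ r 0≤r (ℚ.<⇒≤ r<1))) (ℚ.<⇒≤ r<1)))) r<1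
      cube<1 r<1 (inj₂ r≤0) = ℚ.≤-<-trans (subst (r * r * r ≤_) (ℚ.*-zeroʳ (r * r))
        (*-monoˡ (r * r) (subst (0ℚ ≤_) (solve 1 (λ r → :- r :* :- r := r :* r) refl r)
          (*-nonNeg (ℚ.neg-antimono-≤ r≤0) (ℚ.neg-antimono-≤ r≤0))) r≤0)) 0<1

    -- Bernoulli's inequality, used as (1 - η / r)³ ≥ 1 - 3 η for r ≥ 1.
    cube-shrink : ∀ r η → 1ℚ ≤ r → 0ℚ ≤ η → η ≤ 1ℚ → r * r * r * (1ℚ - 3ℚ * η) ≤ (r - η) * (r - η) * (r - η)
    cube-shrink r η 1≤r 0≤η η≤1 = subst (r * r * r * (1ℚ - 3ℚ * η) ≤_)
      (solve 2 (λ r η → r :* r :* r :* (con 1ℚ :- con 3ℚ :* η) :+ (con 3ℚ :* η :* (r :* r) :* (r :- con 1ℚ) :+ η :* η :* (r :+ r :+ (r :- η)))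
                      := (r :- η) :* (r :- η) :* (r :- η)) refl r η)
      (p≤p+q (+-nonNeg
        (*-nonNeg (*-nonNeg (*-nonNeg (from-yes (0ℚ ℚ.≤? 3ℚ)) 0≤η) (*-nonNeg 0≤r 0≤r)) (0≤q-p 1≤r))
        (*-nonNeg (*-nonNeg 0≤η 0≤η) (+-nonNeg (+-nonNeg 0≤r 0≤r) (0≤q-p (ℚ.≤-trans η≤1 1≤r))))))
      where
      0≤r : 0ℚ ≤ r
      0≤r = ℚ.≤-trans 0≤1 1≤r

    -- The error is stated relatively and on the cube, because only ratios such as n / r³ enter
    -- later. An interval of width `η` around the root suffices, since r ≥ 1.
    ∛-approximation : ∀ n η → 1 ℕ.≤ n → 0ℚ < η → η ≤ 1ℚ →
      ∃[ r ] 1ℚ ≤ r × ι n ≤ r * r * r × r * r * r * (1ℚ - 3ℚ * η) ≤ ι n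
    ∛-approximation n η 1≤n 0<η η≤1 =
      let (p , q , lp , uq , q<p+η) = located (∛ n) η 0<η in approximation p q lp uq q<p+η
      where
      approximation : ∀ p q → Lower (∛ n) p → Upper (∛ n) q → q < p + η →
        ∃[ r ] 1ℚ ≤ r × ι n ≤ r * r * r × r * r * r * (1ℚ - 3ℚ * η) ≤ ι n
      approximation p q (s , p<s , s³≤n) (r , r<q , n≤r³) q<p+η =
        r , 1≤r , n≤r³ , ℚ.≤-trans (cube-shrink r η 1≤r (ℚ.<⇒≤ 0<η) η≤1)
          (ℚ.≤-trans (cube-mono (0≤q-p (ℚ.≤-trans η≤1 1≤r)) r-η≤s) s³≤n)
        where
        1≤r : 1ℚ ≤ r
        1≤r = 1≤cube⇒1≤ (ℚ.≤-trans (ι-mono-≤ 1≤n) n≤r³)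
        r-η≤s : r - η ≤ s
        r-η≤s = ℚ.<⇒≤ (p<r+q⇒p-q<r (ℚ.<-trans r<q (ℚ.<-trans q<p+η (ℚ.+-monoˡ-< η p<s))))

  open Cuts

  0≤2 : 0ℚ ≤ 2ℚ
  0≤2 = from-yes (0ℚ ℚ.≤? 2ℚ)

  -- The growth condition at the shifted parameter.

  module _ (P K x : ℚ) (0<P : 0ℚ < P) (0<x : 0ℚ < x) (x<1 : x < 1ℚ) where

    private
      u y s c : ℚ
      u = 1ℚ - x
      y = u * (1ℚ + x)
      s = 1ℚ + x * x
      c = P * (u * u * u)

      0≤x : 0ℚ ≤ x
      0≤x = ℚ.<⇒≤ 0<x
      0≤P : 0ℚ ≤ P
      0≤P = ℚ.<⇒≤ 0<P
      0≤u : 0ℚ ≤ u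
      0≤u = 0≤q-p (ℚ.<⇒≤ x<1)
      0≤y : 0ℚ ≤ y
      0≤y = *-nonNeg 0≤u (+-nonNeg 0≤1 0≤x)
      0≤s : 0ℚ ≤ s
      0≤s = +-nonNeg 0≤1 (*-nonNeg 0≤x 0≤x)
      0≤c : 0ℚ ≤ c
      0≤c = *-nonNeg 0≤P (*-nonNeg (*-nonNeg 0≤u 0≤u) 0≤u)

    -- The inequality Δ² / (1 - e) + Δ / e² ≤ K at e = (1 - x²) / 2, cleared of denominators.
    -- It rests on (1 + x)² (2 - x + x³) = 4 x (1 + x²) + (1 - x)² (2 + 3 x + 4 x² + x³).
    growth-factor : P * P * (2ℚ + x - x * x) ≤ 2ℚ * (K * x) →
      2ℚ * (4ℚ * (x * s)) ≤ c * (4ℚ * (x * s)) + 2ℚ * (c * (u * u)) →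
      P * P * ((½ * y) * (½ * y)) + P * (½ * s) ≤ K * ((½ * y) * (½ * y) * (½ * s))
    growth-factor H₁ H₂ = *-cancel-≤ʳ (16ℚ * x) (*-pos (from-yes (0ℚ ℚ.<? 16ℚ)) 0<x) (begin
      (P * P * ((½ * y) * (½ * y)) + P * (½ * s)) * (16ℚ * x)
        ≡⟨ solve 4 (λ P y s x → (P :* P :* ((con ½ :* y) :* (con ½ :* y)) :+ P :* (con ½ :* s)) :* (con 16ℚ :* x)
                  := P :* (P :* (con 4ℚ :* (x :* (y :* y)))) :+ P :* (con 2ℚ :* (con 4ℚ :* (x :* s)))) refl P y s x ⟩
      P * (P * (4ℚ * (x * (y * y)))) + P * (2ℚ * (4ℚ * (x * s)))
        -- `H₂` replaces the exact relation c = 2. Of the surplus `u * u` times (2 + 3 x + 4 x² +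
        -- x³), the summand 2 pays for rounding and `rest` is discarded.
        ≤⟨ ℚ.+-monoʳ-≤ (P * (P * (4ℚ * (x * (y * y))))) (*-monoˡ P 0≤P (ℚ.≤-trans H₂ (p≤p+q 0≤rest))) ⟩
      P * (P * (4ℚ * (x * (y * y)))) + P * (c * (4ℚ * (x * s)) + 2ℚ * (c * (u * u)) + c * ((u * u) * rest))
        ≡⟨ identity P x ⟩
      P * P * (2ℚ + x - x * x) * (y * y * s)
        ≤⟨ *-monoʳ (y * y * s) (*-nonNeg (*-nonNeg 0≤y 0≤y) 0≤s) H₁ ⟩
      2ℚ * (K * x) * (y * y * s)
        ≡⟨ solve 4 (λ K y s x → con 2ℚ :* (K :* x) :* (y :* y :* s)
                  := K :* ((con ½ :* y) :* (con ½ :* y) :* (con ½ :* s)) :* (con 16ℚ :* x)) refl K y s x ⟩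
      K * ((½ * y) * (½ * y) * (½ * s)) * (16ℚ * x) ∎)
      where
      open ℚ.≤-Reasoning
      rest : ℚ
      rest = 3ℚ * x + 4ℚ * (x * x) + x * x * x
      0≤rest : 0ℚ ≤ c * ((u * u) * rest)
      0≤rest = *-nonNeg 0≤c (*-nonNeg (*-nonNeg 0≤u 0≤u) (+-nonNeg (+-nonNeg
        (*-nonNeg (from-yes (0ℚ ℚ.≤? 3ℚ)) 0≤x)
        (*-nonNeg (from-yes (0ℚ ℚ.≤? 4ℚ)) (*-nonNeg 0≤x 0≤x)))
        (*-nonNeg (*-nonNeg 0≤x 0≤x) 0≤x)))
      identity : ∀ P x → let u = 1ℚ - x ; y = u * (1ℚ + x) ; s = 1ℚ + x * x ; c = P * (u * u * u) in
        P * (P * (4ℚ * (x * (y * y)))) + P * (c * (4ℚ * (x * s)) + 2ℚ * (c * (u * u)) + c * ((u * u) * (3ℚ * x + 4ℚ * (x * x) + x * x * x)))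
        ≡ P * P * (2ℚ + x - x * x) * (y * y * s)
      identity = solve 2 (λ P x → let u = con 1ℚ :- x ; y = u :* (con 1ℚ :+ x) ; s = con 1ℚ :+ x :* x ; c = P :* (u :* u :* u) in
        P :* (P :* (con 4ℚ :* (x :* (y :* y)))) :+ P :* (c :* (con 4ℚ :* (x :* s)) :+ con 2ℚ :* (c :* (u :* u)) :+ c :* ((u :* u) :* (con 3ℚ :* x :+ con 4ℚ :* (x :* x) :+ x :* x :* x)))
        := P :* P :* (con 2ℚ :+ x :- x :* x) :* (y :* y :* s)) refl

  -- Rounding the cube roots of 2 and Δ.

  module _ {n r R : ℚ} (0≤n : 0ℚ ≤ n) (0<R : 0ℚ < R) (Rr≡1 : R * r ≡ 1ℚ) where

    private
      R³ : ℚ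
      R³ = R * R * R
      0≤R³ : 0ℚ ≤ R³
      0≤R³ = ℚ.<⇒≤ (*-pos (*-pos 0<R 0<R) 0<R)
      r³R³≡1 : r * r * r * R³ ≡ 1ℚ
      r³R³≡1 = trans (solve 2 (λ r R → r :* r :* r :* (R :* R :* R) := (R :* r) :* (R :* r) :* (R :* r)) refl r R)
        (cong (λ z → z * z * z) Rr≡1)

    reciprocal-cube-≤ : n ≤ r * r * r → n * R³ ≤ 1ℚ
    reciprocal-cube-≤ n≤r³ = subst (n * R³ ≤_) r³R³≡1 (*-monoʳ R³ 0≤R³ n≤r³)

    reciprocal-cube-≥ : ∀ {w} → r * r * r * w ≤ n → w ≤ n * R³
    reciprocal-cube-≥ {w} r³w≤n = subst (_≤ n * R³)
      (trans (solve 3 (λ c w R → c :* w :* R := c :* R :* w) refl (r * r * r) w R³)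
        (trans (cong (_* w) r³R³≡1) (ℚ.*-identityˡ w)))
      (*-monoʳ R³ 0≤R³ r³w≤n)

  tolerance-bound : ∀ {P η} → 3ℚ ≤ P → 0ℚ < η → η * (72ℚ * (P * P)) ≡ 1ℚ → 18ℚ * η ≤ 1ℚ
  tolerance-bound {P} {η} 3≤P 0<η 72ηPP≡1 = begin
    18ℚ * η                  ≤⟨ *-monoʳ η 0≤η (from-yes (18ℚ ℚ.≤? 72ℚ * (3ℚ * 3ℚ))) ⟩
    72ℚ * (3ℚ * 3ℚ) * η      ≤⟨ *-monoʳ η 0≤η (*-monoˡ 72ℚ (from-yes (0ℚ ℚ.≤? 72ℚ)) (*-mono (from-yes (0ℚ ℚ.≤? 3ℚ)) 0≤P 3≤P 3≤P)) ⟩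
    72ℚ * (P * P) * η        ≡⟨ trans (ℚ.*-comm (72ℚ * (P * P)) η) 72ηPP≡1 ⟩
    1ℚ                       ∎
    where
    open ℚ.≤-Reasoning
    0≤η : 0ℚ ≤ η
    0≤η = ℚ.<⇒≤ 0<η
    0≤P : 0ℚ ≤ P
    0≤P = ℚ.≤-trans (from-yes (0ℚ ℚ.≤? 3ℚ)) 3≤P

  -- a and d approximate the cube roots of 2 and Δ from above, A and Z are their reciprocals, and
  -- u = 2 / (a² d) approximates (2 / Δ)^⅓ from below.
  module Approximation (P a A d Z η : ℚ) (3≤P : 3ℚ ≤ P)
    (0<A : 0ℚ < A) (Aa≡1 : A * a ≡ 1ℚ) (2≤a³ : 2ℚ ≤ a * a * a) (a³≤ : a * a * a * (1ℚ - 3ℚ * η) ≤ 2ℚ)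
    (0<Z : 0ℚ < Z) (Zd≡1 : Z * d ≡ 1ℚ) (P≤d³ : P ≤ d * d * d) (d³≤ : d * d * d * (1ℚ - 3ℚ * η) ≤ P)
    (0<η : 0ℚ < η) (72ηPP≡1 : η * (72ℚ * (P * P)) ≡ 1ℚ) where

    -- `B` and `C` are 2 / a³ and P / d³, the rounding errors of the two roots, both in [w , 1]. The
    -- lower approximation `t` of the cube root of 2 is 2 / a², derived from `a` itself so that the
    -- later relations are polynomial identities.
    w B C t u x s c : ℚ
    w = 1ℚ - 3ℚ * η
    B = 2ℚ * (A * A * A)
    C = P * (Z * Z * Z)
    t = 2ℚ * (A * A)
    u = t * Z
    x = 1ℚ - u
    s = 1ℚ + x * x
    c = P * (u * u * u)

    0≤η : 0ℚ ≤ η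
    0≤η = ℚ.<⇒≤ 0<η

    0<P : 0ℚ < P
    0<P = ℚ.<-≤-trans (from-yes (0ℚ ℚ.<? 3ℚ)) 3≤P

    0≤P : 0ℚ ≤ P
    0≤P = ℚ.<⇒≤ 0<P

    18η≤1 : 18ℚ * η ≤ 1ℚ
    18η≤1 = tolerance-bound 3≤P 0<η 72ηPP≡1

    3η≤1 : 3ℚ * η ≤ 1ℚ
    3η≤1 = ℚ.≤-trans (*-monoʳ η 0≤η (from-yes (3ℚ ℚ.≤? 18ℚ))) 18η≤1

    0≤w : 0ℚ ≤ w
    0≤w = 0≤q-p 3η≤1

    B≤1 : B ≤ 1ℚ
    B≤1 = reciprocal-cube-≤ 0≤2 0<A Aa≡1 2≤a³

    w≤B : w ≤ B
    w≤B = reciprocal-cube-≥ 0≤2 0<A Aa≡1 a³≤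

    C≤1 : C ≤ 1ℚ
    C≤1 = reciprocal-cube-≤ 0≤P 0<Z Zd≡1 P≤d³

    w≤C : w ≤ C
    w≤C = reciprocal-cube-≥ 0≤P 0<Z Zd≡1 d³≤

    0≤B : 0ℚ ≤ B
    0≤B = ℚ.≤-trans 0≤w w≤B

    0≤C : 0ℚ ≤ C
    0≤C = ℚ.≤-trans 0≤w w≤C

    0<t : 0ℚ < t
    0<t = *-pos (from-yes (0ℚ ℚ.<? 2ℚ)) (*-pos 0<A 0<A)

    0<u : 0ℚ < u
    0<u = *-pos 0<t 0<Z

    0≤u : 0ℚ ≤ u
    0≤u = ℚ.<⇒≤ 0<u

    t³≡ : t * t * t ≡ 2ℚ * (B * B)
    t³≡ = solve 1 (λ A → let t = con 2ℚ :* (A :* A) ; B = con 2ℚ :* (A :* A :* A) in t :* t :* t := con 2ℚ :* (B :* B)) refl A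

    t³≤2 : t * t * t ≤ 2ℚ
    t³≤2 = subst (_≤ 2ℚ) (sym t³≡) (*-monoˡ {q = 1ℚ} 2ℚ 0≤2 (*-mono {q = 1ℚ} {s = 1ℚ} 0≤B 0≤1 B≤1 B≤1))

    c≡ : c ≡ 2ℚ * (B * B * C)
    c≡ = solve 3 (λ P A Z → let t = con 2ℚ :* (A :* A) ; B = con 2ℚ :* (A :* A :* A) ; C = P :* (Z :* Z :* Z) ; u = t :* Z in
      P :* (u :* u :* u) := con 2ℚ :* (B :* B :* C)) refl P A Z

    c≤2 : c ≤ 2ℚ
    c≤2 = subst (_≤ 2ℚ) (sym c≡) (*-monoˡ {q = 1ℚ} 2ℚ 0≤2
      (*-mono {q = 1ℚ} {s = 1ℚ} (*-nonNeg 0≤B 0≤B) 0≤1 (*-mono {q = 1ℚ} {s = 1ℚ} 0≤B 0≤1 B≤1 B≤1) C≤1))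

    -- Three errors of at most 3η each enter `c`, which would be 2 for exact roots; Bernoulli gives
    -- 2 (1 - 3η)³ ≥ 2 (1 - 9η).
    2-18η≤c : 2ℚ - 18ℚ * η ≤ c
    2-18η≤c = begin
      2ℚ - 18ℚ * η                                  ≡⟨ solve 1 (λ η → con 2ℚ :- con 18ℚ :* η
                                                         := con 2ℚ :* (con 1ℚ :* con 1ℚ :* con 1ℚ :* (con 1ℚ :- con 3ℚ :* (con 3ℚ :* η)))) refl η ⟩
      2ℚ * (1ℚ * 1ℚ * 1ℚ * (1ℚ - 3ℚ * (3ℚ * η)))    ≤⟨ *-monoˡ 2ℚ 0≤2 (cube-shrink 1ℚ (3ℚ * η) ℚ.≤-refl
                                                         (*-nonNeg (from-yes (0ℚ ℚ.≤? 3ℚ)) 0≤η) 3η≤1) ⟩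
      2ℚ * (w * w * w)                              ≤⟨ *-monoˡ 2ℚ 0≤2 (*-mono (*-nonNeg 0≤w 0≤w) 0≤C (*-mono 0≤w 0≤B w≤B w≤B) w≤C) ⟩
      2ℚ * (B * B * C)                              ≡⟨ c≡ ⟨
      c                                             ∎
      where open ℚ.≤-Reasoning

    1≤c : 1ℚ ≤ c
    1≤c = ℚ.≤-trans (ℚ.+-monoʳ-≤ 2ℚ (ℚ.neg-antimono-≤ 18η≤1)) 2-18η≤c

    -- Otherwise P ≤ P u³ ≤ 2, against Δ ≥ 3.
    u<1 : u < 1ℚ
    u<1 = ℚ.≰⇒> λ 1≤u → ℚ.<-irrefl refl (begin-strict
      2ℚ                      <⟨ from-yes (2ℚ ℚ.<? 3ℚ) ⟩
      3ℚ                      ≤⟨ 3≤P ⟩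
      P                       ≡⟨ ℚ.*-identityʳ P ⟨
      P * 1ℚ                  ≤⟨ *-monoˡ P 0≤P (cube-mono {1ℚ} 0≤1 1≤u) ⟩
      c                       ≤⟨ c≤2 ⟩
      2ℚ                      ∎)
      where open ℚ.≤-Reasoning

    -- A crude bound u ≥ 1 / Δ, enough to make the slack of order u² dominate a tolerance of order 1
    -- / Δ².
    1≤Pu : 1ℚ ≤ P * u
    1≤Pu = begin
      1ℚ                      ≤⟨ 1≤c ⟩
      P * (u * u * u)         ≤⟨ *-monoˡ P 0≤P (*-monoʳ {q = 1ℚ} u 0≤u (*-mono {q = 1ℚ} {s = 1ℚ} 0≤u 0≤1 (ℚ.<⇒≤ u<1) (ℚ.<⇒≤ u<1))) ⟩
      P * (1ℚ * u)            ≡⟨ cong (P *_) (ℚ.*-identityˡ u) ⟩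
      P * u                   ∎
      where open ℚ.≤-Reasoning

    0<x : 0ℚ < x
    0<x = 0<q-p u<1

    x<1 : x < 1ℚ
    x<1 = subst (x <_) (ℚ.+-identityʳ 1ℚ) (ℚ.+-monoʳ-< 1ℚ (ℚ.neg-antimono-< 0<u))

    1-x≡u : 1ℚ - x ≡ u
    1-x≡u = solve 1 (λ u → con 1ℚ :- (con 1ℚ :- u) := u) refl u

    -- `c` misses 2 by at most 18η and f ≤ 8, so the error is at most 144η. With η = 1 / (72 P²)
    -- this is 2 / P², hence at most 2 u² and at most 2 c u². The constant 72 is chosen for this.
    near-optimal : 2ℚ * (4ℚ * (x * s)) ≤ c * (4ℚ * (x * s)) + 2ℚ * (c * (u * u))
    near-optimal = begin
      2ℚ * f
        ≡⟨ solve 2 (λ η f → con 2ℚ :* f := (con 2ℚ :- con 18ℚ :* η) :* f :+ con 18ℚ :* η :* f) refl η f ⟩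
      (2ℚ - 18ℚ * η) * f + 18ℚ * η * f
        ≤⟨ ℚ.+-mono-≤ (*-monoʳ f 0≤f 2-18η≤c) error ⟩
      c * f + 2ℚ * (c * (u * u)) ∎
      where
      open ℚ.≤-Reasoning
      f : ℚ
      f = 4ℚ * (x * s)
      0≤x : 0ℚ ≤ x
      0≤x = ℚ.<⇒≤ 0<x
      x≤1 : x ≤ 1ℚ
      x≤1 = ℚ.<⇒≤ x<1
      0≤f : 0ℚ ≤ f
      0≤f = *-nonNeg (from-yes (0ℚ ℚ.≤? 4ℚ)) (*-nonNeg 0≤x (+-nonNeg 0≤1 (*-nonNeg 0≤x 0≤x)))
      f≤8 : f ≤ 8ℚ
      f≤8 = *-monoˡ {q = 2ℚ} 4ℚ (from-yes (0ℚ ℚ.≤? 4ℚ)) (*-mono {q = 1ℚ} {s = 2ℚ} 0≤x 0≤2 x≤1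
        (ℚ.+-monoʳ-≤ 1ℚ (*-mono {q = 1ℚ} {s = 1ℚ} 0≤x 0≤1 x≤1 x≤1)))
      error : 18ℚ * η * f ≤ 2ℚ * (c * (u * u))
      error = begin
        18ℚ * η * f                             ≤⟨ *-monoˡ (18ℚ * η) (*-nonNeg (from-yes (0ℚ ℚ.≤? 18ℚ)) 0≤η) f≤8 ⟩
        18ℚ * η * 8ℚ                            ≡⟨ solve 1 (λ η → con 18ℚ :* η :* con 8ℚ := con 144ℚ :* η :* (con 1ℚ :* con 1ℚ)) refl η ⟩
        144ℚ * η * (1ℚ * 1ℚ)                    ≤⟨ *-monoˡ (144ℚ * η) (*-nonNeg (from-yes (0ℚ ℚ.≤? 144ℚ)) 0≤η)
                                                     (*-mono 0≤1 (*-nonNeg 0≤P 0≤u) 1≤Pu 1≤Pu) ⟩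
        144ℚ * η * ((P * u) * (P * u))          ≡⟨ solve 3 (λ η P u → con 144ℚ :* η :* ((P :* u) :* (P :* u))
                                                     := con 2ℚ :* ((η :* (con 72ℚ :* (P :* P))) :* (u :* u))) refl η P u ⟩
        2ℚ * ((η * (72ℚ * (P * P))) * (u * u))  ≡⟨ cong (λ z → 2ℚ * (z * (u * u))) 72ηPP≡1 ⟩
        2ℚ * (1ℚ * (u * u))                     ≤⟨ *-monoˡ 2ℚ 0≤2 (*-monoʳ (u * u) (*-nonNeg 0≤u 0≤u) 1≤c) ⟩
        2ℚ * (c * (u * u))                      ∎

    v : ℚ
    v = d - t

    Zv≡x : Z * v ≡ x
    Zv≡x = trans (solve 3 (λ Z d t → Z :* (d :- t) := Z :* d :- t :* Z) refl Z d t) (cong (_- t * Z) Zd≡1)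

    0<v : 0ℚ < v
    0<v = *-cancel-<ˡ Z (ℚ.<⇒≤ 0<Z) (subst₂ _<_ (sym (ℚ.*-zeroʳ Z)) (sym Zv≡x) 0<x)

    e : ℚ
    e = ½ * (u * (1ℚ + x))

    1-e≡ : 1ℚ - e ≡ ½ * s
    1-e≡ = solve 1 (λ u → let x = con 1ℚ :- u in
      con 1ℚ :- con ½ :* (u :* (con 1ℚ :+ x)) := con ½ :* (con 1ℚ :+ x :* x)) refl u

    0<e : 0ℚ < e
    0<e = *-pos (from-yes (0ℚ ℚ.<? ½)) (*-pos 0<u (ℚ.+-mono-< 0<1 0<x))

    0<1-e : 0ℚ < 1ℚ - e
    0<1-e = subst (0ℚ <_) (sym 1-e≡) (*-pos (from-yes (0ℚ ℚ.<? ½)) (ℚ.+-mono-<-≤ 0<1 (*-nonNeg (ℚ.<⇒≤ 0<x) (ℚ.<⇒≤ 0<x))))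

    module _ (J : ℚ) (Jv≡1 : J * v ≡ 1ℚ) where

      -- The bound with every root rounded so as to lower it: the cube root of 4 up to a² in the
      -- divisor and down to t² in the numerator, that of Δ^5 down to P² Z, and the difference of
      -- roots up to `v`. Since J x = Z, it equals P² (1 + 3u / 2 + u² / (1 - u)) at the rational
      -- `u`.
      R : ℚ
      R = P * P + 3ℚ * (A * A) * (P * P * Z) + (t * t) * (P * P * Z) * J

      2Rx≡ : 2ℚ * (R * x) ≡ P * P * (2ℚ + x - x * x)
      2Rx≡ = begin
        2ℚ * (R * x)
          ≡⟨ solve 5 (λ P A Z J x → let t = con 2ℚ :* (A :* A) in
               con 2ℚ :* ((P :* P :+ con 3ℚ :* (A :* A) :* (P :* P :* Z) :+ (t :* t) :* (P :* P :* Z) :* J) :* x)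
               := P :* P :* (con 2ℚ :* x :+ con 3ℚ :* (t :* Z) :* x :+ con 2ℚ :* ((t :* Z) :* t :* (J :* x)))) refl P A Z J x ⟩
        P * P * (2ℚ * x + 3ℚ * u * x + 2ℚ * (u * t * (J * x)))
          ≡⟨ cong (λ z → P * P * (2ℚ * x + 3ℚ * u * x + 2ℚ * (u * t * z))) Jx≡Z ⟩
        P * P * (2ℚ * x + 3ℚ * u * x + 2ℚ * (u * t * Z))
          ≡⟨ solve 3 (λ P t Z → let u = t :* Z ; x = con 1ℚ :- u in
               P :* P :* (con 2ℚ :* x :+ con 3ℚ :* u :* x :+ con 2ℚ :* (u :* t :* Z))
               := P :* P :* (con 2ℚ :+ x :- x :* x)) refl P t Z ⟩
        P * P * (2ℚ + x - x * x) ∎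
        where
        open ≡-Reasoning
        Jx≡Z : J * x ≡ Z
        Jx≡Z = trans (cong (J *_) (sym Zv≡x)) (trans (solve 3 (λ J Z v → J :* (Z :* v) := J :* v :* Z) refl J Z v)
          (trans (cong (_* Z) Jv≡1) (ℚ.*-identityˡ Z)))

      optimised : ∀ K → R ≤ K → P * P * (e * e) + P * (1ℚ - e) ≤ K * (e * e * (1ℚ - e))
      optimised K R≤K = subst (λ z → P * P * (e * e) + P * z ≤ K * (e * e * z)) (sym 1-e≡)
        (subst (λ z → P * P * ((½ * (z * (1ℚ + x))) * (½ * (z * (1ℚ + x)))) + P * (½ * s)
                      ≤ K * ((½ * (z * (1ℚ + x))) * (½ * (z * (1ℚ + x))) * (½ * s))) 1-x≡u
          (growth-factor P K x 0<P 0<x x<1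
            (subst (_≤ 2ℚ * (K * x)) 2Rx≡ (*-monoˡ 2ℚ 0≤2 (*-monoʳ x (ℚ.<⇒≤ 0<x) R≤K)))
            (subst (λ z → 2ℚ * (4ℚ * (x * s)) ≤ P * (z * z * z) * (4ℚ * (x * s)) + 2ℚ * (P * (z * z * z) * (z * z)))
              (sym 1-x≡u) near-optimal)))

  -- From the real bound to an integral growth condition.

  Witness : ℕ → ℤ → Set
  Witness Δ k = ∃[ e ] 0ℚ < e × 0ℚ < 1ℚ - e ×
    ι Δ * ι Δ * (e * e) + ι Δ * (1ℚ - e) ≤ (k / 1) * (e * e * (1ℚ - e))

  module _ (Δ : ℕ) (3≤Δ : 3 ℕ.≤ Δ) (a A d Z η : ℚ) (3≤P : 3ℚ ≤ ι Δ)
    (0<A : 0ℚ < A) (Aa≡1 : A * a ≡ 1ℚ) (2≤a³ : 2ℚ ≤ a * a * a) (a³≤ : a * a * a * (1ℚ - 3ℚ * η) ≤ 2ℚ)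
    (0<Z : 0ℚ < Z) (Zd≡1 : Z * d ≡ 1ℚ) (P≤d³ : ι Δ ≤ d * d * d) (d³≤ : d * d * d * (1ℚ - 3ℚ * η) ≤ ι Δ)
    (0<η : 0ℚ < η) (72ηPP≡1 : η * (72ℚ * (ι Δ * ι Δ)) ≡ 1ℚ) where

    open Approximation (ι Δ) a A d Z η 3≤P 0<A Aa≡1 2≤a³ a³≤ 0<Z Zd≡1 P≤d³ d³≤ 0<η 72ηPP≡1

    private
      P f : ℚ
      P = ι Δ
      f = P * P * Z

      0<f : 0ℚ < f
      0<f = *-pos (*-pos 0<P 0<P) 0<Z

      ι-Δ^2 : ι (Δ ℕ.^ 2) ≡ P * P
      ι-Δ^2 = trans (ι-* Δ (Δ ℕ.* 1)) (cong (λ n → P * ι n) (ℕ.*-identityʳ Δ))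

      ι-Δ^5 : ι (Δ ℕ.^ 5) ≡ P * (P * (P * (P * P)))
      ι-Δ^5 = trans (ι-* Δ (Δ ℕ.^ 4)) (cong (P *_) (trans (ι-* Δ (Δ ℕ.^ 3)) (cong (P *_)
        (trans (ι-* Δ (Δ ℕ.^ 2)) (cong (P *_) ι-Δ^2)))))

      f³≤ : f * f * f ≤ ι (Δ ℕ.^ 5)
      f³≤ = begin
        f * f * f                                ≡⟨ solve 2 (λ P Z → let f = P :* P :* Z in
                                                      f :* f :* f := P :* (P :* (P :* (P :* P))) :* (P :* (Z :* Z :* Z))) refl P Z ⟩
        P * (P * (P * (P * P))) * C              ≤⟨ *-monoˡ (P * (P * (P * (P * P))))
                                                      (*-nonNeg 0≤P (*-nonNeg 0≤P (*-nonNeg 0≤P (*-nonNeg 0≤P 0≤P)))) C≤1 ⟩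
        P * (P * (P * (P * P))) * 1ℚ             ≡⟨ trans (ℚ.*-identityʳ _) (sym ι-Δ^5) ⟩
        ι (Δ ℕ.^ 5)                              ∎
        where open ℚ.≤-Reasoning

      -- Squares of bounds for the cube root of 2 become bounds for that of 4.
      sixth-power : ∀ p → p * p * (p * p) * (p * p) ≡ p * p * p * (p * p * p)
      sixth-power = solve 1 (λ p → p :* p :* (p :* p) :* (p :* p) := p :* p :* p :* (p :* p :* p)) refl

      4≤[aa]³ : ι (2 ℕ.^ 2) ≤ (a * a) * (a * a) * (a * a)
      4≤[aa]³ = subst (4ℚ ≤_) (sym (sixth-power a)) (*-mono {2ℚ} 0≤2 (ℚ.≤-trans 0≤2 2≤a³) 2≤a³ 2≤a³)

      [tt]³≤4 : (t * t) * (t * t) * (t * t) ≤ ι (2 ℕ.^ 2)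
      [tt]³≤4 = subst (_≤ 4ℚ) (sym (sixth-power t)) (*-mono {q = 2ℚ} {s = 2ℚ} 0≤t³ 0≤2 t³≤2 t³≤2)
        where
        0≤t³ : 0ℚ ≤ t * t * t
        0≤t³ = ℚ.<⇒≤ (*-pos (*-pos 0<t 0<t) 0<t)

      AA·aa≡1 : A * A * (a * a) ≡ 1ℚ
      AA·aa≡1 = trans (solve 2 (λ A a → A :* A :* (a :* a) := (A :* a) :* (A :* a)) refl A a) (cong (λ z → z * z) Aa≡1)

    bound-lower : ∀ J → 0ℚ < J → (Jv≡1 : J * v ≡ 1ℚ) → LowerBound (bound Δ 3≤Δ) (R J Jv≡1)
    bound-lower J 0<J Jv≡1 = lower-expression
      (fromℕ (Δ ℕ.^ 2)) (fromℕ 3) (∛ (2 ℕ.^ 2)) (∛ (Δ ℕ.^ 5)) (∛ Δ) (∛ 2)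
      (∛-positive (2 ℕ.^ 2) (s≤s z≤n)) (∛2<∛ Δ 3≤Δ) {u₄ = d} {a₅ = t}
      (from-yes (0ℚ ℚ.<? 3ℚ)) (*-pos 0<t 0<t) 0<f (*-pos 0<A 0<A) 0<J AA·aa≡1 Jv≡1
      (subst (LowerBound (fromℕ (Δ ℕ.^ 2))) ι-Δ^2 (lower-fromℕ (Δ ℕ.^ 2))) (lower-fromℕ 3)
      (lower-∛ (2 ℕ.^ 2) [tt]³≤4) (upper-∛ (2 ℕ.^ 2) 4≤[aa]³) (lower-∛ (Δ ℕ.^ 5) f³≤)
      (upper-∛ Δ P≤d³) (lower-∛ 2 t³≤2)

    witness : ∀ k → bound Δ 3≤Δ ≤ᵣ fromℤ k → Witness Δ k
    witness k bound≤k =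
      let (J , 0<J , Jv≡1) = reciprocal v 0<v
      in e , 0<e , 0<1-e ,
         optimised J Jv≡1 (k / 1) (lower≤ᵣ (bound Δ 3≤Δ) k (bound-lower J 0<J Jv≡1) bound≤k)

  bound⇒witness : ∀ Δ 3≤Δ k → bound Δ 3≤Δ ≤ᵣ fromℤ k → Witness Δ k
  bound⇒witness Δ 3≤Δ k bound≤k =
    let (η , 0<η , 72ηPP≡1) = reciprocal (72ℚ * (ι Δ * ι Δ)) (*-pos (from-yes (0ℚ ℚ.<? 72ℚ)) (*-pos 0<P 0<P))
        η≤1 = ℚ.≤-trans (subst (_≤ 18ℚ * η) (ℚ.*-identityˡ η) (*-monoʳ η (ℚ.<⇒≤ 0<η) (from-yes (1ℚ ℚ.≤? 18ℚ))))
                (tolerance-bound 3≤P 0<η 72ηPP≡1)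
        (a , 1≤a , 2≤a³ , a³≤) = ∛-approximation 2 η (s≤s z≤n) 0<η η≤1
        (d , 1≤d , P≤d³ , d³≤) = ∛-approximation Δ η (ℕ.≤-trans (s≤s z≤n) 3≤Δ) 0<η η≤1
        (A , 0<A , Aa≡1) = reciprocal a (ℚ.<-≤-trans 0<1 1≤a)
        (Z , 0<Z , Zd≡1) = reciprocal d (ℚ.<-≤-trans 0<1 1≤d)
    in witness Δ 3≤Δ a A d Z η 3≤P 0<A Aa≡1 2≤a³ a³≤ 0<Z Zd≡1 P≤d³ d³≤ 0<η 72ηPP≡1 k bound≤k
    where
    3≤P : 3ℚ ≤ ι Δ
    3≤P = ι-mono-≤ 3≤Δ
    0<P : 0ℚ < ι Δ
    0<P = ℚ.<-≤-trans (from-yes (0ℚ ℚ.<? 3ℚ)) 3≤P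

  ι-positive : ∀ {n} → 0 ℕ.< n → 0ℚ < ι n
  ι-positive 0<n = ℚ.<-≤-trans 0<1 (ι-mono-≤ 0<n)

  ι-cancel-positive : ∀ {n} → 0ℚ < ι n → 0 ℕ.< n
  ι-cancel-positive {zero}  0<0 = contradiction 0<0 (ℚ.<-irrefl refl)
  ι-cancel-positive {suc n} _   = s≤s z≤n

  0≤/1⇒natural : ∀ k → 0ℚ ≤ k / 1 → ∃[ n ] k ≡ + n
  0≤/1⇒natural (+ n)    _   = n , refl
  0≤/1⇒natural -[1+ n ] 0≤k = contradiction (/1-cancel-≤ {+ 0} { -[1+ n ]} 0≤k) λ ()

  Sufficient : ℕ → ℕ → ℕ → ℕ → Set
  Sufficient Δ n X E =
    Δ ℕ.* Δ ℕ.* (X ℕ.+ E) ℕ.* (E ℕ.* E) ℕ.+ Δ ℕ.* ((X ℕ.+ E) ℕ.* (X ℕ.+ E)) ℕ.* X ℕ.≤ X ℕ.* (E ℕ.* E) ℕ.* n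

  -- With e = E / D and X = D - E, multiplication by D³ makes both sides integral. That `k` is a
  -- natural number follows from the inequality, whose left side is positive.
  integral-witness : ∀ Δ k → 0 ℕ.< Δ → Witness Δ k →
    ∃[ n ] k ≡ + n × ∃₂ λ X E → 0 ℕ.< X × 0 ℕ.< E × Sufficient Δ n X E
  integral-witness Δ k 0<Δ (e , 0<e , 0<1-e , inequality) = let (n , k≡n) = 0≤/1⇒natural k 0≤k in n , k≡n , X , E , 0<X , 0<E , sufficient n k≡n
    where
    P : ℚ
    P = ι Δ
    0<P : 0ℚ < P
    0<P = ι-positive 0<Δ
    E D X : ℕ
    E = proj₁ (fraction e 0<e)
    D = proj₁ (proj₂ (fraction e 0<e))
    X = D ℕ.∸ E
    0<ιD : 0ℚ < ι D
    0<ιD = ι-positive (proj₁ (proj₂ (proj₂ (fraction e 0<e))))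
    eD≡E : e * ι D ≡ ι E
    eD≡E = proj₂ (proj₂ (proj₂ (fraction e 0<e)))
    [1-e]D≡D-E : (1ℚ - e) * ι D ≡ ι D - ι E
    [1-e]D≡D-E = trans (solve 2 (λ e D → (con 1ℚ :- e) :* D := D :- e :* D) refl e (ι D)) (cong (λ z → ι D - z) eD≡E)
    0<E : 0 ℕ.< E
    0<E = ι-cancel-positive (subst (0ℚ <_) eD≡E (*-pos 0<e 0<ιD))
    0<D-E : 0ℚ < ι D - ι E
    0<D-E = subst (0ℚ <_) [1-e]D≡D-E (*-pos 0<1-e 0<ιD)
    E≤D : E ℕ.≤ D
    E≤D = ι-cancel-≤ (subst₂ _≤_ (ℚ.+-identityˡ (ι E)) (solve 2 (λ D E → D :- E :+ E := D) refl (ι D) (ι E))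
      (ℚ.+-monoˡ-≤ (ι E) (ℚ.<⇒≤ 0<D-E)))
    X+E≡D : X ℕ.+ E ≡ D
    X+E≡D = ℕ.m∸n+n≡m E≤D
    [1-e]D≡X : (1ℚ - e) * ι D ≡ ι X
    [1-e]D≡X = begin
      (1ℚ - e) * ι D        ≡⟨ [1-e]D≡D-E ⟩
      ι D - ι E             ≡⟨ cong (λ m → ι m - ι E) X+E≡D ⟨
      ι (X ℕ.+ E) - ι E     ≡⟨ cong (_- ι E) (ι-+ X E) ⟩
      ι X + ι E - ι E       ≡⟨ solve 2 (λ X E → X :+ E :- E := X) refl (ι X) (ι E) ⟩
      ι X                   ∎
      where open ≡-Reasoning
    0<X : 0 ℕ.< X
    0<X = ι-cancel-positive (subst (0ℚ <_) [1-e]D≡X (*-pos 0<1-e 0<ιD))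
    ι-left : ι (Δ ℕ.* Δ ℕ.* D ℕ.* (E ℕ.* E) ℕ.+ Δ ℕ.* (D ℕ.* D) ℕ.* X) ≡
             P * P * ι D * (ι E * ι E) + P * (ι D * ι D) * ι X
    ι-left = trans (ι-+ (Δ ℕ.* Δ ℕ.* D ℕ.* (E ℕ.* E)) _) (cong₂ _+_
      (trans (ι-* (Δ ℕ.* Δ ℕ.* D) (E ℕ.* E)) (cong₂ _*_
        (trans (ι-* (Δ ℕ.* Δ) D) (cong (_* ι D) (ι-* Δ Δ))) (ι-* E E)))
      (trans (ι-* (Δ ℕ.* (D ℕ.* D)) X) (cong (_* ι X)
        (trans (ι-* Δ (D ℕ.* D)) (cong (P *_) (ι-* D D))))))
    ι-right : ∀ n → ι (X ℕ.* (E ℕ.* E) ℕ.* n) ≡ ι X * (ι E * ι E) * ι n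
    ι-right n = trans (ι-* (X ℕ.* (E ℕ.* E)) n) (cong (_* ι n)
      (trans (ι-* X (E ℕ.* E)) (cong (ι X *_) (ι-* E E))))
    scale-left : (P * P * (e * e) + P * (1ℚ - e)) * (ι D * ι D * ι D) ≡ P * P * ι D * (ι E * ι E) + P * (ι D * ι D) * ι X
    scale-left = trans
      (solve 4 (λ P e f D → (P :* P :* (e :* e) :+ P :* f) :* (D :* D :* D)
        := P :* P :* D :* ((e :* D) :* (e :* D)) :+ P :* (D :* D) :* (f :* D)) refl P e (1ℚ - e) (ι D))
      (cong₂ (λ E X → P * P * ι D * (E * E) + P * (ι D * ι D) * X) eD≡E [1-e]D≡X)
    scale-right : ∀ K → K * (e * e * (1ℚ - e)) * (ι D * ι D * ι D) ≡ ι X * (ι E * ι E) * K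
    scale-right K = trans
      (solve 4 (λ K e f D → K :* (e :* e :* f) :* (D :* D :* D)
        := (f :* D) :* ((e :* D) :* (e :* D)) :* K) refl K e (1ℚ - e) (ι D))
      (cong₂ (λ E X → X * (E * E) * K) eD≡E [1-e]D≡X)
    0≤D³ : 0ℚ ≤ ι D * ι D * ι D
    0≤D³ = ℚ.<⇒≤ (*-pos (*-pos 0<ιD 0<ιD) 0<ιD)
    0≤k : 0ℚ ≤ k / 1
    0≤k = *-cancel-≤ʳ (e * e * (1ℚ - e)) (*-pos (*-pos 0<e 0<e) 0<1-e)
      (subst (_≤ (k / 1) * (e * e * (1ℚ - e))) (sym (ℚ.*-zeroˡ (e * e * (1ℚ - e))))
        (ℚ.≤-trans (+-nonNeg (ℚ.<⇒≤ (*-pos (*-pos 0<P 0<P) (*-pos 0<e 0<e))) (ℚ.<⇒≤ (*-pos 0<P 0<1-e))) inequality))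
    scaled : P * P * ι D * (ι E * ι E) + P * (ι D * ι D) * ι X ≤ ι X * (ι E * ι E) * (k / 1)
    scaled = subst₂ _≤_ scale-left (scale-right (k / 1)) (*-monoʳ (ι D * ι D * ι D) 0≤D³ inequality)
    numerators : ∀ n → k / 1 ≡ ι n →
      Δ ℕ.* Δ ℕ.* D ℕ.* (E ℕ.* E) ℕ.+ Δ ℕ.* (D ℕ.* D) ℕ.* X ℕ.≤ X ℕ.* (E ℕ.* E) ℕ.* n
    numerators n eq = ι-cancel-≤ {Δ ℕ.* Δ ℕ.* D ℕ.* (E ℕ.* E) ℕ.+ Δ ℕ.* (D ℕ.* D) ℕ.* X} {X ℕ.* (E ℕ.* E) ℕ.* n}
      (subst₂ _≤_ (sym ι-left) (trans (cong (ι X * (ι E * ι E) *_) eq) (sym (ι-right n))) scaled)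
    sufficient : ∀ n → k ≡ + n → Sufficient Δ n X E
    sufficient n k≡n =
      subst (λ D → Δ ℕ.* Δ ℕ.* D ℕ.* (E ℕ.* E) ℕ.+ Δ ℕ.* (D ℕ.* D) ℕ.* X ℕ.≤ X ℕ.* (E ℕ.* E) ℕ.* n)
        (sym X+E≡D) (numerators n (cong (_/ 1) k≡n))

-- The choice number against the ceiling.

open import Data.Integer using (ℤ; +_; +≤+) renaming (_≤_ to _≤ᶻ_)
open import Data.Nat using (_≤_; s≤s; z≤n)
open import Data.Nat.Properties using (≤-trans)
open import Data.Product using (_,_)
open import Relation.Binary.PropositionalEquality using (sym; subst)
open Graph using (maxDegree)
open Combinatorics using (sufficient⇒πₗ≤)
open Analysis using (bound⇒witness; integral-witness)

theorem5 : (G : Graph) (3≤Δ : 3 ≤ maxDegree G) (k : ℤ) →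
    IsCeiling (bound (maxDegree G) 3≤Δ) k → + πₗ G ≤ᶻ k
theorem5 G 3≤Δ k (bound≤k , _) =
  let 0<Δ = ≤-trans (s≤s z≤n) 3≤Δ
      (n , k≡n , X , E , 0<X , 0<E , enough) =
        integral-witness (maxDegree G) k 0<Δ (bound⇒witness (maxDegree G) 3≤Δ k bound≤k)
  in subst (+ πₗ G ≤ᶻ_) (sym k≡n) (+≤+ (sufficient⇒πₗ≤ G 0<Δ X E 0<X 0<E n enough))
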